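{- There is a countably categorical structure $N$ in a finite first-order language such that $Th(N)$ is not G-compact.
   Context: A countable structure is countably categorical ($\omega$-categorical) if its complete theory has, up to isomorphism, exactly one countable model. Let $\mathbf{C}$ be a monster model of a complete theory. For $\delta\in\{1,2,\dots,\omega\}$ let $E_L^{\delta}$ be the finest bounded $Aut(\mathbf{C})$-invariant equivalence relation on $\delta$-tuples of $\mathbf{C}$ (bounded means that the cardinality of the set of classes is bounded, i.e. small compared with the monster model), and let $E_{KP}^{\delta}$ be the finest bounded type-definable (over $\emptyset$) equivalence relation on $\delta$-tuples. The theory $Th(\mathbf{C})$ is called G-compact if $E_L^{\delta}=E_{KP}^{\delta}$ for all $\delta\in\{1,2,\dots,\omega\}$. -}

module Defs where

open import Data.Empty.Polymorphic using (⊥)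
open import Data.Fin.Base using (Fin; zero)
open import Data.List.Base using (List)
open import Data.List.Relation.Unary.All using (All)
open import Data.Maybe.Base using (Maybe; maybe′)
open import Data.Nat.Base using (ℕ; suc)
open import Data.Product.Base using (Σ; ∃; ∃-syntax; _×_; _,_)
open import Data.Sum.Base using (_⊎_; [_,_]′)
open import Data.Vec.Functional using (Vector; []; _∷_)
open import Function.Base using (_∘_)
open import Function.Bundles using (_↔_; _↣_; _⇔_; Inverse)
open import Level using (Level; 0ℓ; _⊔_) renaming (suc to lsuc)
open import Relation.Binary.Core using (Rel; _⇒_) renaming (_⇔_ to _≐_)
open import Relation.Binary.PropositionalEquality.Core using (_≡_)
open import Relation.Binary.Structures using (IsEquivalence)
open import Relation.Unary using (Pred)

private
  variable
    c d ℓ : Level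

------------------------------------------------------------------------
-- First-order logic with equality

-- Constants are function symbols of arity 0.
record Language : Set₁ where
  field
    Func     : Set
    funArity : Func → ℕ
    Rels     : Set
    relArity : Rels → ℕ

IsFinite : Language → Set
IsFinite L = (∃[ m ] (Func ↔ Fin m)) × (∃[ n ] (Rels ↔ Fin n))
  where open Language L

module _ (L : Language) where
  open Language L

  data Term (n : ℕ) : Set where
    var : Fin n → Term n
    app : (f : Func) → Vector (Term n) (funArity f) → Term n

  -- De Bruijn indices: Formula n has its free variables in Fin n, and
  -- `all` binds index zero.  The other connectives and ∃ are the usual
  -- classical abbreviations.
  data Formula : ℕ → Set where
    false : ∀ {n} → Formula n
    equal : ∀ {n} → Term n → Term n → Formula n
    rel   : ∀ {n} (r : Rels) → Vector (Term n) (relArity r) → Formula n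
    imp   : ∀ {n} → Formula n → Formula n → Formula n
    all   : ∀ {n} → Formula (suc n) → Formula n

  Sentence : Set
  Sentence = Formula 0

  Theory : Set₁
  Theory = Pred Sentence 0ℓ

  -- A formula whose free variables are named by elements of V, which may
  -- be infinite; each formula mentions only finitely many of them.
  FormulaOver : Set → Set
  FormulaOver V = Σ ℕ λ n → Formula n × Vector V n

  PartialType : Set → Set₁
  PartialType V = Pred (FormulaOver V) 0ℓ

  record Structure c : Set (lsuc c) where
    field
      Carrier  : Set c
      nonempty : Carrier
      func     : (f : Func) → Vector Carrier (funArity f) → Carrier
      relation : (r : Rels) → Pred (Vector Carrier (relArity r)) c

module _ {L : Language} where
  open Language L
  open Structure

  eval : (M : Structure L c) {n : ℕ} → Vector (Carrier M) n →
         Term L n → Carrier M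
  eval M ρ (var i)    = ρ i
  eval M ρ (app f ts) = func M f λ i → eval M ρ (ts i)

  infix 4 _⊨_[_] _⊨_ _⊨ₜ_

  _⊨_[_] : (M : Structure L c) {n : ℕ} → Formula L n →
           Vector (Carrier M) n → Set c
  M ⊨ false     [ ρ ] = ⊥
  M ⊨ equal s t [ ρ ] = eval M ρ s ≡ eval M ρ t
  M ⊨ rel r ts  [ ρ ] = relation M r λ i → eval M ρ (ts i)
  M ⊨ imp φ ψ   [ ρ ] = M ⊨ φ [ ρ ] → M ⊨ ψ [ ρ ]
  M ⊨ all φ     [ ρ ] = ∀ x → M ⊨ φ [ x ∷ ρ ]

  _⊨_ : Structure L c → Sentence L → Set c
  M ⊨ φ = M ⊨ φ [ [] ]

  _⊨ₜ_ : Structure L c → Theory L → Set c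
  M ⊨ₜ T = ∀ φ → T φ → M ⊨ φ

  Th : Structure L 0ℓ → Theory L
  Th M φ = M ⊨ φ

  Satisfies : (M : Structure L c) {V : Set} → (V → Carrier M) →
              FormulaOver L V → Set c
  Satisfies M ρ (n , φ , v) = M ⊨ φ [ ρ ∘ v ]

  Realises : (M : Structure L c) {V : Set} → (V → Carrier M) →
             PartialType L V → Set c
  Realises M ρ Φ = ∀ φ → Φ φ → Satisfies M ρ φ

  record _≅_ (M : Structure L c) (N : Structure L d) : Set (c ⊔ d) where
    field
      bijection : Carrier M ↔ Carrier N
    open Inverse bijection public using (to; from)
    field
      pres-func     : ∀ f xs → to (func M f xs) ≡ func N f (to ∘ xs)
      pres-relation : ∀ r xs → relation M r xs ⇔ relation N r (to ∘ xs)

  Aut : Structure L c → Set c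
  Aut M = M ≅ M

  ----------------------------------------------------------------------
  -- Countable categoricity

  Countable : Structure L 0ℓ → Set
  Countable M = Carrier M ↣ ℕ

  CountableModel : Theory L → Structure L 0ℓ → Set
  CountableModel T M = Countable M × M ⊨ₜ T

  CountablyCategorical : Structure L 0ℓ → Set₁
  CountablyCategorical N =
    Countable N ×
    (∃[ M ] (CountableModel (Th N) M ×
             (∀ M′ → CountableModel (Th N) M′ → M′ ≅ M)))

  ----------------------------------------------------------------------
  -- Monster models

  -- The universe Set plays the role of the strongly inaccessible cardinal
  -- attached to the monster: "small" means indexed by a type in Set, while
  -- the monster itself lives in Set₁.

  -- In the type Φ below, `just i` names the parameter `p i` and `nothing`
  -- is the variable to be realised.
  Saturated : Structure L (lsuc 0ℓ) → Set₁
  Saturated C =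
    (I : Set) (p : I → Carrier C) (Φ : PartialType L (Maybe I)) →
    (∀ (φs : List (FormulaOver L (Maybe I))) → All Φ φs →
       ∃[ x ] All (Satisfies C (maybe′ p x)) φs) →
    ∃[ x ] Realises C (maybe′ p x) Φ

  StronglyHomogeneous : Structure L (lsuc 0ℓ) → Set₁
  StronglyHomogeneous C =
    (I : Set) (a b : I → Carrier C) →
    (∀ φ → Satisfies C a φ ⇔ Satisfies C b φ) →
    Σ (Aut C) λ σ → ∀ i → _≅_.to σ (a i) ≡ b i

  record IsMonster (T : Theory L) (C : Structure L (lsuc 0ℓ)) : Set₁ where
    field
      isModel             : C ⊨ₜ T
      saturated           : Saturated C
      stronglyHomogeneous : StronglyHomogeneous C

------------------------------------------------------------------------
-- Lengths δ ∈ {1, 2, …, ω}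

data TupleLength : Set where
  1+_ : ℕ → TupleLength
  ω   : TupleLength

Index : TupleLength → Set
Index (1+ n) = Fin (suc n)
Index ω      = ℕ

------------------------------------------------------------------------
-- Strong types and G-compactness

module _ {L : Language} (C : Structure L (lsuc 0ℓ)) (δ : TupleLength) where
  open Structure C using (Carrier)

  Tuple : Set₁
  Tuple = Index δ → Carrier

  TupleRel : Set₂
  TupleRel = Rel Tuple (lsuc 0ℓ)

  -- The set of classes is small: a small family of tuples meets them all.
  Bounded : TupleRel → Set₁
  Bounded E = Σ Set λ I → Σ (I → Tuple) λ r → ∀ a → ∃[ i ] E a (r i)

  Invariant : TupleRel → Set₁
  Invariant E = ∀ (σ : Aut C) a b → E a b → E (_≅_.to σ ∘ a) (_≅_.to σ ∘ b)

  TypeDefinable : TupleRel → Set₁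
  TypeDefinable E =
    Σ (PartialType L (Index δ ⊎ Index δ)) λ Φ →
    ∀ a b → E a b ⇔ Realises C [ a , b ]′ Φ

  BoundedInvariantEq : TupleRel → Set₁
  BoundedInvariantEq E = IsEquivalence E × Bounded E × Invariant E

  BoundedTypeDefinableEq : TupleRel → Set₁
  BoundedTypeDefinableEq E = IsEquivalence E × Bounded E × TypeDefinable E

  Finest : Pred TupleRel ℓ → Pred TupleRel (ℓ ⊔ lsuc (lsuc 0ℓ))
  Finest P E = P E × (∀ E′ → P E′ → E ⇒ E′)

  IsE-L : TupleRel → Set₂
  IsE-L = Finest BoundedInvariantEq

  IsE-KP : TupleRel → Set₂
  IsE-KP = Finest BoundedTypeDefinableEq

-- G-compactness does not depend on the choice of the monster model.  Since
-- the monster and the two relations are quantified universally, ¬ GCompact T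
-- is never vacuous: classically it provides a monster model in which E_L and
-- E_KP exist and differ for some δ.
GCompact : {L : Language} → Theory L → Set₂
GCompact T =
  ∀ C → IsMonster T C → ∀ δ (E-L E-KP : TupleRel C δ) →
  IsE-L C δ E-L → IsE-KP C δ E-KP → E-L ≐ E-KP

-- The monster model carries a linear order, thought of as a circle cut open, and for every n it
-- gives each injective (n+1)-tuple a colour, a point over the first entry of the tuple in a
-- 3ⁿ-fold connected cover of the circle.  Only a 5-ary relation dd belongs to the language.  A
-- point w may link two tuples e, e′, meaning dd w eᵢ e′ᵢ eⱼ e′ⱼ for all i, j; this is allowed only
-- if e′ lies less than one turn ahead of e in the cover, a condition independent of the cut.
-- The structures obeying this rule amalgamate, finitely many of them live on n points, and so the
-- dd-reduct of their generic structure is ω-categorical.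
--
-- Let α ~ β when some w links the injective sequences α and β.  The equivalence relation generated
-- by ~ is invariant, and bounded because two sequences with the same colours are both linked to a
-- third.  One step changes a colour by at most one, so α is not equivalent to β if the colours of
-- β differ from those of α by half n = (3ⁿ − 1)/2 in the n-th cover.  On the other hand, moving the
-- cut of the circle past a sequence raises all its colours by one without changing its type;
-- hence every bounded invariant equivalence relation identifies α with a sequence whose colours
-- are those of α plus an arbitrary integer.  As half m ≡ half n modulo 3ᵐ for m ≤ n, each formula
-- takes β for such a sequence, so a bounded type-definable relation cannot separate α from β.
--
-- Sets indexed by types in Set are called small.  The universe Set provides the class On of
-- ordinals, along which the monster is built by adding one point at a time.

module Submission where

open import Defs
open import Axiom.ExcludedMiddle using (ExcludedMiddle)
open import Axiom.Extensionality.Propositional using (Extensionality; ∀-extensionality)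
open import Axiom.UniquenessOfIdentityProofs.WithK using (uip)
open import Data.Bool.Base using (Bool; true; false; not; if_then_else_)
open import Data.Empty using (⊥; ⊥-elim)
open import Data.Fin.Base as Fin
  using (Fin; zero; suc; toℕ; fromℕ<; combine; remQuot; finToFun; funToFin)
open import Data.Fin.Properties
  using (toℕ<n; toℕ-fromℕ<; toℕ-injective; toℕ-inject≤; pigeonhole; <⇒≢; remQuot-combine;
         combine-injective; finToFun-funToFin)
open import Data.List.Base using (List; []; _∷_; _++_; mapMaybe; tabulate; lookup)
open import Data.List.Membership.Propositional using (_∈_)
open import Data.List.Membership.Propositional.Properties using (∈-++⁺ˡ; ∈-++⁺ʳ)
open import Data.List.Relation.Unary.All as All using (All; []; _∷_)
open import Data.List.Relation.Unary.All.Properties using (++⁺; ++⁻ˡ; ++⁻ʳ)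
open import Data.List.Relation.Unary.Any as Any using (here; there)
open import Data.List.Relation.Unary.Any.Properties using (lookup-index)
open import Data.Maybe.Base as Maybe using (Maybe; just; nothing; maybe′)
open import Data.Maybe.Properties using (just-injective)
open import Data.Nat.Base as ℕ using (ℕ; zero; suc; _+_; _*_; _≤_; z≤n; s≤s)
open import Data.Nat.DivMod using (_mod_; _%_; %-distribˡ-+; m%n%n≡m%n; [m+kn]%n≡m%n; m<n⇒m%n≡m)
import Data.Nat.Induction as ℕ
import Data.Nat.Properties as ℕ
open import Data.Product using (Σ; ∃; _×_; _,_; proj₁; proj₂)
open import Data.Sum using (_⊎_; inj₁; inj₂; [_,_]′; swap)
open import Data.Sum.Properties using (inj₁-injective; inj₂-injective)
open import Data.Unit.Polymorphic using (⊤)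
open import Data.Vec.Functional using (Vector) renaming (_∷_ to _◂_; [] to ⟨⟩)
open import Function.Base using (_∘_; case_of_; id; const)
open import Function.Bundles using (_⇔_; _↣_; mk⇔; mk↔ₛ′; mk↣; Equivalence; Inverse; Injection)
open import Function.Construct.Identity using (↔-id)
open import Induction.WellFounded as WF using (WellFounded; Acc; acc)
open import Level using (Level; _⊔_; Lift; lift; lower) renaming (suc to lsuc; zero to 0ℓ)
open import Relation.Binary.Construct.Closure.Equivalence as EqClosure using (EqClosure)
open import Relation.Binary.Construct.On using () renaming (wellFounded to on-wellFounded)
open import Relation.Binary.Definitions using (tri<; tri≈; tri>)
open import Relation.Binary.PropositionalEquality hiding ([_]; J)
open import Relation.Binary.Structures using (IsEquivalence)
open import Relation.Nullary using (¬_; Dec; yes; no; does)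

-- Infinitely many covers are needed to keep α and β apart, but the language must be finite. Hence
-- order and colours stay outside the language and act only through the rule for `dd`, a single
-- relation that governs linked tuples of every length. Among n points only the covers of index
-- below n carry colours, so a formula sees a finite part of the colouring, while an infinite
-- sequence sees all of it. The 3-adic integer -1/2 agrees with an integer modulo each 3ᵐ, which
-- defeats formulas; its distance from 0 in the covers is unbounded, which defeats finite chains of
-- links.
--
-- Smallness takes the place of cardinal arithmetic. A small family of ordinals is bounded, and a
-- request for a new point over a proper initial segment is an element of a small type, so a
-- bookkeeping enumeration meets all requests. The resulting one-point extension property over small
-- sets is the source of quantifier-free control, saturation and automorphisms alike.

private variable
  a b c d e ℓ ℓ′ ℓ″ : Level
  A B I V X Y Z : Set ℓ

-- Classical choice and transfinite recursion

module Classical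
  (em : ∀ {ℓ} → ExcludedMiddle ℓ)
  (fe : ∀ {a b} → Extensionality a b)
  where

  abstract
    -- `truth P ≡ true` lies in `Set` whatever the level of `P`, and it has at most one proof. This
    -- resizing keeps partial types and codes of relations small and makes subtypes of `On`
    -- proof-irrelevant.
    truth : Set ℓ → Bool
    truth P = does (em {P = P})

    truth⁺ : {P : Set ℓ} → P → truth P ≡ true
    truth⁺ {P = P} p with em {P = P}
    ... | yes _ = refl
    ... | no ¬p = ⊥-elim (¬p p)

    truth⁻ : {P : Set ℓ} → truth P ≡ true → P
    truth⁻ {P = P} eq with em {P = P}
    ... | yes p = p
    truth⁻ () | no _

    truth-false⁺ : {P : Set ℓ} → ¬ P → truth P ≡ false
    truth-false⁺ {P = P} ¬p with em {P = P}
    ... | yes p = ⊥-elim (¬p p)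
    ... | no _ = refl

    truth-cong : {P : Set a} {Q : Set b} → (P → Q) → (Q → P) → truth P ≡ truth Q
    truth-cong {P = P} f g with em {P = P}
    ... | yes p = sym (truth⁺ (f p))
    ... | no ¬p = sym (truth-false⁺ (¬p ∘ g))

  dne : {P : Set ℓ} → ¬ ¬ P → P
  dne {P = P} ¬¬p with em {P = P}
  ... | yes p = p
  ... | no ¬p = ⊥-elim (¬¬p ¬p)

  ¬∀⇒∃¬ : {P : A → Set ℓ} → ¬ (∀ x → P x) → ∃ λ x → ¬ P x
  ¬∀⇒∃¬ ¬all = dne λ ¬ex → ¬all λ x → dne λ ¬px → ¬ex (x , ¬px)

  abstract
    -- Excluded middle decides the type `∃ P` and so hands over a witness: this is global choice.
    -- The result depends only on `P` and the default, so equal predicates yield equal choices.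
    choose : (P : A → Set ℓ) → A → A
    choose P d with em {P = ∃ P}
    ... | yes (x , _) = x
    ... | no _ = d

    choose-spec : {P : A → Set ℓ} (d : A) → ∃ P → P (choose P d)
    choose-spec {P = P} d ex with em {P = ∃ P}
    ... | yes (_ , px) = px
    ... | no ¬ex = ⊥-elim (¬ex ex)

  module _ {W : Set a} {_<_ : W → W → Set b} (wf : WellFounded _<_) where

    Below : (w : W) (f g : W → A) → Set _
    Below w f g = ∀ v → v < w → f v ≡ g v

    -- Stages are predicates on total functions, which spares partial ones. Locality says that stage
    -- w reads values up to w only and so survives later changes.
    Local : ((w : W) → (W → A) → Set ℓ) → Set _
    Local P = ∀ w F F′ → Below w F F′ → F w ≡ F′ w → P w F → P w F′

    abstract
      -- Transfinite recursion in which each stage is only required to exist.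
      build : {A : Set c} (d : A) (P : (w : W) → (W → A) → Set ℓ) → Local P →
              (∀ w F → (∀ v → v < w → P v F) →
                 ∃ λ F′ → Below w F F′ × P w F′) →
              ∃ λ F → ∀ w → P w F
      build {c} {ℓ} {A} d P local step = F , P-F
        where
        Good : (w : W) → (∀ {v} → v < w → A) → (W → A) → Set (a ⊔ b ⊔ c ⊔ ℓ)
        Good w ih F′ = (∀ v (v<w : v < w) → ih v<w ≡ F′ v) × P w F′

        -- Of the chosen total extension only the value at w is kept; `local` permits its other
        -- values to be discarded.
        next : (w : W) → (∀ {v} → v < w → A) → A
        next w ih = choose (Good w ih) (λ _ → d) w

        next-ext : ∀ w {ih ih′ : ∀ {v} → v < w → A} →
                   (∀ {v} (v<w : v < w) → ih v<w ≡ ih′ v<w) → next w ih ≡ next w ih′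
        next-ext w {ih} {ih′} eq =
          cong (λ (g : ∀ v → v < w → A) → next w (λ {v} → g v))
            {x = λ v → ih {v}} {y = λ v → ih′ {v}} (fe λ v → fe λ v<w → eq v<w)

        open WF.All wf _ using (wfRec)
        F : W → A
        F = wfRec (λ _ → A) next

        unfold : ∀ w → F w ≡ next w (λ {v} _ → F v)
        unfold w = WF.FixPoint.unfold-wfRec wf (λ _ → A) next (λ w → next-ext w)

        P-F : ∀ w → P w F
        P-F = WF.All.wfRec wf _ (λ w → P w F) λ w ih →
          let F′ , below , p = step w F (λ v v<w → ih v<w)
              good : Good w (λ {v} _ → F v) (choose (Good w (λ {v} _ → F v)) (λ _ → d))
              good = choose-spec {P = Good w (λ {v} _ → F v)} (λ _ → d) (F′ , below , p)
          in local w _ F (λ v v<w → sym (proj₁ good v v<w)) (sym (unfold w)) (proj₂ good)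

    abstract
      override : (W → A) → W → A → W → A
      override F w x v with em {P = v ≡ w}
      ... | yes _ = x
      ... | no _  = F v

      override-at : (F : W → A) (w : W) (x : A) → override F w x w ≡ x
      override-at F w x with em {P = w ≡ w}
      ... | yes _ = refl
      ... | no ne = ⊥-elim (ne refl)

    abstract
      override-below : (F : W → A) (w : W) (x : A) → Below w F (override F w x)
      override-below F w x v v<w with em {P = v ≡ w}
      ... | yes refl = ⊥-elim (WF.wf⇒asym wf v<w v<w)
      ... | no _ = refl

    least : (P : W → Set ℓ) → ∃ P → ∃ λ w → P w × (∀ v → v < w → ¬ P v)
    least P (w , p) = dne λ none →
      WF.All.wfRec wf _ (λ w → ¬ P w) (λ w ih p → none (w , p , λ v v<w → ih v<w)) w p

-- Ordinals

-- `Seg` presents each proper initial segment as a small set, possibly with repetitions. `On` and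
-- `ℕ` share this interface, so one back-and-forth argument yields both automorphisms of the monster
-- and isomorphisms of countable models.
record SmallWellOrder {ℓ} (W : Set ℓ) : Set (lsuc 0ℓ ⊔ ℓ) where
  infix 4 _<_ _≼_
  field
    _<_      : W → W → Set
    wf       : WellFounded _<_
    <-trans  : ∀ {u v w} → u < v → v < w → u < w
    compare  : ∀ u v → u < v ⊎ u ≡ v ⊎ v < u
    Seg      : W → Set
    elem     : ∀ w → Seg w → W
    elem-<   : ∀ w i → elem w i < w
    elem-sur : ∀ {v w} → v < w → ∃ λ i → elem w i ≡ v

  _≼_ : W → W → Set ℓ
  v ≼ w = v < w ⊎ v ≡ w

  <-≼-trans : ∀ {u v w} → u < v → v ≼ w → u < w
  <-≼-trans p (inj₁ q)    = <-trans p q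
  <-≼-trans p (inj₂ refl) = p

  ≼-<-trans : ∀ {u v w} → u ≼ v → v < w → u < w
  ≼-<-trans (inj₁ p)    q = <-trans p q
  ≼-<-trans (inj₂ refl) q = q

  ≼-trans : ∀ {u v w} → u ≼ v → v ≼ w → u ≼ w
  ≼-trans p (inj₁ q)    = inj₁ (≼-<-trans p q)
  ≼-trans p (inj₂ refl) = p

  <-irrefl : ∀ {w} → ¬ (w < w)
  <-irrefl p = WF.wf⇒asym wf p p

  ≼-total : ∀ v w → v ≼ w ⊎ w < v
  ≼-total v w with compare v w
  ... | inj₁ p        = inj₁ (inj₁ p)
  ... | inj₂ (inj₁ p) = inj₁ (inj₂ p)
  ... | inj₂ (inj₂ p) = inj₂ p

  upper₂ : ∀ v w → ∃ λ u → v ≼ u × w ≼ u × (∀ {x} → v < x → w < x → u < x)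
  upper₂ v w with ≼-total v w
  ... | inj₁ p = w , p , inj₂ refl , λ _ q → q
  ... | inj₂ p = v , inj₂ refl , inj₁ p , λ q _ → q

  maximum : ∀ {n} (t : Fin (suc n) → W) → ∃ λ i → ∀ k → t k ≼ t i
  maximum {zero}  t = zero , λ { zero → inj₂ refl }
  maximum {suc n} t with maximum (t ∘ suc)
  ... | i , max with ≼-total (t zero) (t (suc i))
  ...   | inj₁ p = suc i , λ { zero → p ; (suc k) → max k }
  ...   | inj₂ p = zero , λ { zero → inj₂ refl ; (suc k) → inj₁ (≼-<-trans (max k) p) }

ℕ-order : SmallWellOrder ℕ
ℕ-order = record
  { _<_      = ℕ._<_
  ; wf       = ℕ.<-wellFounded
  ; <-trans  = ℕ.<-trans
  ; compare  = compare
  ; Seg      = Fin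
  ; elem     = λ _ → toℕ
  ; elem-<   = λ _ → toℕ<n
  ; elem-sur = λ v<w → Fin.fromℕ< v<w , toℕ-fromℕ< v<w
  }
  where
  compare : ∀ m n → m ℕ.< n ⊎ m ≡ n ⊎ n ℕ.< m
  compare m n with ℕ.<-cmp m n
  ... | tri< p _ _ = inj₁ p
  ... | tri≈ _ p _ = inj₂ (inj₁ p)
  ... | tri> _ _ p = inj₂ (inj₂ p)

-- Well-founded trees with small branching stand for ordinals through their ranks; `canon` later
-- identifies trees of equal rank.
data Tree : Set₁ where
  sup : (I : Set) → (I → Tree) → Tree

-- s ⊑ t compares the ranks of s and t.
infix 4 _⊑_ _⊏_

_⊑_ : Tree → Tree → Set
sup I f ⊑ sup J g = ∀ i → ∃ λ j → f i ⊑ g j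

_⊏_ : Tree → Tree → Set
t ⊏ sup J g = ∃ λ j → t ⊑ g j

⊑-refl : ∀ t → t ⊑ t
⊑-refl (sup I f) i = i , ⊑-refl (f i)

⊑-trans : ∀ {s t u} → s ⊑ t → t ⊑ u → s ⊑ u
⊑-trans {sup _ _} {sup _ _} {sup _ _} p q i =
  let j , p′ = p i ; k , q′ = q j in k , ⊑-trans p′ q′

⊏-⊑-trans : ∀ {s t u} → s ⊏ t → t ⊑ u → s ⊏ u
⊏-⊑-trans {s} {sup _ _} {sup _ _} (j , p) q = let k , q′ = q j in k , ⊑-trans {s} p q′

⊑-⊏-trans : ∀ {s t u} → s ⊑ t → t ⊏ u → s ⊏ u
⊑-⊏-trans {s} {t} {sup _ _} p (k , q) = k , ⊑-trans {s} p q

child-⊑ : ∀ t {J} {g : J → Tree} {j} → t ≡ g j → t ⊑ sup J g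
child-⊑ (sup K h) {j = j} eq k = j , subst (h k ⊑_) eq (child-⊑ (h k) refl)

⊏⇒⊑ : ∀ {s t} → s ⊏ t → s ⊑ t
⊏⇒⊑ {s} {sup J g} (j , p) = ⊑-trans {s} p (child-⊑ (g j) refl)

⊏-wellFounded : WellFounded _⊏_
⊏-wellFounded t = acc (below t)
  where
  below : ∀ t {s} → s ⊏ t → Acc _⊏_ s
  below (sup J g) {s} (j , s⊑gj) = acc λ {r} r⊏s → below (g j) (⊏-⊑-trans {r} {s} r⊏s s⊑gj)

-- These are the positions of the proper subtrees. Every smaller rank is attained by one of them, so
-- a small type indexes the ordinals below a given one.
Node : Tree → Set
Node (sup J g) = Σ J λ j → Maybe (Node (g j))

subtree : ∀ t → Node t → Tree
subtree (sup J g) (j , nothing) = g j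
subtree (sup J g) (j , just n)  = subtree (g j) n

subtree-⊏ : ∀ t n → subtree t n ⊏ t
subtree-⊏ (sup J g) (j , nothing) = j , ⊑-refl (g j)
subtree-⊏ (sup J g) (j , just n)  = j , ⊏⇒⊑ {subtree (g j) n} (subtree-⊏ (g j) n)

module Ordinals
  (em : ∀ {ℓ} → ExcludedMiddle ℓ)
  (fe : ∀ {a b} → Extensionality a b)
  where
  open Classical em fe

  ⊑-total : ∀ s t → s ⊑ t ⊎ t ⊏ s
  ⊑-total (sup I f) (sup J g) with em {P = ∃ λ i → ∀ j → g j ⊏ f i}
  ... | yes (i , above) = inj₂ (i , all-children (f i) above)
    where
    all-children : ∀ s → (∀ j → g j ⊏ s) → sup J g ⊑ s
    all-children (sup _ _) p = p
  ... | no none = inj₁ λ i → dne λ ¬p → none (i , λ j → case ⊑-total (f i) (g j) of λ where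
          (inj₁ q) → ⊥-elim (¬p (j , q))
          (inj₂ q) → q)

  _≍_ : Tree → Tree → Set
  s ≍ t = s ⊑ t × t ⊑ s

  -- The predicate given to `choose` depends on t only through its rank. So `canon` selects one tree
  -- of each rank, and its fixed points form the quotient.
  canon : Tree → Tree
  canon t = choose (λ s → truth (s ≍ t) ≡ true) (sup ⊥ λ ())

  canon-≍ : ∀ t → canon t ≍ t
  canon-≍ t = truth⁻ (choose-spec {P = λ s → truth (s ≍ t) ≡ true} _
    (t , truth⁺ (⊑-refl t , ⊑-refl t)))

  canon-cong : ∀ {s t} → s ≍ t → canon s ≡ canon t
  canon-cong {s} {t} (p , q) = cong (λ P → choose (λ r → P r ≡ true) (sup ⊥ λ ()))
    (fe λ r → truth-cong (λ (a , b) → ⊑-trans {r} a p , ⊑-trans {t} q b)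
                         (λ (a , b) → ⊑-trans {r} a q , ⊑-trans {s} p b))

  On : Set₁
  On = Σ Tree λ t → canon t ≡ t

  On-≡ : {x y : On} → proj₁ x ≡ proj₁ y → x ≡ y
  On-≡ refl = cong (_ ,_) (uip _ _)

  ordinal : Tree → On
  ordinal t = canon t , canon-cong (canon-≍ t)

  record _<ₒ_ (x y : On) : Set where
    constructor ranks
    field rank-⊏ : proj₁ x ⊏ proj₁ y

  abstract
    On-order : SmallWellOrder On
    On-order = record
      { _<_      = _<ₒ_
      ; wf       = wf
      ; <-trans  = λ {u} {v} {w} (ranks p) (ranks q) →
          ranks (⊏-⊑-trans {proj₁ u} p (⊏⇒⊑ {proj₁ v} {proj₁ w} q))
      ; compare  = compare
      ; Seg      = Node ∘ proj₁
      ; elem     = λ w n → ordinal (subtree (proj₁ w) n)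
      ; elem-<   = λ (w , _) n → ranks (⊑-⊏-trans {_} {_} {w} (proj₁ (canon-≍ _)) (subtree-⊏ w n))
      ; elem-sur = λ {v} {w} (ranks p) → let n , q = find (proj₁ v) (proj₁ w) p in
          n , On-≡ (trans (canon-cong q) (proj₂ v))
      }
      where
      wf : WellFounded _<ₒ_
      wf = WF.Subrelation.wellFounded _<ₒ_.rank-⊏ (on-wellFounded proj₁ ⊏-wellFounded)

      compare : ∀ (x y : On) → x <ₒ y ⊎ x ≡ y ⊎ y <ₒ x
      compare (s , p) (t , q) with ⊑-total s t | ⊑-total t s
      ... | inj₂ a | _      = inj₂ (inj₂ (ranks a))
      ... | inj₁ _ | inj₂ b = inj₁ (ranks b)
      ... | inj₁ a | inj₁ b = inj₂ (inj₁ (On-≡ (trans (sym p) (trans (canon-cong (a , b)) q))))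

      find : ∀ s t → s ⊏ t → ∃ λ n → subtree t n ≍ s
      find s (sup J g) (j , s⊑gj) with ⊑-total (g j) s
      ... | inj₁ p = (j , nothing) , p , s⊑gj
      ... | inj₂ p = let n , q = find s (g j) p in (j , just n) , q

    strict-bound : {I : Set} (p : I → On) → ∃ λ w → ∀ i → SmallWellOrder._<_ On-order (p i) w
    strict-bound {I} p = ordinal t , λ i →
      ranks (⊏-⊑-trans {proj₁ (p i)} {t} (i , ⊑-refl _) (proj₂ (canon-≍ t)))
      where
      t : Tree
      t = sup I (proj₁ ∘ p)

  open SmallWellOrder On-order public

  next : ∀ w → ∃ λ u → w < u
  next w = let u , p = strict-bound {Fin 1} (λ _ → w) in u , p zero

  -- For each value z take an ordinal from β on with value z, if there is one, and let w exceed them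
  -- all; the ordinal taken for the value of w itself serves as v. The index `nothing` puts w above
  -- β.
  On-pigeonhole : {Z : Set} (β : On) (h : On → Z) →
                  ∃ λ v → ∃ λ w → β ≼ v × v < w × h v ≡ h w
  On-pigeonhole {Z} β h = v , w , proj₁ spec , v<w , proj₂ spec
    where
    P : Z → On → Set₁
    P z u = β ≼ u × h u ≡ z
    section : Maybe Z → On
    section nothing  = β
    section (just z) = choose (P z) β
    w : On
    w = proj₁ (strict-bound section)
    v : On
    v = section (just (h w))
    v<w : v < w
    v<w = proj₂ (strict-bound section) (just (h w))
    spec : P (h w) v
    spec = choose-spec {P = P (h w)} β
      (w , inj₁ (proj₂ (strict-bound section) nothing) , refl)

  abstract
    -- Stage w takes an open request of the least possible level.  If a request stayed open for ever,
    -- the requests taken would inject a final segment of the ordinals into a small type.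
    enumerate : (R : On → Set) → Σ On R →
                ∃ λ (g : On → Σ On R) → ∀ β s → ∃ λ w → β ≼ w × g w ≡ (β , s)
    enumerate R r₀ = g , hit
      where
      Met : On → (On → Σ On R) → Σ On R → Set₁
      Met w g r = ∃ λ v → v < w × proj₁ r ≼ v × g v ≡ r
      Open : On → (On → Σ On R) → Σ On R → Set₁
      Open w g r = proj₁ r ≼ w × ¬ Met w g r
      P : On → (On → Σ On R) → Set₁
      P w g = ∀ r → Open w g r → Open w g (g w) × proj₁ (g w) ≼ proj₁ r

      met-local : ∀ {w g g′ r} → Below wf w g g′ → Met w g r → Met w g′ r
      met-local b (v , v<w , l , eq) = v , v<w , l , trans (sym (b v v<w)) eq
      flip-below : ∀ {w} {g g′ : On → Σ On R} → Below wf w g g′ → Below wf w g′ g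
      flip-below b v v<w = sym (b v v<w)
      local : Local wf P
      local w g g′ b eq p r (l , ¬met)
        with p r (l , λ m → ¬met (met-local {g = g} b m))
      ... | (l′ , ¬met′) , min rewrite eq =
        (l′ , λ m → ¬met′ (met-local {g = g′} (flip-below b) m)) , min

      step : ∀ w g → (∀ v → v < w → P v g) → ∃ λ g′ → Below wf w g g′ × P w g′
      step w g _ with em {P = ∃ (Open w g)}
      ... | no none = g , (λ _ _ → refl) , λ r o → ⊥-elim (none (r , o))
      ... | yes (r , o) =
        let β , (s , o′) , least-β = least wf (λ β → ∃ λ s → Open w g (β , s)) (proj₁ r , proj₂ r , o)
            g′ = override wf g w (β , s)
            b  = override-below wf g w (β , s)
        in g′ , b , λ (β′ , s′) (l , ¬met) →
             subst (λ x → Open w g′ x × proj₁ x ≼ β′) (sym (override-at wf g w (β , s)))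
               ( (proj₁ o′ , λ m → proj₂ o′ (met-local {g = g′} (flip-below b) m))
               , (case ≼-total β β′ of λ where
                    (inj₁ p) → p
                    (inj₂ p) → ⊥-elim (least-β β′ p (s′ , l , λ m → ¬met (met-local {g = g} b m)))))

      built : ∃ λ g → ∀ w → P w g
      built = build wf r₀ P local step
      g : On → Σ On R
      g = proj₁ built

      hit : ∀ β s → ∃ λ w → β ≼ w × g w ≡ (β , s)
      hit β s = dne λ missed →
        let opened : ∀ w → β ≼ w → Open w g (g w) × proj₁ (g w) ≼ β
            opened w l = proj₂ built w (β , s) (l , λ (v , _ , l′ , eq) → missed (v , l′ , eq))
            β⁺ , β<β⁺ = next β
            Z = Σ (Seg β⁺) (R ∘ elem β⁺)
            Code : On → Z → Set₁
            Code w (i , x) = g w ≡ (elem β⁺ i , x)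
            code : ∀ w → β ≼ w → ∃ (Code w)
            code w l = let i , eq = elem-sur {w = β⁺} (≼-<-trans (proj₂ (opened w l)) β<β⁺) in
              (i , subst R (sym eq) (proj₂ (g w))) , code-eq eq
            z₀ : Z
            z₀ = proj₁ (code β (inj₂ refl))
            h : On → Z
            h w = choose (Code w) z₀
            v , w , β≼v , v<w , hv≡hw = On-pigeonhole β h
            β≼w = ≼-trans β≼v (inj₁ v<w)
            gv≡gw : g v ≡ g w
            gv≡gw = trans (choose-spec {P = Code v} z₀ (code v β≼v))
                    (trans (cong (λ z → elem β⁺ (proj₁ z) , proj₂ z) hv≡hw)
                           (sym (choose-spec {P = Code w} z₀ (code w β≼w))))
            (_ , ¬met) , _ = opened w β≼w
            (l , _) , _ = opened v β≼v
        in ¬met (v , v<w , subst (λ r → proj₁ r ≼ v) gv≡gw l , gv≡gw)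
        where
        code-eq : ∀ {β′} {r : Σ On R} (eq : β′ ≡ proj₁ r) → r ≡ (β′ , subst R (sym eq) (proj₂ r))
        code-eq refl = refl

-- Presented structures and their amalgamation

half : ℕ → ℕ
half zero    = 0
half (suc n) = half n + suc (half n + half n)

-- The cyclic group of order 3ⁿ = 1 + 2 · half n; the coherent sequence half n is the 3-adic
-- integer −1/2.
Colour : ℕ → Set
Colour n = Fin (suc (half n + half n))

abstract
  act : ∀ n → ℕ → Colour n → Colour n
  act n k c = (toℕ c + k) mod suc (half n + half n)

  toℕ-act : ∀ n k c → toℕ (act n k c) ≡ (toℕ c + k) % suc (half n + half n)
  toℕ-act n k c = toℕ-fromℕ< _

act-act : ∀ n k l c → act n k (act n l c) ≡ act n (l + k) c
act-act n k l c = toℕ-injective (begin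
  toℕ (act n k (act n l c))      ≡⟨ toℕ-act n k (act n l c) ⟩
  (toℕ (act n l c) + k) % m      ≡⟨ cong (λ x → (x + k) % m) (toℕ-act n l c) ⟩
  ((toℕ c + l) % m + k) % m      ≡⟨ %-distribˡ-+ ((toℕ c + l) % m) k m ⟩
  ((toℕ c + l) % m % m + k % m) % m ≡⟨ cong (λ x → (x + k % m) % m) (m%n%n≡m%n (toℕ c + l) m) ⟩
  ((toℕ c + l) % m + k % m) % m  ≡⟨ %-distribˡ-+ (toℕ c + l) k m ⟨
  (toℕ c + l + k) % m            ≡⟨ cong (_% m) (ℕ.+-assoc (toℕ c) l k) ⟩
  (toℕ c + (l + k)) % m          ≡⟨ toℕ-act n (l + k) c ⟨
  toℕ (act n (l + k) c)          ∎)
  where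
  open ≡-Reasoning
  m = suc (half n + half n)

act-multiple : ∀ n j k c → act n (k + j * suc (half n + half n)) c ≡ act n k c
act-multiple n j k c = toℕ-injective (begin
  toℕ (act n (k + j * m) c)      ≡⟨ toℕ-act n (k + j * m) c ⟩
  (toℕ c + (k + j * m)) % m      ≡⟨ cong (_% m) (ℕ.+-assoc (toℕ c) k (j * m)) ⟨
  (toℕ c + k + j * m) % m        ≡⟨ [m+kn]%n≡m%n (toℕ c + k) j m ⟩
  (toℕ c + k) % m                ≡⟨ toℕ-act n k c ⟨
  toℕ (act n k c)                ∎)
  where
  open ≡-Reasoning
  m = suc (half n + half n)

act-0 : ∀ n c → act n 0 c ≡ c
act-0 n c = toℕ-injective (trans (toℕ-act n 0 c)
  (trans (cong (_% suc (half n + half n)) (ℕ.+-identityʳ (toℕ c))) (m<n⇒m%n≡m (toℕ<n c))))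

-- Since `half n + half n` is -1 in the cyclic group, this is -k.
opposite : ℕ → ℕ → ℕ
opposite n k = k * (half n + half n)

act-opposite : ∀ n k c → act n (opposite n k) (act n k c) ≡ c
act-opposite n k c = begin
  act n (opposite n k) (act n k c)              ≡⟨ act-act n (opposite n k) k c ⟩
  act n (k + k * (half n + half n)) c           ≡⟨ cong (λ x → act n x c) (ℕ.*-suc k (half n + half n)) ⟨
  act n (0 + k * suc (half n + half n)) c       ≡⟨ act-multiple n k 0 c ⟩
  act n 0 c                                     ≡⟨ act-0 n c ⟩
  c                                             ∎
  where open ≡-Reasoning

Inj : {A : Set a} {B : Set b} → (A → B) → Set _
Inj f = ∀ x y → f x ≡ f y → x ≡ y

inj-∘ : {f : Y → Z} {g : X → Y} → Inj f → Inj g → Inj (f ∘ g)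
inj-∘ {g = g} i j x y eq = j x y (i (g x) (g y) eq)

inj-∘⁻ : (f : Y → Z) (g : X → Y) → Inj (f ∘ g) → Inj g
inj-∘⁻ f g i x y eq = i x y (cong f eq)

just-inj : Inj (just {A = A})
just-inj _ _ = just-injective

map-inj : {f : A → B} → Inj f → Inj (Maybe.map f)
map-inj i (just x) (just y) eq = cong just (i x y (just-injective eq))
map-inj i nothing  nothing  _  = refl

bit : Bool → ℕ
bit true  = 1
bit false = 0

five : X → X → X → X → X → Vector X 5
five a b c d e = a ◂ b ◂ c ◂ d ◂ e ◂ ⟨⟩

-- All values are Booleans or colours, so the structures on a small set form a small type, and an
-- equation `pull a R ≡ pull b S` can express that a and b have the same presented type.
record Str (X : Set ℓ) : Set ℓ where
  field
    lt  : X → X → Bool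
    dd  : Vector X 5 → Bool
    col : ∀ n → Vector X (suc n) → Colour n
open Str public

pull : (Y → X) → Str X → Str Y
pull f R = record
  { lt  = λ x y → lt R (f x) (f y)
  ; dd  = λ t → dd R (f ∘ t)
  ; col = λ n t → col R n (f ∘ t)
  }

-- Positions are taken in pairs, whence the arity 5. In a free amalgam a new point at position k
-- then forces every other position onto its side; a ternary relation of w, `e i` and `e′ i` would
-- admit tuples linked partly on one side and partly on the other.
Linked : {X : Set ℓ} → Str X → ∀ {n} → X → Vector X n → Vector X n → Set
Linked R w e e′ = ∀ i j → dd R (five w (e i) (e′ i) (e j) (e′ j)) ≡ true

Adjacent : {X : Set ℓ} → Str X → ∀ n → Vector X (suc n) → Vector X (suc n) → Set
Adjacent R n e e′ = act n (bit (lt R (e′ zero) (e zero))) (col R n e′) ≡ col R n e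

-- In terms of a circle cut open to the linear order lt, col n e is the sheet, over the point
-- e zero, of a 3ⁿ-fold connected cover of the circle; crossing the cut changes the sheet by one.
-- Adjacency says that e′ lies less than one turn ahead of e in the cover.
record IsK {X : Set ℓ} (R : Str X) : Set ℓ where
  field
    lt-irrefl : ∀ x → lt R x x ≡ false
    lt-trans  : ∀ x y z → lt R x y ≡ true → lt R y z ≡ true → lt R x z ≡ true
    lt-conn   : ∀ x y → lt R x y ≡ false → lt R y x ≡ false → x ≡ y
    col-zero  : ∀ n e → ¬ Inj e → col R n e ≡ zero
    linked    : ∀ n e e′ w → Inj e → Inj e′ → Linked R w e e′ → Adjacent R n e e′

  lt-asym : ∀ x y → lt R x y ≡ true → lt R y x ≡ false
  lt-asym x y p with lt R y x in q
  ... | false = refl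
  ... | true = case trans (sym (lt-trans x y x p q)) (lt-irrefl x) of λ ()

  lt-flip : ∀ x y → x ≢ y → lt R x y ≡ not (lt R y x)
  lt-flip x y ne with lt R y x in q
  ... | true = lt-asym y x q
  ... | false with lt R x y in p
  ...   | true = refl
  ...   | false = ⊥-elim (ne (lt-conn x y p q))

open IsK public

bool-≡ : {x y : Bool} → (x ≡ true → y ≡ true) → (y ≡ true → x ≡ true) → x ≡ y
bool-≡ {true}  f g = sym (f refl)
bool-≡ {false} {true}  f g = g refl
bool-≡ {false} {false} f g = refl

≢true⇒false : {x : Bool} → x ≢ true → x ≡ false
≢true⇒false {true}  ne = ⊥-elim (ne refl)
≢true⇒false {false} ne = refl

true≢false : {x : Bool} → x ≡ true → x ≢ false
true≢false refl ()

module Presented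
  (em : ∀ {ℓ} → ExcludedMiddle ℓ)
  (fe : ∀ {a b} → Extensionality a b)
  where
  open Classical em fe

  five-map : (f : X → Y) (a b c d e : X) → f ∘ five a b c d e ≡ five (f a) (f b) (f c) (f d) (f e)
  five-map f a b c d e = fe λ where
    zero → refl
    (suc zero) → refl
    (suc (suc zero)) → refl
    (suc (suc (suc zero))) → refl
    (suc (suc (suc (suc zero)))) → refl

  Str-≡ : {R S : Str X} → (∀ x y → lt R x y ≡ lt S x y) → (∀ t → dd R t ≡ dd S t) →
          (∀ n t → col R n t ≡ col S n t) → R ≡ S
  Str-≡ p q r = mk (fe λ x → fe (p x)) (fe q) (fe λ n → fe (r n))
    where
    mk : ∀ {l l′ d d′ c c′} → l ≡ l′ → d ≡ d′ → c ≡ c′ →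
         record { lt = l ; dd = d ; col = c } ≡ record { lt = l′ ; dd = d′ ; col = c′ }
    mk refl refl refl = refl

  pull-linked : (f : Y → X) (R : Str X) → ∀ {n} w (e e′ : Vector Y n) →
                Linked (pull f R) w e e′ → Linked R (f w) (f ∘ e) (f ∘ e′)
  pull-linked f R w e e′ l i j = trans (sym (cong (dd R) (five-map f _ _ _ _ _))) (l i j)

  pull-linked⁻ : (f : Y → X) (R : Str X) → ∀ {n} w (e e′ : Vector Y n) →
                 Linked R (f w) (f ∘ e) (f ∘ e′) → Linked (pull f R) w e e′
  pull-linked⁻ f R w e e′ l i j = trans (cong (dd R) (five-map f _ _ _ _ _)) (l i j)

  -- The rule for links mentions only w and the entries of both tuples, so it can be verified in any
  -- substructure containing them.
  linked-along : (R : Str X) (g : Y → X) {S : Str Y} → IsK S → pull g R ≡ S →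
                 ∀ n {e e′ : Vector X (suc n)} {w} {w₁} {e₁ e₁′ : Vector Y (suc n)} →
                 w ≡ g w₁ → e ≡ g ∘ e₁ → e′ ≡ g ∘ e₁′ →
                 Inj e → Inj e′ → Linked R w e e′ → Adjacent R n e e′
  linked-along R g K refl n {w₁ = w} {e} {e′} refl refl refl i i′ l =
    linked K n e e′ w (inj-∘⁻ g e i) (inj-∘⁻ g e′ i′) (pull-linked⁻ g R w e e′ l)

  pull-IsK : {R : Str X} {f : Y → X} → Inj f → IsK R → IsK (pull f R)
  pull-IsK {R = R} {f = f} f-inj K = record
    { lt-irrefl = λ x → lt-irrefl K (f x)
    ; lt-trans  = λ x y z → lt-trans K (f x) (f y) (f z)
    ; lt-conn   = λ x y p q → f-inj x y (lt-conn K (f x) (f y) p q)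
    ; col-zero  = λ n e ¬i → col-zero K n (f ∘ e) (¬i ∘ inj-∘⁻ f e)
    ; linked    = λ n e e′ w i i′ l → linked K n (f ∘ e) (f ∘ e′) (f w)
                    (inj-∘ f-inj i) (inj-∘ f-inj i′) (pull-linked f R w e e′ l)
    }

  -- The colours of the amalgam and the relation dd vanish on tuples that meet both
  -- the new point and Y outside A, and the new point is put just above the lower part of its cut.
  module Amalgam
    {Y : Set ℓ} {A : Set ℓ′} (R : Str Y) (K : IsK R) (ι : A → Y) (ι-inj : Inj ι)
    (T : Str (Maybe A)) (KT : IsK T) (compat : pull just T ≡ pull ι R)
    where

    ι⁺ : Maybe A → Maybe Y
    ι⁺ = Maybe.map ι

    descend : (u : I → Maybe A) (t : I → Y) → just ∘ t ≡ ι⁺ ∘ u →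
              ∃ λ s → u ≡ just ∘ s × t ≡ ι ∘ s
    descend u t eq = (λ i → proj₁ (at (u i) (cong (λ f → f i) eq))) ,
      fe (λ i → proj₁ (proj₂ (at (u i) (cong (λ f → f i) eq)))) ,
      fe (λ i → proj₂ (proj₂ (at (u i) (cong (λ f → f i) eq))))
      where
      at : ∀ {y} x → just y ≡ ι⁺ x → ∃ λ a → x ≡ just a × y ≡ ι a
      at (just a) eq = a , refl , just-injective eq

    just∘-inj : (s t : I → Y) → just ∘ s ≡ just ∘ t → s ≡ t
    just∘-inj _ _ eq = fe λ i → just-injective (cong (λ f → f i) eq)

    ι⁺∘-inj : (s t : I → Maybe A) → ι⁺ ∘ s ≡ ι⁺ ∘ t → s ≡ t
    ι⁺∘-inj _ _ eq = fe λ i → map-inj ι-inj _ _ (cong (λ f → f i) eq)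

    compat-lt : ∀ x y → lt T (just x) (just y) ≡ lt R (ι x) (ι y)
    compat-lt x y = cong (λ S → lt S x y) compat
    compat-dd : ∀ t → dd T (just ∘ t) ≡ dd R (ι ∘ t)
    compat-dd t = cong (λ S → dd S t) compat
    compat-col : ∀ n t → col T n (just ∘ t) ≡ col R n (ι ∘ t)
    compat-col n t = cong (λ S → col S n t) compat

    Below-new : Y → Set _
    Below-new y = ∃ λ a → lt T (just a) nothing ≡ true × lt R (ι a) y ≡ false

    Related : Vector (Maybe Y) 5 → Set _
    Related t = (∃ λ u → t ≡ just ∘ u × dd R u ≡ true) ⊎ (∃ λ u → t ≡ ι⁺ ∘ u × dd T u ≡ true)

    Old New : ∀ {n} → Vector (Maybe Y) n → Set _
    Old {n} t = Σ (Vector Y n) λ u → t ≡ just ∘ u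
    New {n} t = Σ (Vector (Maybe A) n) λ u → t ≡ ι⁺ ∘ u

    lt⁺ : Maybe Y → Maybe Y → Bool
    lt⁺ (just x) (just y) = lt R x y
    lt⁺ (just x) nothing  = truth (Below-new x)
    lt⁺ nothing  (just y) = not (truth (Below-new y))
    lt⁺ nothing  nothing  = false

    col⁺ : ∀ n → Vector (Maybe Y) (suc n) → Colour n
    col⁺ n t with em {P = Old t}
    ... | yes (u , _) = col R n u
    ... | no _ with em {P = New t}
    ...   | yes (u , _) = col T n u
    ...   | no _ = zero

    R⁺ : Str (Maybe Y)
    R⁺ = record { lt = lt⁺ ; dd = λ t → truth (Related t) ; col = col⁺ }

    extends : pull just R⁺ ≡ R
    extends = Str-≡ (λ _ _ → refl)
      (λ t → bool-≡ (dd-from ∘ truth⁻) λ p → truth⁺ (inj₁ (t , refl , p))) col-eq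
      where
      dd-from : ∀ {t} → Related (just ∘ t) → dd R t ≡ true
      dd-from (inj₁ (u , eq , p)) = trans (cong (dd R) (just∘-inj _ _ eq)) p
      dd-from {t} (inj₂ (u , eq , p)) with descend u t eq
      ... | s , refl , refl = trans (sym (compat-dd s)) p
      col-eq : ∀ n t → col⁺ n (just ∘ t) ≡ col R n t
      col-eq n t with em {P = Old (just ∘ t)}
      ... | yes (u , eq) = cong (col R n) (sym (just∘-inj _ _ eq))
      ... | no none = ⊥-elim (none (t , refl))

    realises : pull ι⁺ R⁺ ≡ T
    realises = Str-≡ lt-eq
      (λ t → bool-≡ (dd-from ∘ truth⁻) λ p → truth⁺ (inj₂ (t , refl , p))) col-eq
      where
      below-eq : ∀ a → truth (Below-new (ι a)) ≡ lt T (just a) nothing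
      below-eq a = bool-≡ (λ p → from (truth⁻ p)) λ p → truth⁺ (a , p , lt-irrefl K (ι a))
        where
        from : Below-new (ι a) → lt T (just a) nothing ≡ true
        from (a′ , p , q) with lt T (just a) (just a′) in r
        ... | true = lt-trans KT _ _ _ r p
        ... | false with ι-inj a a′ (lt-conn K _ _ (trans (sym (compat-lt _ _)) r) q)
        ...   | refl = p
      lt-eq : ∀ x y → lt⁺ (ι⁺ x) (ι⁺ y) ≡ lt T x y
      lt-eq (just x) (just y) = sym (compat-lt x y)
      lt-eq (just x) nothing  = below-eq x
      lt-eq nothing  (just y) = trans (cong not (below-eq y)) (sym (lt-flip KT _ _ λ ()))
      lt-eq nothing  nothing  = sym (lt-irrefl KT nothing)
      dd-from : ∀ {t} → Related (ι⁺ ∘ t) → dd T t ≡ true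
      dd-from {t} (inj₁ (u , eq , p)) with descend t u (sym eq)
      ... | s , refl , refl = trans (compat-dd s) p
      dd-from (inj₂ (u , eq , p)) = trans (cong (dd T) (ι⁺∘-inj _ _ eq)) p
      col-eq : ∀ n t → col⁺ n (ι⁺ ∘ t) ≡ col T n t
      col-eq n t with em {P = Old (ι⁺ ∘ t)}
      ... | yes (u , eq) with descend t u (sym eq)
      ...   | s , refl , refl = sym (compat-col n s)
      col-eq n t | no _ with em {P = New (ι⁺ ∘ t)}
      ...   | yes (u , eq) = cong (col T n) (sym (ι⁺∘-inj _ _ eq))
      ...   | no none = ⊥-elim (none (t , refl))

    R⁺-IsK : IsK R⁺
    R⁺-IsK = record
      { lt-irrefl = λ { (just x) → lt-irrefl K x ; nothing → refl }
      ; lt-trans  = trans⁺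
      ; lt-conn   = conn⁺
      ; col-zero  = zero⁺
      ; linked    = linked⁺
      }
      where
      not-true : ∀ {x} → not x ≡ true → x ≢ true
      not-true {false} _ ()

      down : ∀ {x y} → lt R x y ≡ true → Below-new y → Below-new x
      down {x} {y} p (a , q , r) = a , q , ≢true⇒false λ s →
        true≢false (lt-trans K _ _ _ s p) r

      trans⁺ : ∀ x y z → lt⁺ x y ≡ true → lt⁺ y z ≡ true → lt⁺ x z ≡ true
      trans⁺ (just x) (just y) (just z) p q = lt-trans K x y z p q
      trans⁺ (just x) (just y) nothing p q = truth⁺ (down p (truth⁻ q))
      trans⁺ (just x) nothing (just z) p q with lt R x z in r
      ... | true = refl
      ... | false with lt R z x in s
      ...   | true = ⊥-elim (not-true q (truth⁺ (down s (truth⁻ p))))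
      ...   | false with lt-conn K _ _ r s
      ...     | refl = ⊥-elim (not-true q p)
      trans⁺ nothing (just y) (just z) p q = cong not (truth-false⁺ λ b →
        not-true p (truth⁺ (down q b)))
      trans⁺ nothing (just y) nothing p q = ⊥-elim (not-true p q)

      conn⁺ : ∀ x y → lt⁺ x y ≡ false → lt⁺ y x ≡ false → x ≡ y
      conn⁺ (just x) (just y) p q = cong just (lt-conn K x y p q)
      conn⁺ (just x) nothing p q = case trans (sym q) (cong not p) of λ ()
      conn⁺ nothing (just y) p q = case trans (sym p) (cong not q) of λ ()
      conn⁺ nothing nothing p q = refl

      zero⁺ : ∀ n e → ¬ Inj e → col⁺ n e ≡ zero
      zero⁺ n e ¬i with em {P = Old e}
      ... | yes (u , refl) = col-zero K n u (¬i ∘ inj-∘ just-inj)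
      ... | no _ with em {P = New e}
      ...   | yes (u , refl) = col-zero KT n u (¬i ∘ inj-∘ (map-inj ι-inj))
      ...   | no _ = refl

      defined : ∀ {x : Maybe Y} → x ≢ nothing → ∃ λ y → x ≡ just y
      defined {just y}  _  = y , refl
      defined {nothing} ne = ⊥-elim (ne refl)

      linked⁺ : ∀ n e e′ w → Inj e → Inj e′ → Linked R⁺ w e e′ → Adjacent R⁺ n e e′
      linked⁺ n e e′ w i i′ l
        with em {P = ∃ λ k → w ≡ nothing ⊎ e k ≡ nothing ⊎ e′ k ≡ nothing}
      ... | no all-old = linked-along R⁺ just K extends n
              (proj₂ (defined (λ p → all-old (zero , inj₁ p))))
              (fe λ k → proj₂ (defined (λ p → all-old (k , inj₂ (inj₁ p)))))
              (fe λ k → proj₂ (defined (λ p → all-old (k , inj₂ (inj₂ p))))) i i′ l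
      linked⁺ n e e′ w i i′ l | yes (k , new) =
        linked-along R⁺ ι⁺ KT realises n {w₁ = proj₁ (image zero) zero}
          {λ j → proj₁ (image j) (suc (suc (suc zero)))}
          {λ j → proj₁ (image j) (suc (suc (suc (suc zero))))} (proj₁ (in-A zero)) (fe (proj₁ ∘ proj₂ ∘ in-A))
          (fe (proj₂ ∘ proj₂ ∘ in-A)) i i′ l
        where
        -- Each quintuple `t j` contains the new point, as w or at position k, so it is not old.
        -- Being related, it comes from `T`, and position j with it.
        t : Fin (suc n) → Vector (Maybe Y) 5
        t j = five w (e k) (e′ k) (e j) (e′ j)
        old-absurd : ∀ {j} {u} → t j ≡ just ∘ u → ⊥
        old-absurd eq = case new of λ where
          (inj₁ p)        → case trans (sym p) (cong (λ f → f zero) eq) of λ ()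
          (inj₂ (inj₁ p)) → case trans (sym p) (cong (λ f → f (suc zero)) eq) of λ ()
          (inj₂ (inj₂ p)) → case trans (sym p) (cong (λ f → f (suc (suc zero))) eq) of λ ()
        image : ∀ j → ∃ λ u → t j ≡ ι⁺ ∘ u
        image j with truth⁻ {P = Related (t j)} (l k j)
        ... | inj₁ (u , eq , _) = ⊥-elim (old-absurd {j} eq)
        ... | inj₂ (u , eq , _) = u , eq
        in-A : ∀ j → (w ≡ ι⁺ (proj₁ (image zero) zero)) ×
                     (e j ≡ ι⁺ (proj₁ (image j) (suc (suc (suc zero))))) ×
                     (e′ j ≡ ι⁺ (proj₁ (image j) (suc (suc (suc (suc zero))))))
        in-A j = cong (λ f → f zero) (proj₂ (image zero)) ,
                 cong (λ f → f (suc (suc (suc zero)))) (proj₂ (image j)) ,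
                 cong (λ f → f (suc (suc (suc (suc zero))))) (proj₂ (image j))

  -- Amalgamated over the empty set at stages without a valid request, so that these too add their
  -- point.
  trivial : Str (Maybe ⊥)
  trivial = record { lt = λ _ _ → false ; dd = λ _ → false ; col = λ _ _ → zero }

  trivial-IsK : IsK trivial
  trivial-IsK = record
    { lt-irrefl = λ _ → refl
    ; lt-trans  = λ _ _ _ ()
    ; lt-conn   = λ { nothing nothing _ _ → refl }
    ; col-zero  = λ _ _ _ → refl
    ; linked    = λ _ _ _ _ _ _ l → case l zero zero of λ ()
    }

-- The generic presented structure

module Generic
  (em : ∀ {ℓ} → ExcludedMiddle ℓ)
  (fe : ∀ {a b} → Extensionality a b)
  where
  open Classical em fe
  open Ordinals em fe
  open Presented em fe

  pull-≗ : (R : Str X) (f g : Y → X) → (∀ y → f y ≡ g y) → pull f R ≡ pull g R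
  pull-≗ R f g eq = cong (λ f → pull f R) (fe eq)

  -- Equality is not part of a `Str`, but the linear order determines it: two points coincide if
  -- neither precedes the other.
  agree-≡ : {R : Str X} {S : Str Y} → IsK R → IsK S → (a : I → X) (b : I → Y) →
            pull a R ≡ pull b S → ∀ i j → a i ≡ a j → b i ≡ b j
  agree-≡ {R = R} {S = S} KR KS a b eq i j ai≡aj =
    lt-conn KS _ _ (flat i j ai≡aj) (flat j i (sym ai≡aj))
    where
    flat : ∀ i j → a i ≡ a j → lt S (b i) (b j) ≡ false
    flat i j e = trans (sym (cong (λ P → lt P i j) eq))
      (trans (cong (lt R (a i)) (sym e)) (lt-irrefl KR (a i)))

  -- Each axiom concerns at most one point and two tuples, so substructures containing these
  -- suffice. Constant tuples let the same hypothesis serve the axioms about two or three points.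
  IsK-local : (S : Str Y) →
    (∀ n x (e e′ : Vector Y (suc n)) →
      Σ (Set ℓ′) λ C → Σ (C → Y) λ g → Inj g × IsK (pull g S) ×
      ∃ λ x₁ → ∃ λ e₁ → ∃ λ e₁′ → x ≡ g x₁ × e ≡ g ∘ e₁ × e′ ≡ g ∘ e₁′) →
    IsK S
  IsK-local S cover = record
    { lt-irrefl = λ x → let _ , _ , _ , K , x₁ , _ , _ , p , _ = cover 0 x (const x) (const x) in
        subst (λ x → lt S x x ≡ false) (sym p) (lt-irrefl K x₁)
    ; lt-trans  = λ x y z →
        let _ , _ , _ , K , x₁ , y₁ , z₁ , p , q , r = cover 0 x (const y) (const z) in
        elim₃ (λ x y z → lt S x y ≡ true → lt S y z ≡ true → lt S x z ≡ true)
          p (cong (λ f → f zero) q) (cong (λ f → f zero) r)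
          (lt-trans K x₁ (y₁ zero) (z₁ zero))
    ; lt-conn   = λ x y →
        let _ , g , _ , K , x₁ , y₁ , _ , p , q , _ = cover 0 x (const y) (const y) in
        elim₃ (λ x y _ → lt S x y ≡ false → lt S y x ≡ false → x ≡ y)
          p (cong (λ f → f zero) q) p
          (λ u v → cong g (lt-conn K x₁ (y₁ zero) u v))
    ; col-zero  = λ n e →
        let _ , _ , i , K , _ , e₁ , _ , _ , q , _ = cover n (e zero) e e in
        subst (λ e → ¬ Inj e → col S n e ≡ zero) (sym q)
          (λ ¬i → col-zero K n e₁ (¬i ∘ inj-∘ i))
    ; linked    = λ n e e′ w i i′ l →
        let _ , g , _ , K , _ , _ , _ , p , q , r = cover n w e e′ in
        linked-along S g K refl n p q r i i′ l
    }
    where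
    elim₃ : ∀ {A : Set ℓ} {B : Set ℓ′} {C : Set ℓ″} {k} (P : A → B → C → Set k)
            {x y z x′ y′ z′} → x ≡ x′ → y ≡ y′ → z ≡ z′ → P x′ y′ z′ → P x y z
    elim₃ _ refl refl refl p = p

  Down Upto : On → Set₁
  Down w = Σ On λ v → truth (v < w) ≡ true
  Upto w = Σ On λ v → truth (v ≼ w) ≡ true

  incl-inj : {P : X → Bool} → Inj (proj₁ {A = X} {B = λ x → P x ≡ true})
  incl-inj (x , p) (.x , q) refl = cong (x ,_) (uip p q)

  segment : ∀ β → Seg β → Down β
  segment β i = elem β i , truth⁺ (elem-< β i)

  top : ∀ {n} → Vector On (suc n) → On
  top t = t (proj₁ (maximum t))

  top-≽ : ∀ {n} (t : Vector On (suc n)) k → t k ≼ top t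
  top-≽ t = proj₂ (maximum t)

  -- Each value is read off the stage at which the last entry of the tuple was created.
  assemble : (On → Str On) → Str On
  assemble F = record
    { lt  = λ x y → lt (F (top (x ◂ y ◂ ⟨⟩))) x y
    ; dd  = λ t → dd (F (top t)) t
    ; col = λ n t → col (F (top t)) n t
    }

  assemble-cong : (F F′ : On → Str On) (f : Y → On) → (∀ y → F (f y) ≡ F′ (f y)) →
                  pull f (assemble F) ≡ pull f (assemble F′)
  assemble-cong F F′ f eq = Str-≡
    (λ x y → cong (λ S → lt S (f x) (f y)) (pair x y (proj₁ (maximum (f x ◂ f y ◂ ⟨⟩)))))
    (λ t → cong (λ S → dd S (f ∘ t)) (eq _))
    (λ n t → cong (λ S → col S n (f ∘ t)) (eq _))
    where
    pair : ∀ x y i → F ((f x ◂ f y ◂ ⟨⟩) i) ≡ F′ ((f x ◂ f y ◂ ⟨⟩) i)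
    pair x y zero       = eq x
    pair x y (suc zero) = eq y

  Request : On → Set
  Request β = Str (Maybe (Seg β))

  decode : ∀ w β → Maybe (Seg β) → On
  decode w β = maybe′ (elem β) w

  -- As `elem β` may repeat ordinals, a request can itself violate `lt-conn`. It counts as valid
  -- when it is read off an extension of R on the honest segment `Down β`.
  Valid : Str On → (β : On) → Request β → Set₁
  Valid R β s = Σ (Str (Maybe (Down β))) λ T →
    IsK T × pull just T ≡ pull proj₁ R × s ≡ pull (Maybe.map (segment β)) T

  abstract
    requests : ∃ λ (g : On → Σ On Request) → ∀ β s → ∃ λ w → β ≼ w × g w ≡ (β , s)
    requests = enumerate Request (β₀ , record { lt = λ _ _ → false ; dd = λ _ → false ; col = λ _ _ → zero })
      where
      β₀ : On
      β₀ = ordinal (sup ⊥ λ ())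

  request : On → Σ On Request
  request = proj₁ requests

  Stage : On → (On → Str On) → Set₁
  Stage w F = IsK (pull {Y = Upto w} proj₁ (assemble F)) ×
    (let β , s = request w in
     β ≼ w → Valid (assemble F) β s → pull (decode w β) (assemble F) ≡ s)

  valid-local : ∀ {w β s} {F F′ : On → Str On} → β ≼ w → Below wf w F F′ →
                Valid (assemble F) β s → Valid (assemble F′) β s
  valid-local {F = F} {F′} l b (T , K , eq , eq′) =
    T , K , trans eq (assemble-cong F F′ proj₁ λ (v , p) → b v (<-≼-trans (truth⁻ p) l)) , eq′

  decode-≼ : ∀ w β → β ≼ w → ∀ i → decode w β i ≼ w
  decode-≼ w β l (just i) = inj₁ (<-≼-trans (elem-< β i) l)
  decode-≼ w β l nothing  = inj₂ refl

  stage-local : Local wf Stage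
  stage-local w F F′ b eq (K , meets) =
    subst IsK (assemble-cong F F′ proj₁ λ (v , p) → upto (truth⁻ p)) K ,
    λ l valid → trans (sym (assemble-cong F F′ (decode w _) (upto ∘ decode-≼ w _ l)))
      (meets l (valid-local {F = F′} {F} l (λ v p → sym (b v p)) valid))
    where
    upto : ∀ {v} → v ≼ w → F v ≡ F′ v
    upto (inj₁ p)    = b _ p
    upto (inj₂ refl) = eq

  top₃ : ∀ {n} (x : On) (e e′ : Vector On (suc n)) →
         ∃ λ v → x ≼ v × (∀ i → e i ≼ v) × (∀ i → e′ i ≼ v) ×
                 (∀ {w} → x < w → (∀ i → e i < w) → (∀ i → e′ i < w) → v < w)
  top₃ x e e′ =
    let u , p , q , r = upper₂ (top e) (top e′)
        v , p′ , q′ , r′ = upper₂ x u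
    in v , p′ , (λ i → ≼-trans (top-≽ e i) (≼-trans p q′)) ,
       (λ i → ≼-trans (top-≽ e′ i) (≼-trans q q′)) ,
       λ a b c → r′ a (r (b (proj₁ (maximum e))) (c (proj₁ (maximum e′))))

  union-IsK : (R : Str On) (g : Y → On) → Inj g →
    (∀ n (x : Y) (e e′ : Vector Y (suc n)) → ∃ λ v → IsK (pull {Y = Upto v} proj₁ R) ×
       g x ≼ v × (∀ i → g (e i) ≼ v) × (∀ i → g (e′ i) ≼ v)) →
    IsK (pull g R)
  union-IsK {Y = Y} R g g-inj cover = IsK-local (pull g R) λ n x e e′ →
    let v , K , p , q , r = cover n x e e′ in
    (Σ Y λ y → truth (g y ≼ v) ≡ true) , proj₁ , incl-inj ,
    pull-IsK {R = pull proj₁ R} {f = λ (y , p) → g y , p}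
      (λ (x , p) (y , q) eq → incl-inj _ _ (g-inj x y (cong proj₁ eq))) K ,
    (x , truth⁺ p) , (λ i → e i , truth⁺ (q i)) , (λ i → e′ i , truth⁺ (r i)) , refl , refl , refl

  module _ (w : On) where

    conv-at : ∀ v b → truth (v < w) ≡ b → Maybe (Down w)
    conv-at v true  eq = just (v , eq)
    conv-at v false _  = nothing

    conv : On → Maybe (Down w)
    conv v = conv-at v _ refl

    conv-< : ∀ {v} (p : truth (v < w) ≡ true) → conv v ≡ just (v , p)
    conv-< {v} p = at _ refl
      where
      at : ∀ b eq → conv-at v b eq ≡ just (v , p)
      at true  eq = cong (λ q → just (v , q)) (uip eq p)
      at false eq = ⊥-elim (true≢false p eq)

    conv-w : conv w ≡ nothing
    conv-w = at _ refl
      where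
      at : ∀ b eq → conv-at w b eq ≡ nothing
      at true  eq = ⊥-elim (<-irrefl (truth⁻ eq))
      at false _  = refl

    conv-inj : Inj {A = Upto w} (conv ∘ proj₁)
    conv-inj (x , p) (y , q) eq with truth⁻ {P = x ≼ w} p | truth⁻ {P = y ≼ w} q
    ... | inj₁ a | inj₁ b = incl-inj _ _ (cong proj₁ (just-injective
            (trans (sym (conv-< (truth⁺ a))) (trans eq (conv-< (truth⁺ b))))))
    ... | inj₁ a | inj₂ refl = case trans (sym (conv-< (truth⁺ a))) (trans eq conv-w) of λ ()
    ... | inj₂ refl | inj₁ b = case trans (sym (conv-< (truth⁺ b))) (trans (sym eq) conv-w) of λ ()
    ... | inj₂ refl | inj₂ refl = incl-inj _ _ refl

  module Step (w : On) (F : On → Str On) (ih : ∀ v → v < w → Stage v F) where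

    R : Str (Down w)
    R = pull proj₁ (assemble F)

    R-IsK : IsK R
    R-IsK = union-IsK (assemble F) proj₁ incl-inj λ n x e e′ →
      let v , p , q , r , bound = top₃ (proj₁ x) (proj₁ ∘ e) (proj₁ ∘ e′)
          v<w = bound (truth⁻ (proj₂ x)) (λ i → truth⁻ (proj₂ (e i))) (λ i → truth⁻ (proj₂ (e′ i)))
      in v , proj₁ (ih v v<w) , p , q , r

    module Extend (R⁺ : Str (Maybe (Down w))) (K⁺ : IsK R⁺) (extends : pull just R⁺ ≡ R) where

      F⁺ : On → Str On
      F⁺ = override wf F w (pull (conv w) R⁺)

      below : Below wf w F F⁺
      below = override-below wf F w (pull (conv w) R⁺)

      assembled : pull {Y = Upto w} proj₁ (assemble F⁺) ≡ pull (conv w ∘ proj₁) R⁺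
      assembled = Str-≡
        (λ (x , p) (y , q) →
          query (λ S t → lt S (t zero) (t (suc zero))) (λ _ _ _ → refl) (x ◂ y ◂ ⟨⟩) (λ _ → refl)
          λ { zero → truth⁻ p ; (suc zero) → truth⁻ q })
        (λ t → query dd (λ _ _ _ → refl) (proj₁ ∘ t) (λ _ → refl) λ i → truth⁻ (proj₂ (t i)))
        (λ n t → query (λ S → col S n) (λ _ _ _ → refl) (proj₁ ∘ t) (λ _ → refl)
          λ i → truth⁻ (proj₂ (t i)))
        where
        -- A query φ is any of the three fields, natural under `pull`. If the last entry is w, the
        -- answer is read in stage w; otherwise all entries lie below w and `extends` preserves the
        -- old answer.
        query : ∀ {n} {V : Set} (φ : ∀ {X : Set₁} → Str X → Vector X (suc n) → V) →
                (∀ {X Y : Set₁} (f : Y → X) S t → φ (pull f S) t ≡ φ S (f ∘ t)) →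
                (t : Vector On (suc n)) → (∀ F → φ (F (top t)) t ≡ φ (assemble F) t) →
                (∀ i → t i ≼ w) →
                φ (F⁺ (top t)) t ≡ φ R⁺ (conv w ∘ t)
        query φ nat t at-top le with le (proj₁ (maximum t))
        ... | inj₂ eq = trans (cong (λ v → φ (F⁺ v) t) eq)
                (trans (cong (λ S → φ S t) (override-at wf F w _)) (nat (conv w) R⁺ t))
        ... | inj₁ lt = begin
          φ (F⁺ (top t)) t         ≡⟨ cong (λ S → φ S t) (below _ lt) ⟨
          φ (F (top t)) t          ≡⟨ at-top F ⟩
          φ (assemble F) t         ≡⟨ nat proj₁ (assemble F) t⁻ ⟨
          φ R t⁻                   ≡⟨ cong (λ S → φ S t⁻) extends ⟨
          φ (pull just R⁺) t⁻      ≡⟨ nat just R⁺ t⁻ ⟩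
          φ R⁺ (just ∘ t⁻)         ≡⟨ cong (φ R⁺) (fe λ i → sym (conv-< w (proj₂ (t⁻ i)))) ⟩
          φ R⁺ (conv w ∘ t)          ∎
          where
          open ≡-Reasoning
          t⁻ : Vector (Down w) _
          t⁻ i = t i , truth⁺ (≼-<-trans (top-≽ t i) lt)

      F⁺-IsK : IsK (pull {Y = Upto w} proj₁ (assemble F⁺))
      F⁺-IsK = subst IsK (sym assembled) (pull-IsK (conv-inj w) K⁺)

    Wanted : Set₁
    Wanted = let β , s = request w in β ≼ w × Valid (assemble F) β s

    step : Dec Wanted → ∃ λ F′ → Below wf w F F′ × Stage w F′
    step (no unwanted) = F⁺ , below , F⁺-IsK , λ l valid →
      ⊥-elim (unwanted (l , valid-local {F = F⁺} {F} l (λ v p → sym (below v p)) valid))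
      where
      open Amalgam R R-IsK (λ ()) (λ ()) trivial trivial-IsK
        (Str-≡ (λ ()) (λ t → ⊥-elim (t zero)) (λ _ t → ⊥-elim (t zero)))
      open Extend R⁺ R⁺-IsK extends
    step (yes (l , T , KT , compat , eq)) = F⁺ , below , F⁺-IsK , λ _ _ → met
      where
      β : On
      β = proj₁ (request w)
      ι : Down β → Down w
      ι (v , p) = v , truth⁺ (<-≼-trans (truth⁻ p) l)
      open Amalgam R R-IsK ι (λ x y e → incl-inj x y (cong proj₁ e)) T KT compat
      open Extend R⁺ R⁺-IsK extends
      decode⁺ : Maybe (Seg β) → Upto w
      decode⁺ i = decode w β i , truth⁺ (decode-≼ w β l i)
      conv-decode : ∀ i → conv w (decode w β i) ≡ Maybe.map ι (Maybe.map (segment β) i)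
      conv-decode (just i) = conv-< w _
      conv-decode nothing  = conv-w w
      open ≡-Reasoning
      met : pull (decode w β) (assemble F⁺) ≡ proj₂ (request w)
      met = begin
        pull (decode w β) (assemble F⁺)                 ≡⟨ cong (pull decode⁺) assembled ⟩
        pull (conv w ∘ decode w β) R⁺                   ≡⟨ pull-≗ R⁺ _ _ conv-decode ⟩
        pull (Maybe.map (segment β)) (pull ι⁺ R⁺)       ≡⟨ cong (pull (Maybe.map (segment β))) realises ⟩
        pull (Maybe.map (segment β)) T                  ≡⟨ eq ⟨
        proj₂ (request w)                               ∎

  abstract
    construction : ∃ λ F → ∀ w → Stage w F
    construction = build wf (record { lt = λ _ _ → false ; dd = λ _ → false ; col = λ _ _ → zero })
      Stage stage-local λ w F ih → Step.step w F ih em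

    𝕆 : Str On
    𝕆 = assemble (proj₁ construction)

    𝕆-IsK : IsK 𝕆
    𝕆-IsK = union-IsK 𝕆 id (λ _ _ → id) λ n x e e′ →
      let v , p , q , r , _ = top₃ x e e′ in v , proj₁ (proj₂ construction v) , p , q , r

    𝕆-meets : ∀ β s → Valid 𝕆 β s → ∃ λ w → pull (decode w β) 𝕆 ≡ s
    𝕆-meets β s valid = w , met (request w) eq (proj₂ (proj₂ construction w))
      where
      w : On
      w = proj₁ (proj₂ requests β s)
      β≼w : β ≼ w
      β≼w = proj₁ (proj₂ (proj₂ requests β s))
      eq : request w ≡ (β , s)
      eq = proj₂ (proj₂ (proj₂ requests β s))
      met : ∀ r → r ≡ (β , s) → (proj₁ r ≼ w → Valid 𝕆 (proj₁ r) (proj₂ r) →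
            pull (decode w (proj₁ r)) 𝕆 ≡ proj₂ r) → pull (decode w β) 𝕆 ≡ s
      met _ refl meets = meets β≼w valid

  infix 4 _↾_~_↾_
  _↾_~_↾_ : {X : Set ℓ} {Y : Set ℓ′} {I : Set ℓ″} → Str X → (I → X) → Str Y → (I → Y) → Set ℓ″
  R ↾ a ~ S ↾ b = pull a R ≡ pull b S

  -- This is the extension property of `𝕆` over small sets. If x is fresh, its type over a is
  -- carried to the range of b and amalgamated with everything below a strict bound of b; the
  -- amalgam is a valid request, which some stage grants.
  one-point : {RX : Str X} → IsK RX → {I : Set} (a : I → X) (b : I → On) → RX ↾ a ~ 𝕆 ↾ b →
              ∀ x → ∃ λ y → RX ↾ maybe′ a x ~ 𝕆 ↾ maybe′ b y
  one-point {X = X} {RX} KX {I} a b a~b x with em {P = ∃ λ i → a i ≡ x}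
  ... | yes (i , refl) = b i , (begin
      pull (maybe′ a (a i)) RX          ≡⟨ pull-≗ RX _ _ (λ { (just _) → refl ; nothing → refl }) ⟩
      pull (maybe′ id i) (pull a RX)    ≡⟨ cong (pull (maybe′ id i)) a~b ⟩
      pull (maybe′ id i) (pull b 𝕆)     ≡⟨ pull-≗ 𝕆 _ _ (λ { (just _) → refl ; nothing → refl }) ⟩
      pull (maybe′ b (b i)) 𝕆           ∎)
    where open ≡-Reasoning
  ... | no fresh = w , (begin
      pull (maybe′ a x) RX                          ≡⟨ pull-≗ RX _ _
                                                         (λ { (just i) → a-b (sym (b-rep (in-A i)))
                                                            ; nothing → refl }) ⟩
      pull (Maybe.map in-A) (pull ψ RX)             ≡⟨ cong (pull (Maybe.map in-A)) realises ⟨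
      pull (ι⁺ ∘ Maybe.map in-A) R⁺                 ≡⟨ pull-≗ R⁺ (ι⁺ ∘ Maybe.map in-A) (Maybe.map in-β)
                                                         (λ { (just _) → refl ; nothing → refl }) ⟩
      pull (Maybe.map in-β) R⁺                      ≡⟨ cong (pull (Maybe.map in-β)) placed ⟨
      pull (maybe′ proj₁ w ∘ Maybe.map in-β) 𝕆      ≡⟨ pull-≗ 𝕆 _ _ (λ { (just _) → refl ; nothing → refl }) ⟩
      pull (maybe′ b w) 𝕆                           ∎)
    where
    β : On
    β = proj₁ (strict-bound b)
    in-β : I → Down β
    in-β i = b i , truth⁺ (proj₂ (strict-bound b) i)
    -- The map b may repeat values, so its range is the base of the amalgam, with a preimage of each
    -- element chosen by `rep`.
    Image : Set₁
    Image = Σ (Down β) λ d → truth (∃ λ i → b i ≡ proj₁ d) ≡ true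
    in-A : I → Image
    in-A i = in-β i , truth⁺ (i , refl)
    rep : Image → I
    rep (d , p) = proj₁ (truth⁻ p)
    b-rep : ∀ d → b (rep d) ≡ proj₁ (proj₁ d)
    b-rep (d , p) = proj₂ (truth⁻ p)
    ψ : Maybe Image → X
    ψ = maybe′ (a ∘ rep) x
    a-b : ∀ {i j} → b i ≡ b j → a i ≡ a j
    a-b = agree-≡ 𝕆-IsK KX b a (sym a~b) _ _
    ψ-inj : Inj ψ
    ψ-inj (just d) (just d′) eq = cong just (incl-inj _ _ (incl-inj _ _
      (trans (sym (b-rep d)) (trans (agree-≡ KX 𝕆-IsK a b a~b _ _ eq) (b-rep d′)))))
    ψ-inj (just d) nothing   eq = ⊥-elim (fresh (rep d , eq))
    ψ-inj nothing  (just d)  eq = ⊥-elim (fresh (rep d , sym eq))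
    ψ-inj nothing  nothing   eq = refl
    compat : pull (ψ ∘ just) RX ≡ pull (proj₁ ∘ proj₁) 𝕆
    compat = trans (cong (pull rep) a~b) (pull-≗ 𝕆 _ _ b-rep)
    open Amalgam {A = Image} (pull proj₁ 𝕆) (pull-IsK {X = On} {Y = Down β} incl-inj 𝕆-IsK) proj₁ incl-inj
      (pull ψ RX) (pull-IsK ψ-inj KX) compat
    chosen : ∃ λ w → pull (decode w β) 𝕆 ≡ pull (Maybe.map (segment β)) R⁺
    chosen = 𝕆-meets β _ (R⁺ , R⁺-IsK , extends , refl)
    w : On
    w = proj₁ chosen
    section : Down β → Seg β
    section (v , p) = proj₁ (elem-sur (truth⁻ p))
    elem-section : ∀ d → elem β (section d) ≡ proj₁ d
    elem-section (v , p) = proj₂ (elem-sur (truth⁻ p))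
    open ≡-Reasoning
    placed : pull (maybe′ proj₁ w) 𝕆 ≡ R⁺
    placed = begin
      pull (maybe′ proj₁ w) 𝕆                             ≡⟨ pull-≗ 𝕆 _ _
            (λ { (just d) → sym (elem-section d) ; nothing → refl }) ⟩
      pull (Maybe.map section) (pull (decode w β) 𝕆)      ≡⟨ cong (pull (Maybe.map section)) (proj₂ chosen) ⟩
      pull (Maybe.map (segment β) ∘ Maybe.map section) R⁺ ≡⟨ pull-≗ R⁺ (Maybe.map (segment β) ∘ Maybe.map section) id
            (λ { (just d) → cong just (incl-inj _ _ (elem-section d)) ; nothing → refl }) ⟩
      R⁺                                                  ∎

-- Elementary maps and countable categoricity

lift-ren : ∀ {m n} → (Fin n → Fin m) → Fin (suc n) → Fin (suc m)
lift-ren r zero    = zero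
lift-ren r (suc i) = suc (r i)

module _ {L : Language} where
  open Language L

  ren-term : ∀ {m n} → (Fin n → Fin m) → Term L n → Term L m
  ren-term r (var i)    = var (r i)
  ren-term r (app f ts) = app f λ i → ren-term r (ts i)

  ren : ∀ {m n} → (Fin n → Fin m) → Formula L n → Formula L m
  ren r false       = false
  ren r (equal s t) = equal (ren-term r s) (ren-term r t)
  ren r (rel R ts)  = rel R λ i → ren-term r (ts i)
  ren r (imp φ ψ)   = imp (ren r φ) (ren r ψ)
  ren r (all φ)     = all (ren (lift-ren r) φ)

  neg : ∀ {n} → Formula L n → Formula L n
  neg φ = imp φ false

  ex : ∀ {n} → Formula L (suc n) → Formula L n
  ex φ = neg (all (neg φ))

  ⋀ : ∀ {n} k → (Fin k → Formula L n) → Formula L n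
  ⋀ zero    φ = neg false
  ⋀ (suc k) φ = neg (imp (φ zero) (neg (⋀ k (φ ∘ suc))))

  close : ∀ {n} → Formula L n → Sentence L
  close {zero}  φ = φ
  close {suc n} φ = close (all φ)

module Logic
  (em : ∀ {ℓ} → ExcludedMiddle ℓ)
  (fe : ∀ {a b} → Extensionality a b)
  {L : Language}
  where
  open Classical em fe
  open Language L
  open Structure

  ◂-head-tail : ∀ {A : Set c} {n} (ρ : Vector A (suc n)) → ρ zero ◂ ρ ∘ suc ≡ ρ
  ◂-head-tail ρ = fe λ { zero → refl ; (suc _) → refl }

  eval-ren : (M : Structure L c) → ∀ {m n} (r : Fin n → Fin m) (ρ : Vector (Carrier M) m) t →
             eval M ρ (ren-term r t) ≡ eval M (ρ ∘ r) t
  eval-ren M r ρ (var i)    = refl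
  eval-ren M r ρ (app f ts) = cong (func M f) (fe λ i → eval-ren M r ρ (ts i))

  sat-ren : (M : Structure L c) → ∀ {m n} (r : Fin n → Fin m) (ρ : Vector (Carrier M) m) φ →
            (M ⊨ ren r φ [ ρ ]) ≡ (M ⊨ φ [ ρ ∘ r ])
  sat-ren M r ρ false       = refl
  sat-ren M r ρ (equal s t) = cong₂ _≡_ (eval-ren M r ρ s) (eval-ren M r ρ t)
  sat-ren M r ρ (rel R ts)  = cong (relation M R) (fe λ i → eval-ren M r ρ (ts i))
  sat-ren M r ρ (imp φ ψ)   = cong₂ (λ P Q → P → Q) (sat-ren M r ρ φ) (sat-ren M r ρ ψ)
  sat-ren M r ρ (all φ)     = ∀-extensionality fe _ _ λ x →
    trans (sat-ren M (lift-ren r) (x ◂ ρ) φ)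
          (cong (M ⊨ φ [_]) (fe λ { zero → refl ; (suc _) → refl }))

  module _ (M : Structure L c) where

    ex⁺ : ∀ {n} (φ : Formula L (suc n)) {ρ} x → M ⊨ φ [ x ◂ ρ ] → M ⊨ ex φ [ ρ ]
    ex⁺ φ x p none = none x p

    ex⁻ : ∀ {n} (φ : Formula L (suc n)) {ρ} → M ⊨ ex φ [ ρ ] → ∃ λ x → M ⊨ φ [ x ◂ ρ ]
    ex⁻ φ p = dne λ none → lower (p λ x q → ⊥-elim (none (x , q)))

    ⋀⁺ : ∀ {n} k (φ : Fin k → Formula L n) {ρ} → (∀ i → M ⊨ φ i [ ρ ]) → M ⊨ ⋀ k φ [ ρ ]
    ⋀⁺ zero    φ p = id
    ⋀⁺ (suc k) φ p q = q (p zero) (⋀⁺ k (φ ∘ suc) (p ∘ suc))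

    ⋀⁻ : ∀ {n} k (φ : Fin k → Formula L n) {ρ} → M ⊨ ⋀ k φ [ ρ ] → ∀ i → M ⊨ φ i [ ρ ]
    ⋀⁻ (suc k) φ p zero    = dne λ ¬q → lower (p λ q → ⊥-elim (¬q q))
    ⋀⁻ (suc k) φ p (suc i) = ⋀⁻ k (φ ∘ suc)
      (dne λ ¬q → lower (p λ _ q → ⊥-elim (¬q q))) i

    close⁺ : ∀ {n} (φ : Formula L n) → (∀ ρ → M ⊨ φ [ ρ ]) → M ⊨ close φ
    close⁺ {zero}  φ p = p ⟨⟩
    close⁺ {suc n} φ p = close⁺ (all φ) λ ρ x → p (x ◂ ρ)

    close⁻ : ∀ {n} (φ : Formula L n) → M ⊨ close φ → ∀ ρ → M ⊨ φ [ ρ ]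
    close⁻ {zero}  φ p ρ = subst (M ⊨ φ [_]) (fe λ ()) p
    close⁻ {suc n} φ p ρ = subst (M ⊨ φ [_]) (◂-head-tail ρ) (close⁻ (all φ) p (ρ ∘ suc) (ρ zero))

  -- One direction suffices, since formulas can be negated. Testing finite tuples of indices admits
  -- index sets of any size, so the notion covers tuples and whole structures.
  record Elem {I : Set ℓ} (M : Structure L c) (a : I → Carrier M)
              (N : Structure L d) (b : I → Carrier N) : Set (ℓ ⊔ c ⊔ d) where
    constructor mkElem
    field preserves : ∀ {n} φ (t : Fin n → I) → M ⊨ φ [ a ∘ t ] → N ⊨ φ [ b ∘ t ]
  open Elem public

  module _ {I : Set ℓ} {M : Structure L c} {N : Structure L d} {a : I → Carrier M} {b : I → Carrier N} where

    elem-sym : Elem M a N b → Elem N b M a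
    elem-sym el = mkElem λ φ t q → dne λ ¬p → lower (preserves el (neg φ) t (⊥-elim ∘ ¬p) q)

    elem-≡ : Elem M a N b → ∀ i j → a i ≡ a j → b i ≡ b j
    elem-≡ el i j = preserves el (equal (var zero) (var (suc zero))) (i ◂ j ◂ ⟨⟩)

  elem-tuple : {M : Structure L c} {N : Structure L d} → ∀ {n} {ρ : Vector (Carrier M) n} {σ} →
               (∀ φ → M ⊨ φ [ ρ ] → N ⊨ φ [ σ ]) → Elem M ρ N σ
  elem-tuple {M = M} {N} {ρ = ρ} {σ} el = mkElem λ φ t p →
    subst id (sat-ren N t σ φ) (el (ren t φ) (subst id (sym (sat-ren M t ρ φ)) p))

  Extends : Structure L c → Structure L d → (I : Set ℓ) → Set _
  Extends M N I = (a : I → Carrier M) (b : I → Carrier N) → Elem M a N b →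
                  ∀ x → ∃ λ y → Elem M (maybe′ a x) N (maybe′ b y)

  module BackAndForth {M : Structure L c} {N : Structure L d}
    (B : ∀ {n} → Vector (Carrier M) n → Vector (Carrier N) n → Set ℓ)
    (forth : ∀ {n} {ρ : Vector (Carrier M) n} {σ} → B ρ σ → ∀ x → ∃ λ y → B (x ◂ ρ) (y ◂ σ))
    (back  : ∀ {n} {ρ : Vector (Carrier M) n} {σ} → B ρ σ → ∀ y → ∃ λ x → B (x ◂ ρ) (y ◂ σ))
    (equals : ∀ {n} {ρ : Vector (Carrier M) n} {σ} → B ρ σ → ∀ s t →
       (eval M ρ s ≡ eval M ρ t → eval N σ s ≡ eval N σ t) ×
       (eval N σ s ≡ eval N σ t → eval M ρ s ≡ eval M ρ t))
    (relates : ∀ {n} {ρ : Vector (Carrier M) n} {σ} → B ρ σ → ∀ r (ts : Vector (Term L n) (relArity r)) →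
       (relation M r (λ i → eval M ρ (ts i)) → relation N r (λ i → eval N σ (ts i))) ×
       (relation N r (λ i → eval N σ (ts i)) → relation M r (λ i → eval M ρ (ts i))))
    where

    transfer : ∀ {n} φ {ρ : Vector (Carrier M) n} {σ} → B ρ σ →
               (M ⊨ φ [ ρ ] → N ⊨ φ [ σ ]) × (N ⊨ φ [ σ ] → M ⊨ φ [ ρ ])
    transfer false       bf = (λ ()) , (λ ())
    transfer (equal s t) bf = equals bf s t
    transfer (rel r ts)  bf = relates bf r ts
    transfer (imp φ ψ)   bf =
      (λ f → proj₁ (transfer ψ bf) ∘ f ∘ proj₂ (transfer φ bf)) ,
      (λ f → proj₂ (transfer ψ bf) ∘ f ∘ proj₁ (transfer φ bf))
    transfer (all φ)     bf =
      (λ f y → let x , bf′ = back bf y in proj₁ (transfer φ bf′) (f x)) ,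
      (λ f x → let y , bf′ = forth bf x in proj₂ (transfer φ bf′) (f y))

  iso-elem : {M : Structure L c} {N : Structure L d} (σ : M ≅ N) → Elem M id N (_≅_.to σ)
  iso-elem {M = M} {N} σ = mkElem λ φ t → proj₁ (transfer φ refl)
    where
    open _≅_ σ
    eval-to : ∀ {n} (ρ : Vector (Carrier M) n) s → to (eval M ρ s) ≡ eval N (to ∘ ρ) s
    eval-to ρ (var i)    = refl
    eval-to ρ (app f ts) = trans (pres-func f _) (cong (func N f) (fe λ i → eval-to ρ (ts i)))
    to-from : ∀ y → to (from y) ≡ y
    to-from y = Inverse.inverseˡ bijection refl
    from-to : ∀ x → from (to x) ≡ x
    from-to x = Inverse.inverseʳ bijection refl
    extend : ∀ {n} {ρ : Vector (Carrier M) n} {τ} {x y} → to ∘ ρ ≡ τ → to x ≡ y → to ∘ (x ◂ ρ) ≡ y ◂ τ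
    extend refl refl = fe λ { zero → refl ; (suc _) → refl }
    equals : ∀ {n} {ρ : Vector (Carrier M) n} {τ} → to ∘ ρ ≡ τ → ∀ s t →
             (eval M ρ s ≡ eval M ρ t → eval N τ s ≡ eval N τ t) ×
             (eval N τ s ≡ eval N τ t → eval M ρ s ≡ eval M ρ t)
    equals {ρ = ρ} refl s t =
      (λ eq → trans (sym (eval-to ρ s)) (trans (cong to eq) (eval-to ρ t))) ,
      (λ eq → trans (sym (from-to _)) (trans (cong from
         (trans (eval-to ρ s) (trans eq (sym (eval-to ρ t))))) (from-to _)))
    relates : ∀ {n} {ρ : Vector (Carrier M) n} {τ} → to ∘ ρ ≡ τ → ∀ r (ts : Vector (Term L n) (relArity r)) →
              (relation M r (λ i → eval M ρ (ts i)) → relation N r (λ i → eval N τ (ts i))) ×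
              (relation N r (λ i → eval N τ (ts i)) → relation M r (λ i → eval M ρ (ts i)))
    relates {ρ = ρ} refl r ts =
      (λ p → subst (relation N r) (fe λ i → eval-to ρ (ts i))
               (Equivalence.to (pres-relation r _) p)) ,
      (λ p → Equivalence.from (pres-relation r _)
               (subst (relation N r) (fe λ i → sym (eval-to ρ (ts i))) p))
    open BackAndForth {M = M} {N} (λ ρ τ → to ∘ ρ ≡ τ)
      (λ eq x → to x , extend eq refl) (λ eq y → from y , extend eq (to-from y)) equals relates

  -- The codes need not be sharp: several codes may belong to one type, and some to no tuple.
  FinitelyManyTypes : Structure L c → Set _
  FinitelyManyTypes M = ∀ n → ∃ λ k → Σ (Vector (Carrier M) n → Fin k) λ type →
    ∀ ρ σ → type ρ ≡ type σ → Elem M ρ M σ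

  -- Structures with finitely many types in each finite number of variables: all types are
  -- isolated, and the isolating formulas work in every model of the same theory.
  module RyllNardzewski (C : Structure L c) (types : FinitelyManyTypes C) where

    Isolates : ∀ {n} → Vector (Carrier C) n → Formula L n → Set _
    Isolates ρ θ = C ⊨ θ [ ρ ] × (∀ σ → C ⊨ θ [ σ ] → Elem C ρ C σ)

    -- For each code some formula true of ρ admits, among the tuples of that code, only those with
    -- the type of ρ. As there are finitely many codes, these formulas have a conjunction.
    isolated : ∀ {n} (ρ : Vector (Carrier C) n) → ∃ (Isolates ρ)
    isolated {n} ρ = ⋀ k (proj₁ ∘ separated) , ⋀⁺ C k (proj₁ ∘ separated) (proj₁ ∘ proj₂ ∘ separated) ,
      λ σ p → proj₂ (proj₂ (separated (type σ))) σ refl (⋀⁻ C k (proj₁ ∘ separated) p (type σ))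
      where
      k = proj₁ (types n)
      type = proj₁ (proj₂ (types n))
      same = proj₂ (proj₂ (types n))
      separated : ∀ i → ∃ λ ψ → C ⊨ ψ [ ρ ] × (∀ σ → type σ ≡ i → C ⊨ ψ [ σ ] → Elem C ρ C σ)
      separated i with em {P = ∀ σ → type σ ≡ i → Elem C ρ C σ}
      ... | yes same-as = neg false , id , λ σ eq _ → same-as σ eq
      ... | no ¬elem =
        let σ , ¬p = ¬∀⇒∃¬ ¬elem
            typeσ≡i = dne {P = type σ ≡ i} λ ne → ¬p λ eq → ⊥-elim (ne eq)
            ψ , ¬q = ¬∀⇒∃¬ {P = λ φ → C ⊨ φ [ ρ ] → C ⊨ φ [ σ ]}
                       λ el → ¬p λ _ → elem-tuple el
        in ψ , dne (λ ¬r → ¬q λ r → ⊥-elim (¬r r)) , λ τ eq r →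
           ⊥-elim (¬q λ _ → preserves (same τ σ (trans eq (sym typeσ≡i))) ψ id r)

    module _ {M : Structure L d} (models : ∀ φ → C ⊨ φ → M ⊨ φ) where

      isolates-in : ∀ {n} {ρ : Vector (Carrier C) n} {θ} → Isolates ρ θ →
                    ∀ {σ} → M ⊨ θ [ σ ] → Elem C ρ M σ
      isolates-in {θ = θ} (_ , iso) {σ} p = elem-tuple λ ψ q →
        close⁻ M (imp θ ψ)
          (models (close (imp θ ψ)) (close⁺ C (imp θ ψ) λ τ r → preserves (iso τ r) ψ id q)) σ p

      -- Every tuple of C satisfies the isolating formula of its code. The universal closure of this
      -- finite disjunction passes to M, where an isolating formula still fixes the type.
      realised : ∀ {n} (σ : Vector (Carrier M) n) → ∃ λ ρ → Elem C ρ M σ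
      realised {n} σ = dne λ none → lower
        (close⁻ M (neg (⋀ k (neg ∘ θ)))
          (models (close (neg (⋀ k (neg ∘ θ)))) (close⁺ C (neg (⋀ k (neg ∘ θ))) covered)) σ
          (⋀⁺ M k (neg ∘ θ) λ i p → ⊥-elim (none (found i p))))
        where
        k = proj₁ (types n)
        type = proj₁ (proj₂ (types n))
        same = proj₂ (proj₂ (types n))
        -- A code without tuples gets the formula `false`, which no tuple of M satisfies.
        Class : Fin k → Formula L n → Set _
        Class i θ = (θ ≡ false × (∀ ρ → type ρ ≢ i)) ⊎ ∃ λ ρ → type ρ ≡ i × Isolates ρ θ
        class : ∀ i → ∃ (Class i)
        class i with em {P = ∃ λ ρ → type ρ ≡ i}
        ... | yes (ρ , eq) = let θ , iso = isolated ρ in θ , inj₂ (ρ , eq , iso)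
        ... | no none      = false , inj₁ (refl , λ ρ eq → none (ρ , eq))
        θ : Fin k → Formula L n
        θ = proj₁ ∘ class
        covered : ∀ ρ → C ⊨ neg (⋀ k (neg ∘ θ)) [ ρ ]
        covered ρ p with proj₂ (class (type ρ)) | ⋀⁻ C k (neg ∘ θ) p (type ρ)
        ... | inj₁ (_ , empty) | _ = ⊥-elim (empty ρ refl)
        ... | inj₂ (ρ′ , eq , iso) | q = q (preserves (same ρ′ ρ eq) (θ (type ρ)) id (proj₁ iso))
        found : ∀ i → M ⊨ θ i [ σ ] → ∃ λ ρ → Elem C ρ M σ
        found i p with class i
        found i () | .false , inj₁ (refl , _)
        found i p  | θ′ , inj₂ (ρ , _ , iso) = ρ , isolates-in {θ = θ′} iso p

    module _ {M : Structure L d} {N : Structure L e}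
      (models-M : ∀ φ → C ⊨ φ → M ⊨ φ) (models-N : ∀ φ → C ⊨ φ → N ⊨ φ) where

      -- If θ isolates the type of `x ◂ ρ`, then `ex θ` holds of ρ and hence of σ; any witness has
      -- the right type because θ isolates in N as well.
      extends-tuple : ∀ {n} {ρ : Vector (Carrier M) n} {σ} → Elem M ρ N σ →
                      ∀ x → ∃ λ y → Elem M (x ◂ ρ) N (y ◂ σ)
      extends-tuple {ρ = ρ} {σ} el x =
        let τ , el₁ = realised models-M (x ◂ ρ)
            θ , iso = isolated τ
            y , p   = ex⁻ N θ (preserves el (ex θ) id (ex⁺ M θ x (preserves el₁ θ id (proj₁ iso))))
            el₂     = isolates-in models-N {θ = θ} iso p
        in y , mkElem λ φ t q → preserves el₂ φ t (preserves (elem-sym el₁) φ t q)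

      extends-finite : ∀ {n} {I : Set} (r : I → Fin n) (s : Fin n → I) → (∀ i → s (r i) ≡ i) → Extends M N I
      extends-finite r s sr a b el x =
        let y , el′ = extends-tuple {ρ = a ∘ s} {b ∘ s} (mkElem λ φ t → preserves el φ (s ∘ t)) x
        in y , mkElem λ φ t p → subst (N ⊨ φ [_]) (sym (via b y t))
             (preserves el′ φ (index ∘ t) (subst (M ⊨ φ [_]) (via a x t) p))
        where
        index : _ → Fin _
        index = maybe′ (suc ∘ r) zero
        via : ∀ {A : Set ℓ} (a : _ → A) x {n} (t : Fin n → _) → maybe′ a x ∘ t ≡ (x ◂ a ∘ s) ∘ index ∘ t
        via a x t = fe λ k → at (t k)
          where
          at : ∀ i → maybe′ a x i ≡ (x ◂ a ∘ s) (index i)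
          at (just i) = cong a (sym (sr i))
          at nothing  = refl

-- Back and forth along a well-order, and countable elementary substructures

module Isomorphisms
  (em : ∀ {ℓ} → ExcludedMiddle ℓ)
  (fe : ∀ {a b} → Extensionality a b)
  {L : Language}
  where
  open Classical em fe
  open Logic em fe {L}
  open Language L
  open Structure

  elem-trans : {I : Set ℓ} {M : Structure L c} {N : Structure L d} {P : Structure L e}
               {f : I → Carrier M} {g : I → Carrier N} {h : I → Carrier P} →
               Elem M f N g → Elem N g P h → Elem M f P h
  elem-trans p q = mkElem λ φ t → preserves q φ t ∘ preserves p φ t

  elem-subst : {I : Set ℓ} {M : Structure L c} {N : Structure L d}
               {f f′ : I → Carrier M} {g g′ : I → Carrier N} →
               f ≡ f′ → g ≡ g′ → Elem M f N g → Elem M f′ N g′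
  elem-subst refl refl p = p

  elementary-bijection : {M : Structure L c} {N : Structure L d}
    (to : Carrier M → Carrier N) (from : Carrier N → Carrier M) →
    (∀ y → to (from y) ≡ y) → (∀ x → from (to x) ≡ x) → Elem M id N to → M ≅ N
  elementary-bijection {M = M} {N} to from to-from from-to el = record
    { bijection     = mk↔ₛ′ to from to-from from-to
    ; pres-func     = λ f xs → preserves el (equal (var zero) (app f (var ∘ suc))) (func M f xs ◂ xs) refl
    ; pres-relation = λ r xs → mk⇔ (preserves el (rel r var) xs)
        (preserves (elem-sym el) (rel r var) xs)
    }

  module Along {W : Set ℓ} (order : SmallWellOrder W)
    {M : Structure L c} {N : Structure L d}
    (enumM : W → Carrier M) (surM : ∀ x → ∃ λ v → enumM v ≡ x)
    (enumN : W → Carrier N) (surN : ∀ y → ∃ λ v → enumN v ≡ y)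
    {I : Set} (a : I → Carrier M) (b : I → Carrier N) (base : Elem M a N b)
    where
    open SmallWellOrder order

    Entry : Set ℓ
    Entry = I ⊎ (W × Bool)

    -- The stage v pairs the v-th element of M with the second component of F v, and the first
    -- component of F v with the v-th element of N.
    left : (W → Carrier M × Carrier N) → Entry → Carrier M
    left F (inj₁ i)           = a i
    left F (inj₂ (v , true))  = enumM v
    left F (inj₂ (v , false)) = proj₁ (F v)

    right : (W → Carrier M × Carrier N) → Entry → Carrier N
    right F (inj₁ i)           = b i
    right F (inj₂ (v , true))  = proj₂ (F v)
    right F (inj₂ (v , false)) = enumN v

    Within Before : W → Entry → Set ℓ
    Within w (inj₁ _)       = ⊤
    Within w (inj₂ (v , _)) = v ≼ w
    Before w (inj₁ _)       = ⊤
    Before w (inj₂ (v , _)) = Lift ℓ (v < w)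

    Stage : W → (W → Carrier M × Carrier N) → Set _
    Stage w F = ∀ {n} φ (t : Fin n → Entry) → (∀ k → Within w (t k)) →
                M ⊨ φ [ left F ∘ t ] → N ⊨ φ [ right F ∘ t ]

    within-mono : ∀ {u w} → u ≼ w → ∀ v → Within u v → Within w v
    within-mono l (inj₁ _) _ = _
    within-mono l (inj₂ _) p = ≼-trans p l

    -- A formula sees finitely many entries, so one stage v contains them all, and v precedes each w
    -- beyond them. Hence the stages below w together give an elementary map, also when w is a
    -- limit.
    bounding : ∀ {n} (t : Fin n → Entry) → (∀ k → ∃ λ i → t k ≡ inj₁ i) ⊎
      ∃ λ v → (∀ k → Within v (t k)) × (∀ w → (∀ k → Before w (t k)) → v < w)
    bounding {zero}  t = inj₁ λ ()
    bounding {suc n} t with t zero in eq | bounding (t ∘ suc)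
    ... | inj₁ i | inj₁ old = inj₁ λ { zero → i , eq ; (suc k) → old k }
    ... | inj₁ i | inj₂ (v , p , q) = inj₂ (v ,
          (λ { zero → subst (Within v) (sym eq) _ ; (suc k) → p k }) , λ w r → q w (r ∘ suc))
    ... | inj₂ (u , x) | inj₁ old = inj₂ (u ,
          (λ { zero → subst (Within u) (sym eq) (inj₂ refl)
             ; (suc k) → subst (Within u) (sym (proj₂ (old k))) _ }) ,
          λ w r → lower (subst (Before w) eq (r zero)))
    ... | inj₂ (u , x) | inj₂ (v , p , q) =
      let m , u≼m , v≼m , least-bound = upper₂ u v in inj₂ (m ,
          (λ { zero → subst (Within m) (sym eq) u≼m
             ; (suc k) → within-mono v≼m (t (suc k)) (p k) }) ,
          λ w r → least-bound (lower (subst (Before w) eq (r zero))) (q w (r ∘ suc)))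

    agree : ∀ {F F′ w} → (∀ v → v ≼ w → F v ≡ F′ v) → ∀ v → Within w v →
            left F v ≡ left F′ v × right F v ≡ right F′ v
    agree eq (inj₁ _) _           = refl , refl
    agree eq (inj₂ (v , true)) p  = refl , cong proj₂ (eq v p)
    agree eq (inj₂ (v , false)) p = cong proj₁ (eq v p) , refl

    stage-local : Local wf Stage
    stage-local w F F′ b eq stage φ t p q =
      subst (N ⊨ φ [_]) (fe λ k → proj₂ (same (t k) (p k)))
        (stage φ t p (subst (M ⊨ φ [_]) (sym (fe λ k → proj₁ (same (t k) (p k)))) q))
      where
      same = agree {F} {F′} {w} λ { v (inj₁ v<w) → b v v<w ; v (inj₂ refl) → eq }

    Segment : W → Set
    Segment w = I ⊎ (Seg w × Bool)

    include : ∀ w → Segment w → Entry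
    include w (inj₁ i)       = inj₁ i
    include w (inj₂ (s , x)) = inj₂ (elem w s , x)

    include-before : ∀ w k → Before w (include w k)
    include-before w (inj₁ _)       = _
    include-before w (inj₂ (s , _)) = lift (elem-< w s)

    from-stages : ∀ F {n} φ (t : Fin n → Entry) →
                  (∀ v → (∀ w → (∀ k → Before w (t k)) → v < w) → Stage v F) →
                  M ⊨ φ [ left F ∘ t ] → N ⊨ φ [ right F ∘ t ]
    from-stages F φ t stages p with bounding t
    ... | inj₂ (v , within , below) = stages v below φ t within p
    ... | inj₁ all-base =
      subst (N ⊨ φ [_]) (fe λ k → cong (right F) (sym (proj₂ (all-base k))))
        (preserves base φ (proj₁ ∘ all-base)
          (subst (M ⊨ φ [_]) (fe λ k → cong (left F) (proj₂ (all-base k))) p))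

    module _ (ext  : ∀ w → Extends M N (Segment w))
             (ext⁻ : ∀ w → Extends N M (Maybe (Segment w))) where

      step : ∀ w F → (∀ v → v < w → Stage v F) → ∃ λ F′ → Below wf w F F′ × Stage w F′
      step w F ih = F′ , below , stage
        where
        l = left F ∘ include w
        r = right F ∘ include w
        first : ∃ λ y → Elem M (maybe′ l (enumM w)) N (maybe′ r y)
        first = ext w l r (mkElem λ φ t → from-stages F φ (include w ∘ t)
          λ v below → ih v (below w λ k → include-before w (t k))) (enumM w)
        y = proj₁ first
        second : ∃ λ x → Elem N (maybe′ (maybe′ r y) (enumN w)) M (maybe′ (maybe′ l (enumM w)) x)
        second = ext⁻ w _ _ (elem-sym (proj₂ first)) (enumN w)
        x = proj₁ second
        F′ = override wf F w (x , y)
        below = override-below wf F w (x , y)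
        locate : ∀ v → Within w v → ∃ λ k →
          left F′ v ≡ maybe′ (maybe′ l (enumM w)) x k × right F′ v ≡ maybe′ (maybe′ r y) (enumN w) k
        locate (inj₁ i) _ = just (just (inj₁ i)) , refl , refl
        locate (inj₂ (v , true)) (inj₁ v<w) =
          let s , eq = elem-sur v<w in just (just (inj₂ (s , true))) , cong enumM (sym eq) ,
          trans (cong proj₂ (sym (below v v<w))) (cong (proj₂ ∘ F) (sym eq))
        locate (inj₂ (v , false)) (inj₁ v<w) =
          let s , eq = elem-sur v<w in just (just (inj₂ (s , false))) ,
          trans (cong proj₁ (sym (below v v<w))) (cong (proj₁ ∘ F) (sym eq)) , cong enumN (sym eq)
        locate (inj₂ (v , true)) (inj₂ refl) =
          just nothing , refl , cong proj₂ (override-at wf F w (x , y))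
        locate (inj₂ (v , false)) (inj₂ refl) =
          nothing , cong proj₁ (override-at wf F w (x , y)) , refl
        stage : Stage w F′
        stage φ t within p =
          subst (N ⊨ φ [_]) (sym (fe λ k → proj₂ (proj₂ (at k))))
            (preserves (elem-sym (proj₂ second)) φ (proj₁ ∘ at)
              (subst (M ⊨ φ [_]) (fe λ k → proj₁ (proj₂ (at k))) p))
          where
          at = λ k → locate (t k) (within k)

      -- Elements of M are read at entries marked `true`, those of N at entries marked `false`.
      -- Because `total` and its inverse preserve equality between entries of both kinds, the two
      -- maps are mutually inverse.
      isomorphism : Σ (M ≅ N) λ σ → ∀ i → _≅_.to σ (a i) ≡ b i
      isomorphism = elementary-bijection to from to-from from-to elementary ,
          λ i → elem-≡ total (selM (a i)) (inj₁ i) (proj₂ (surM (a i)))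
        where
        built = build wf (nonempty M , nonempty N) Stage stage-local step
        F = proj₁ built
        total : Elem M (left F) N (right F)
        total = mkElem λ φ t → from-stages F φ t λ v _ → proj₂ built v
        selM : Carrier M → Entry
        selM x = inj₂ (proj₁ (surM x) , true)
        selN : Carrier N → Entry
        selN y = inj₂ (proj₁ (surN y) , false)
        to : Carrier M → Carrier N
        to x = right F (selM x)
        from : Carrier N → Carrier M
        from y = left F (selN y)
        to-from : ∀ y → to (from y) ≡ y
        to-from y = trans (elem-≡ total (selM (from y)) (selN y) (proj₂ (surM (from y))))
                          (proj₂ (surN y))
        from-to : ∀ x → from (to x) ≡ x
        from-to x = trans (elem-≡ (elem-sym total) (selN (to x)) (selM x)
                            (proj₂ (surN (to x)))) (proj₂ (surM x))
        elementary : Elem M id N to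
        elementary = mkElem λ φ t p → preserves total φ (selM ∘ t)
          (subst (M ⊨ φ [_]) (fe λ k → sym (proj₂ (surM (t k)))) p)

  module _ {M : Structure L c} (countable : Carrier M ↣ ℕ) where
    open Injection countable using (to; injective)

    enumeration : ℕ → Carrier M
    enumeration k = choose (λ x → to x ≡ k) (nonempty M)

    enumeration-sur : ∀ x → ∃ λ k → enumeration k ≡ x
    enumeration-sur x = to x ,
      injective (choose-spec {P = λ y → to y ≡ to x} (nonempty M) (x , refl))

  categorical : (N : Structure L 0ℓ) → Countable N → FinitelyManyTypes N → CountablyCategorical N
  categorical N countable types = countable , N , (countable , λ _ → id) , λ M (countable′ , models) →
    proj₁ (Along.isomorphism ℕ-order {M = M} {N} (enumeration {M = M} countable′)
      (enumeration-sur {M = M} countable′) (enumeration {M = N} countable) (enumeration-sur {M = N} countable)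
      {⊥} ⊥-elim ⊥-elim (base M models)
      (λ w → extends-finite models (λ _ → id) (code w) (decode w) (decode-code w))
      (λ w → extends-finite (λ _ → id) models (maybe′ (suc ∘ code w) zero)
        (λ { zero → nothing ; (suc i) → just (decode w i) })
        λ { (just k) → cong just (decode-code w k) ; nothing → refl }))
    where
    open RyllNardzewski N types
    code : ∀ w → ⊥ ⊎ (Fin w × Bool) → Fin (w * 2)
    code w (inj₂ (i , true))  = combine i zero
    code w (inj₂ (i , false)) = combine i (suc zero)
    truth-value : Fin 2 → Bool
    truth-value zero       = true
    truth-value (suc zero) = false
    decode : ∀ w → Fin (w * 2) → ⊥ ⊎ (Fin w × Bool)
    decode w k = let i , j = remQuot 2 k in inj₂ (i , truth-value j)
    decode-code : ∀ w k → decode w (code w k) ≡ k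
    decode-code w (inj₂ (i , true))  =
      cong (λ (i , j) → inj₂ (i , truth-value j)) (remQuot-combine i zero)
    decode-code w (inj₂ (i , false)) =
      cong (λ (i , j) → inj₂ (i , truth-value j)) (remQuot-combine i (suc zero))
    base : ∀ M → (∀ φ → N ⊨ φ → M ⊨ φ) → Elem {I = ⊥} M ⊥-elim N ⊥-elim
    base M models = mkElem transport
      where
      transport : ∀ {n} φ (t : Fin n → ⊥) → M ⊨ φ [ ⊥-elim ∘ t ] → N ⊨ φ [ ⊥-elim ∘ t ]
      transport {suc n} φ t p = ⊥-elim (t zero)
      transport {zero}  φ t p = subst (N ⊨ φ [_]) (fe λ ()) (dne λ ¬q →
        lower (models (neg φ) (⊥-elim ∘ ¬q) (subst (M ⊨ φ [_]) (fe λ ()) p)))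

  -- Downward Löwenheim–Skolem: stage w of the enumeration realises a type over the first k
  -- elements that is not yet realised, with k as small as possible; such a k is exceeded after
  -- finitely many stages since there are only finitely many types over k elements.
  module Countably (C : Structure L c) (types : FinitelyManyTypes C)
    (relational : Func → ⊥)
    (infinite : ∀ {k} (f : Fin k → Carrier C) → ∃ λ x → ∀ i → f i ≢ x) where
    open RyllNardzewski C types
    open SmallWellOrder ℕ-order using (wf)

    Same : (ℕ → Carrier C) → ℕ → Carrier C → Carrier C → Set _
    Same f k x y = Elem C (x ◂ (λ (i : Fin k) → f (toℕ i))) C (y ◂ (λ i → f (toℕ i)))

    New : ℕ → (ℕ → Carrier C) → ℕ → Carrier C → Set _
    New w f k x = ∀ v → v ℕ.< w → ¬ Same f k x (f v)

    Stage : ℕ → (ℕ → Carrier C) → Set _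
    Stage w f = ∀ k x → k ≤ w → New w f k x → ∃ λ k′ → k′ ≤ k × New w f k′ (f w)

    new-local : ∀ {w f g k x} → k ≤ w → Below wf w f g → New w f k x → New w g k x
    new-local {w} {f} {g} {k} {x} k≤w b new v v<w same = new v v<w (elem-subst
      (cong (x ◂_) (sym eq)) (cong₂ _◂_ (sym (b v v<w)) (sym eq)) same)
      where
      eq : (λ (i : Fin k) → f (toℕ i)) ≡ (λ i → g (toℕ i))
      eq = fe λ i → b (toℕ i) (ℕ.<-≤-trans (toℕ<n i) k≤w)

    built : ∃ λ f → ∀ w → Stage w f
    built = build wf (nonempty C) Stage local step
      where
      flip : ∀ {w} {f g : ℕ → Carrier C} → Below wf w f g → Below wf w g f
      flip b v v<w = sym (b v v<w)
      local : Local wf Stage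
      local w f g b eq stage k x k≤w new =
        let k′ , k′≤k , new′ = stage k x k≤w (new-local {f = g} k≤w (flip b) new) in
        k′ , k′≤k , subst (New w g k′) eq (new-local {f = f} (ℕ.≤-trans k′≤k k≤w) b new′)
      step : ∀ w f → (∀ v → v ℕ.< w → Stage v f) → ∃ λ g → Below wf w f g × Stage w g
      step w f _ with em {P = ∃ λ k → ∃ λ x → k ≤ w × New w f k x}
      ... | no none = f , (λ _ _ → refl) , λ k x k≤w new → ⊥-elim (none (k , x , k≤w , new))
      ... | yes some =
        let k , (x , k≤w , new) , min = least wf (λ k → ∃ λ x → k ≤ w × New w f k x) some
            g = override wf f w x
            b = override-below wf f w x
        in g , b , λ k₂ x₂ k₂≤w new₂ →
             k , ℕ.≮⇒≥ (λ lt → min k₂ lt (x₂ , k₂≤w , new-local {f = g} k₂≤w (flip b) new₂)) ,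
             subst (New w g k) (sym (override-at wf f w x)) (new-local {f = f} k≤w b new)

    f : ℕ → Carrier C
    f = proj₁ built

    same-mono : ∀ {k k′ x y} → k′ ≤ k → Same f k x y → Same f k′ x y
    same-mono {k} {k′} {x} {y} k′≤k same = mkElem λ φ t p →
      subst (C ⊨ φ [_]) (via y t) (preserves same φ (weaken ∘ t) (subst (C ⊨ φ [_]) (sym (via x t)) p))
      where
      weaken : Fin (suc k′) → Fin (suc k)
      weaken zero    = zero
      weaken (suc i) = suc (Fin.inject≤ i k′≤k)
      via : ∀ z {n} (t : Fin n → Fin (suc k′)) →
            (z ◂ (λ i → f (toℕ i))) ∘ weaken ∘ t ≡ (z ◂ (λ i → f (toℕ i))) ∘ t
      via z t = fe λ i → at (t i)
        where
        at : ∀ j → (z ◂ (λ (i : Fin k) → f (toℕ i))) (weaken j) ≡ (z ◂ (λ (i : Fin k′) → f (toℕ i))) j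
        at zero    = refl
        at (suc i) = cong f (toℕ-inject≤ i k′≤k)

    closed : ∀ k x → ∃ λ v → Same f k x (f v)
    closed k x = dne λ none →
      let K , type , equal-type = types (suc k)
          new : ∀ w → k ≤ w → New w f k (f w)
          new w k≤w = let k′ , k′≤k , new′ = proj₂ built w k x k≤w (λ v _ s → none (v , s)) in
            λ v v<w s → new′ v v<w (same-mono k′≤k s)
          i , j , i<j , eq = pigeonhole (ℕ.n<1+n K)
            (λ j → type (f (k + toℕ j) ◂ (λ i → f (toℕ i))))
      in new (k + toℕ j) (ℕ.m≤m+n k _) (k + toℕ i) (ℕ.+-monoʳ-< k i<j)
           (equal-type _ _ (sym eq))

    f-inj : ∀ {v w} → v ℕ.< w → f v ≢ f w
    f-inj {v} {w} v<w fv≡fw =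
      -- A point off the first w values has a type over them that none of them realises. So stage w
      -- is not idle, and `f w` has a type that no earlier value has.
      let x , x∉ = infinite {w} (f ∘ toℕ)
          _ , _ , new = proj₂ built w w x ℕ.≤-refl λ u u<w same →
            x∉ (fromℕ< u<w) (sym (elem-≡ (elem-sym same) zero (suc (fromℕ< u<w))
              (cong f (sym (toℕ-fromℕ< u<w)))))
      in new v v<w (elem-subst refl (cong (_◂ _) (sym fv≡fw)) (mkElem λ φ t → id))

    N : Structure L 0ℓ
    N = record
      { Carrier  = ℕ
      ; nonempty = 0
      ; func     = λ g → ⊥-elim (relational g)
      ; relation = λ r xs → truth (relation C r (f ∘ xs)) ≡ true
      }

    elementary : ∀ {n} φ (ρ : Vector ℕ n) → (N ⊨ φ [ ρ ] → C ⊨ φ [ f ∘ ρ ]) × (C ⊨ φ [ f ∘ ρ ] → N ⊨ φ [ ρ ])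
    elementary φ ρ = transfer φ (mkElem λ _ _ → id)
      where
      eval-f : ∀ {n} (ρ : Vector ℕ n) t → f (eval N ρ t) ≡ eval C (f ∘ ρ) t
      eval-f ρ (var i)   = refl
      eval-f ρ (app g _) = ⊥-elim (relational g)
      f-injective : ∀ {v w} → f v ≡ f w → v ≡ w
      f-injective {v} {w} eq with SmallWellOrder.compare ℕ-order v w
      ... | inj₁ v<w        = ⊥-elim (f-inj v<w eq)
      ... | inj₂ (inj₁ p)   = p
      ... | inj₂ (inj₂ w<v) = ⊥-elim (f-inj w<v (sym eq))
      Matching : ∀ {n} → Vector ℕ n → Vector (Carrier C) n → Set _
      Matching ρ σ = Elem C (f ∘ ρ) C σ
      cons : ∀ {n} (x : ℕ) (ρ : Vector ℕ n) → f x ◂ (f ∘ ρ) ≡ f ∘ (x ◂ ρ)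
      cons x ρ = fe λ { zero → refl ; (suc _) → refl }
      bounded : ∀ {n} (ρ : Vector ℕ n) → ∃ λ k → ∀ i → ρ i ℕ.< k
      bounded {zero}  ρ = 0 , λ ()
      bounded {suc n} ρ =
        let k , p = bounded (ρ ∘ suc) in suc (ρ zero) ℕ.⊔ k ,
        λ { zero → ℕ.m≤m⊔n _ k ; (suc i) → ℕ.≤-trans (p i) (ℕ.m≤n⊔m _ k) }
      back : ∀ {n} {ρ : Vector ℕ n} {σ} → Matching ρ σ → ∀ y → ∃ λ x → Matching (x ◂ ρ) (y ◂ σ)
      back {ρ = ρ} {σ} el y =
        let x , el₁ = extends-tuple (λ _ → id) (λ _ → id) (elem-sym el) y
            k , below = bounded ρ
            v , same = closed k x
            index : Fin (suc _) → Fin (suc k)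
            index = λ { zero → zero ; (suc i) → suc (fromℕ< (below i)) }
            via : ∀ z → (z ◂ (λ i → f (toℕ i))) ∘ index ≡ z ◂ (f ∘ ρ)
            via z = fe λ { zero → refl ; (suc i) → cong f (toℕ-fromℕ< (below i)) }
            el₂ : Elem C (f v ◂ (f ∘ ρ)) C (x ◂ (f ∘ ρ))
            el₂ = elem-subst (via (f v)) (via x)
              (mkElem λ φ t → preserves (elem-sym same) φ (index ∘ t))
        in v , elem-subst (cons v ρ) refl (elem-trans el₂ (elem-sym el₁))
      forth : ∀ {n} {ρ : Vector ℕ n} {σ} → Matching ρ σ → ∀ x → ∃ λ y → Matching (x ◂ ρ) (y ◂ σ)
      forth {ρ = ρ} el x =
        let y , el′ = extends-tuple (λ _ → id) (λ _ → id) el (f x)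
        in y , elem-subst (cons x ρ) refl el′
      equals : ∀ {n} {ρ : Vector ℕ n} {σ} → Matching ρ σ → ∀ s t →
               (eval N ρ s ≡ eval N ρ t → eval C σ s ≡ eval C σ t) ×
               (eval C σ s ≡ eval C σ t → eval N ρ s ≡ eval N ρ t)
      equals {ρ = ρ} el s t =
        (λ eq → preserves el (equal s t) id (trans (sym (eval-f ρ s)) (trans (cong f eq) (eval-f ρ t)))) ,
        (λ eq → f-injective (trans (eval-f ρ s)
          (trans (preserves (elem-sym el) (equal s t) id eq) (sym (eval-f ρ t)))))
      relates : ∀ {n} {ρ : Vector ℕ n} {σ} → Matching ρ σ → ∀ r (ts : Vector (Term L n) (relArity r)) →
                (relation N r (λ i → eval N ρ (ts i)) → relation C r (λ i → eval C σ (ts i))) ×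
                (relation C r (λ i → eval C σ (ts i)) → relation N r (λ i → eval N ρ (ts i)))
      relates {ρ = ρ} el r ts =
        (λ p → preserves el (rel r ts) id (subst (relation C r) (fe λ i → eval-f ρ (ts i)) (truth⁻ p))) ,
        (λ p → truth⁺ (subst (relation C r) (fe λ i → sym (eval-f ρ (ts i)))
          (preserves (elem-sym el) (rel r ts) id p)))
      open BackAndForth {M = N} {C} Matching forth back equals relates

    N-types : FinitelyManyTypes N
    N-types n = let k , type , same = types n in
      k , (λ ρ → type (f ∘ ρ)) , λ ρ σ eq → mkElem λ φ t p →
        proj₂ (elementary φ (σ ∘ t)) (preserves (same _ _ eq) φ t (proj₁ (elementary φ (ρ ∘ t)) p))

    N-countable : Countable N
    N-countable = mk↣ {to = id} id

  -- The type of x over a, rewritten with parameters b, is finitely satisfiable: finitely many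
  -- formulas name finitely many parameters, and over those `extends-tuple` applies.
  saturated-extends : (C : Structure L (lsuc 0ℓ)) → FinitelyManyTypes C → Saturated C →
                      (K : Set) → Extends C C K
  saturated-extends C types saturated K a b el x = y , mkElem λ {n} φ v p →
      real (n , φ , v) (truth⁺ p)
    where
    open RyllNardzewski C types
    Φ : PartialType L (Maybe K)
    Φ φ = truth (Satisfies C (maybe′ a x) φ) ≡ true
    parameters : List (FormulaOver L (Maybe K)) → List K
    parameters []                = []
    parameters ((n , _ , v) ∷ φs) = mapMaybe id (tabulate v) ++ parameters φs
    used : ∀ {n} (v : Fin n → Maybe K) i {κ} → v i ≡ just κ → κ ∈ mapMaybe id (tabulate v)
    used v zero    eq rewrite eq = here refl
    used v (suc i) eq with v zero
    ... | just _  = there (used (v ∘ suc) i eq)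
    ... | nothing = used (v ∘ suc) i eq
    finite : (φs : List (FormulaOver L (Maybe K))) → All Φ φs →
             ∃ λ y → All (Satisfies C (maybe′ b y)) φs
    finite φs all-Φ = y , transfer-all φs (λ p → p) all-Φ
      where
      ks = parameters φs
      u : Fin _ → K
      u = lookup ks
      one = extends-tuple (λ _ → id) (λ _ → id) {ρ = a ∘ u} {b ∘ u} (mkElem λ φ t → preserves el φ (u ∘ t)) x
      y = proj₁ one
      locate : (k : Maybe K) → (∀ {κ} → k ≡ just κ → κ ∈ ks) → ∃ λ i →
        maybe′ a x k ≡ (x ◂ (a ∘ u)) i × maybe′ b y k ≡ (y ◂ (b ∘ u)) i
      locate nothing  _ = zero , refl , refl
      locate (just κ) m = suc (Any.index (m refl)) ,
        cong a (lookup-index (m refl)) , cong b (lookup-index (m refl))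
      transfer-all : ∀ ψs → (∀ {κ} → κ ∈ parameters ψs → κ ∈ ks) → All Φ ψs →
                     All (Satisfies C (maybe′ b y)) ψs
      transfer-all [] _ [] = []
      transfer-all ((n , φ , v) ∷ ψs) sub (p ∷ ps) =
        subst (C ⊨ φ [_]) (sym (fe λ i → proj₂ (proj₂ (at i))))
          (preserves (proj₂ one) φ (proj₁ ∘ at)
            (subst (C ⊨ φ [_]) (fe λ i → proj₁ (proj₂ (at i))) (truth⁻ p)))
        ∷ transfer-all ψs (sub ∘ ∈-++⁺ʳ (mapMaybe id (tabulate v))) ps
        where
        at = λ i → locate (v i) (λ eq → sub (∈-++⁺ˡ (used v i eq)))
    chosen = saturated K b Φ finite
    y = proj₁ chosen
    real = proj₂ chosen

-- The monster model

ℒ : Language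
ℒ = record { Func = Fin 0 ; funArity = λ () ; Rels = Fin 1 ; relArity = λ _ → 5 }

ℒ-finite : IsFinite ℒ
ℒ-finite = (0 , ↔-id _) , (1 , ↔-id _)

-- Exchanges the two parts of a linear order cut in two: J tells which points are in the lower
-- part of the old order, which becomes the upper part of the new one.
rotate-lt : Bool → Bool → Bool → Bool
rotate-lt true  true  l = l
rotate-lt true  false _ = false
rotate-lt false true  _ = true
rotate-lt false false l = l

-- Finite sets and ultrafilters

module FiniteTypes
  (fe : ∀ {a b} → Extensionality a b)
  where

  Finite : Set ℓ → Set ℓ
  Finite A = ∃ λ k → Σ (A → Fin k) Inj

  finite-Bool : Finite Bool
  finite-Bool = 2 , (λ { true → zero ; false → suc zero }) ,
    λ { true true _ → refl ; false false _ → refl }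

  finite-Fin : ∀ k → Finite (Fin k)
  finite-Fin k = k , id , λ _ _ → id

  finite-× : Finite A → Finite B → Finite (A × B)
  finite-× (m , f , f-inj) (n , g , g-inj) = m * n , (λ (x , y) → combine (f x) (g y)) ,
    λ (x , y) (x′ , y′) eq → let p , q = combine-injective (f x) (g y) (f x′) (g y′) eq in
      cong₂ _,_ (f-inj x x′ p) (g-inj y y′ q)

  finite-Π : ∀ n {B : Fin n → Set} → (∀ i → Finite (B i)) → Finite (∀ i → B i)
  finite-Π zero    fin = 1 , (λ _ → zero) , λ _ _ _ → fe λ ()
  finite-Π (suc n) fin =
    let k , code , code-inj = finite-× (fin zero) (finite-Π n (fin ∘ suc)) in
    k , (λ f → code (f zero , f ∘ suc)) , λ f g eq →
      let p = code-inj _ _ eq in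
      fe λ { zero → cong proj₁ p ; (suc i) → cong (λ q → proj₂ q i) p }

  finite-tuples→ : ∀ {m n} {B : Set} → Finite B → Finite (Vector (Fin n) m → B)
  finite-tuples→ {m} {n} fin =
    let k , code , code-inj = finite-Π (n ℕ.^ m) (λ _ → fin) in
    k , (λ f → code (f ∘ finToFun)) , λ f g eq → fe λ t →
      subst (λ t → f t ≡ g t) (fe (finToFun-funToFin t)) (cong (λ h → h (funToFin t)) (code-inj _ _ eq))

module Ultrafilters
  (em : ∀ {ℓ} → ExcludedMiddle ℓ)
  (fe : ∀ {a b} → Extensionality a b)
  {X : Set}
  where
  open Classical em fe
  open Ordinals em fe

  Holds : X → List (X → Bool) → Set
  Holds ξ = All λ A → A ξ ≡ true

  FIP : ((X → Bool) → Set ℓ) → Set ℓ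
  FIP 𝓐 = ∀ l → All 𝓐 l → ∃ λ ξ → Holds ξ l

  -- Transfinite recursion in place of Zorn's lemma: stage w accepts the w-th subset of X if it has
  -- the finite intersection property together with 𝓑 and the sets accepted before. Repetitions in
  -- the list of subsets do no harm.
  module Maximal (𝓑 : (X → Bool) → Set) (𝓑-FIP : FIP 𝓑) where

    abstract
      subsets : ∃ λ (g : On → Σ On λ _ → X → Bool) → ∀ β A → ∃ λ w → β ≼ w × g w ≡ (β , A)
      subsets = enumerate (λ _ → X → Bool) (ordinal (sup ⊥ λ ()) , const true)

      nth : On → X → Bool
      nth w = proj₂ (proj₁ subsets w)

      nth-sur : ∀ A → ∃ λ w → nth w ≡ A
      nth-sur A = let w , _ , eq = proj₂ subsets (ordinal (sup ⊥ λ ())) A in w , cong proj₂ eq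

    Stage-family : On → (On → Bool) → (X → Bool) → Set₁
    Stage-family w F A = (𝓑 A ⊎ ∃ λ v → v < w × F v ≡ true × nth v ≡ A) ⊎ A ≡ nth w

    Stage : On → (On → Bool) → Set₁
    Stage w F = (F w ≡ true → FIP (Stage-family w F)) × (FIP (Stage-family w F) → F w ≡ true)

    family-local : ∀ {w F G} → Below wf w F G → ∀ {A} → Stage-family w F A → Stage-family w G A
    family-local b (inj₁ (inj₁ p)) = inj₁ (inj₁ p)
    family-local b (inj₁ (inj₂ (v , v<w , p , eq))) =
      inj₁ (inj₂ (v , v<w , trans (sym (b v v<w)) p , eq))
    family-local b (inj₂ eq) = inj₂ eq

    abstract
      built : ∃ λ F → ∀ w → Stage w F
      built = build wf false Stage
        (λ w F G b eq (p , q) →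
          (λ r l mem → p (trans eq r) l (All.map (family-local {G = F} λ v u → sym (b v u)) mem)) ,
          (λ fip → trans (sym eq) (q λ l mem → fip l (All.map (family-local {F = F} b) mem))))
        (λ w F _ →
          let F′ = override wf F w (truth (FIP (Stage-family w F)))
              b  = override-below wf F w (truth (FIP (Stage-family w F)))
              at = override-at wf F w (truth (FIP (Stage-family w F)))
          in F′ , b ,
             (λ r l mem → truth⁻ (trans (sym at) r) l
               (All.map (family-local {G = F} λ v u → sym (b v u)) mem)) ,
             (λ fip → trans at (truth⁺ λ l mem → fip l (All.map (family-local {F = F} b) mem))))

    F : On → Bool
    F = proj₁ built

    𝓤 : (X → Bool) → Set₁
    𝓤 A = 𝓑 A ⊎ ∃ λ v → F v ≡ true × nth v ≡ A

    -- The latest of finitely many accepted sets was accepted in the presence of the others, so its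
    -- stage vouches for their common point.
    dominated : ∀ l → All 𝓤 l → All 𝓑 l ⊎ ∃ λ v → F v ≡ true × All (Stage-family v F) l
    dominated [] [] = inj₁ []
    dominated (A ∷ l) (p ∷ ps) with dominated l ps
    dominated (A ∷ l) (inj₁ p ∷ ps) | inj₁ qs = inj₁ (p ∷ qs)
    dominated (A ∷ l) (inj₁ p ∷ ps) | inj₂ (v , r , qs) = inj₂ (v , r , inj₁ (inj₁ p) ∷ qs)
    dominated (A ∷ l) (inj₂ (u , r , eq) ∷ ps) | inj₁ qs =
      inj₂ (u , r , inj₂ (sym eq) ∷ All.map (inj₁ ∘ inj₁) qs)
    dominated (A ∷ l) (inj₂ (u , r , eq) ∷ ps) | inj₂ (v , s , qs) with compare u v
    ... | inj₁ u<v         = inj₂ (v , s , inj₁ (inj₂ (u , u<v , r , eq)) ∷ qs)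
    ... | inj₂ (inj₁ refl) = inj₂ (v , s , inj₂ (sym eq) ∷ qs)
    ... | inj₂ (inj₂ v<u)  = inj₂ (u , r , inj₂ (sym eq) ∷ All.map raise qs)
      where
      raise : ∀ {B} → Stage-family v F B → Stage-family u F B
      raise (inj₁ (inj₁ p)) = inj₁ (inj₁ p)
      raise (inj₁ (inj₂ (x , x<v , p))) = inj₁ (inj₂ (x , <-trans x<v v<u , p))
      raise (inj₂ eq) = inj₁ (inj₂ (v , v<u , s , sym eq))

    𝓤-FIP : FIP 𝓤
    𝓤-FIP l mem with dominated l mem
    ... | inj₁ p           = 𝓑-FIP l p
    ... | inj₂ (v , r , p) = proj₁ (proj₂ built v) r l p

    forced : ∀ A → (∀ l → All 𝓤 l → ∃ λ ξ → A ξ ≡ true × Holds ξ l) → 𝓤 A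
    forced A meets = let w , eq = nth-sur A in
      inj₂ (w , proj₂ (proj₂ built w) (λ l mem → consistent eq l mem) , eq)
      where
      split : ∀ {w} → nth w ≡ A → ∀ l → All (Stage-family w F) l →
              ∃ λ m → All 𝓤 m × (∀ ξ → A ξ ≡ true → Holds ξ m → Holds ξ l)
      split eq [] [] = [] , [] , λ _ _ _ → []
      split eq (B ∷ l) (p ∷ ps) with split eq l ps
      split eq (B ∷ l) (inj₁ (inj₁ p) ∷ ps) | m , q , r =
        B ∷ m , inj₁ p ∷ q , λ { ξ s (t ∷ ts) → t ∷ r ξ s ts }
      split eq (B ∷ l) (inj₁ (inj₂ (v , _ , p)) ∷ ps) | m , q , r =
        B ∷ m , inj₂ (v , p) ∷ q , λ { ξ s (t ∷ ts) → t ∷ r ξ s ts }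
      split eq (B ∷ l) (inj₂ refl ∷ ps) | m , q , r =
        m , q , λ ξ s ts → trans (cong (λ C → C ξ) eq) s ∷ r ξ s ts
      consistent : ∀ {w} → nth w ≡ A → FIP (Stage-family w F)
      consistent eq l mem = let m , q , r = split eq l mem ; ξ , s , t = meets m q in ξ , r ξ s t

    ultra : ∀ A → 𝓤 A ⊎ 𝓤 (not ∘ A)
    ultra A with em {P = ∀ l → All 𝓤 l → ∃ λ ξ → A ξ ≡ true × Holds ξ l}
    ... | yes meets = inj₁ (forced A meets)
    ... | no ¬meets = inj₂ (forced (not ∘ A) λ l p → dne λ none → ¬meets λ m q →
            let ξ , h = 𝓤-FIP (l ++ m) (++⁺ p q) in
            ξ , value ξ (λ r → none (ξ , r , ++⁻ˡ l h)) , ++⁻ʳ l h)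
      where
      value : ∀ ξ → not (A ξ) ≢ true → A ξ ≡ true
      value ξ ne with A ξ
      ... | true  = refl
      ... | false = ⊥-elim (ne refl)

    Large : (X → Set ℓ) → Set₁
    Large Q = 𝓤 λ ξ → truth (Q ξ)

    large-from : ∀ {Q : X → Set ℓ} l → All 𝓤 l → (∀ ξ → Holds ξ l → Q ξ) → Large Q
    large-from {Q = Q} l mem f with ultra (λ ξ → truth (Q ξ))
    ... | inj₁ p = p
    ... | inj₂ p with 𝓤-FIP (_ ∷ l) (p ∷ mem)
    ...   | ξ , r ∷ h = case trans (sym r) (cong not (truth⁺ (f ξ h))) of λ ()

    large-map : ∀ {Q : X → Set ℓ} {R : X → Set ℓ′} → (∀ ξ → Q ξ → R ξ) → Large Q → Large R
    large-map f p = large-from (_ ∷ []) (p ∷ []) λ { ξ (q ∷ []) → f ξ (truth⁻ q) }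

    large-∧ : ∀ {Q : X → Set ℓ} {R : X → Set ℓ′} → Large Q → Large R → Large (λ ξ → Q ξ × R ξ)
    large-∧ p q = large-from (_ ∷ _ ∷ []) (p ∷ q ∷ []) λ { ξ (r ∷ s ∷ []) → truth⁻ r , truth⁻ s }

    large-always : ∀ {Q : X → Set ℓ} → (∀ ξ → Q ξ) → Large Q
    large-always f = large-from [] [] λ ξ _ → f ξ

    large-∃ : ∀ {Q : X → Set ℓ} → Large Q → ∃ Q
    large-∃ p with 𝓤-FIP (_ ∷ []) (p ∷ [])
    ... | ξ , q ∷ [] = ξ , truth⁻ q

    large-¬ : ∀ {Q : X → Set ℓ} → ¬ Large Q → Large (λ ξ → ¬ Q ξ)
    large-¬ {Q = Q} ¬p with ultra (λ ξ → truth (Q ξ))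
    ... | inj₁ p = ⊥-elim (¬p p)
    ... | inj₂ p = large-from (_ ∷ []) (p ∷ []) λ { ξ (r ∷ []) q →
            case trans (sym r) (cong not (truth⁺ q)) of λ () }

    large-∀ : ∀ k {Q : Fin k → X → Set ℓ} → (∀ i → Large (Q i)) → Large (λ ξ → ∀ i → Q i ξ)
    large-∀ zero    p = large-always λ _ ()
    large-∀ (suc k) p = large-map (λ { ξ (q , r) zero → q ; ξ (q , r) (suc i) → r i })
      (large-∧ (p zero) (large-∀ k (p ∘ suc)))

    limit : ∀ {k} (f : X → Fin k) → ∃ λ v → Large (λ ξ → f ξ ≡ v)
    limit {k} f = dne λ none →
      let ξ , p = large-∃ (large-∀ k λ v → large-¬ {Q = λ ξ → f ξ ≡ v} λ q → none (v , q)) in p (f ξ) refl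

    limit-Bool : (f : X → Bool) → ∃ λ v → Large (λ ξ → f ξ ≡ v)
    limit-Bool f with em {P = Large (λ ξ → f ξ ≡ true)}
    ... | yes p = true , p
    ... | no ¬p = false , large-map (λ ξ → ≢true⇒false) (large-¬ {Q = λ ξ → f ξ ≡ true} ¬p)

-- The structure `ℂ`, moving the cut, and finiteness of types

module Monster
  (em : ∀ {ℓ} → ExcludedMiddle ℓ)
  (fe : ∀ {a b} → Extensionality a b)
  where
  open Classical em fe
  open Ordinals em fe
  open Presented em fe
  open Generic em fe
  open FiniteTypes fe
  open Logic em fe {ℒ}

  ℂ : Structure ℒ (lsuc 0ℓ)
  ℂ = record
    { Carrier  = On
    ; nonempty = ordinal (sup ⊥ λ ())
    ; func     = λ ()
    ; relation = λ _ t → Lift (lsuc 0ℓ) (dd 𝕆 t ≡ true)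
    }

  if-inj : {A : Set ℓ} {B : Set} → (I → A) → B → B → B
  if-inj f x y = if truth (Inj f) then x else y

  if-inj-yes : {A : Set ℓ} {B : Set} {f : I → A} {x y : B} → Inj f → if-inj f x y ≡ x
  if-inj-yes i = cong (if_then _ else _) (truth⁺ i)

  if-inj-no : {A : Set ℓ} {B : Set} {f : I → A} {x y : B} → ¬ Inj f → if-inj f x y ≡ y
  if-inj-no ¬i = cong (if_then _ else _) (truth-false⁺ ¬i)

  if-inj-cong : {A : Set ℓ} {A′ : Set ℓ′} {B : Set} {f : I → A} {g : I → A′} {x x′ y : B} →
                (Inj f → Inj g) → (Inj g → Inj f) → (Inj f → x ≡ x′) → if-inj f x y ≡ if-inj g x′ y
  if-inj-cong {f = f} to from eq with em {P = Inj f}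
  ... | yes i = trans (if-inj-yes i) (trans (eq i) (sym (if-inj-yes (to i))))
  ... | no ¬i = trans (if-inj-no ¬i) (sym (if-inj-no (¬i ∘ from)))

  Lower : Str X → (X → Bool) → Set _
  Lower R J = ∀ x y → lt R x y ≡ true → J y ≡ true → J x ≡ true

  -- Tuples that start in the lower part J cross the cut and gain one in every cover; k adds a
  -- uniform deck transformation in each.
  rotate : Str X → (X → Bool) → (ℕ → ℕ) → Str X
  rotate R J k = record
    { lt  = λ x y → rotate-lt (J x) (J y) (lt R x y)
    ; dd  = dd R
    ; col = λ n t → if-inj t (act n (k n + bit (J (t zero))) (col R n t)) zero
    }

  rotate-IsK : {R : Str X} {J : X → Bool} → IsK R → Lower R J → ∀ k → IsK (rotate R J k)
  rotate-IsK {X = X} {R} {J} K low k = record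
    { lt-irrefl = λ x → irrefl (J x) (lt-irrefl K x)
    ; lt-trans  = λ x y z → transitive (J x) (J y) (J z) (lt-trans K x y z)
    ; lt-conn   = λ x y → connected (J x) (J y) (lt-conn K x y)
    ; col-zero  = λ n e → if-inj-no
    ; linked    = λ n e e′ w i i′ l → adjacent n e e′ i i′ (linked K n e e′ w i i′ l)
    }
    where
    irrefl : ∀ b {l} → l ≡ false → rotate-lt b b l ≡ false
    irrefl true  = id
    irrefl false = id
    transitive : ∀ a b c {l m n} → (l ≡ true → m ≡ true → n ≡ true) →
                 rotate-lt a b l ≡ true → rotate-lt b c m ≡ true → rotate-lt a c n ≡ true
    transitive true  true  true  f p q = f p q
    transitive true  true  false f p ()
    transitive true  false _     f () q
    transitive false true  true  f p q = refl
    transitive false true  false f p ()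
    transitive false false true  f p q = refl
    transitive false false false f p q = f p q
    connected : ∀ a b {l m} {P : Set ℓ} → (l ≡ false → m ≡ false → P) →
                rotate-lt a b l ≡ false → rotate-lt b a m ≡ false → P
    connected true  true  f p q = f p q
    connected true  false f p ()
    connected false true  f () q
    connected false false f p q = f p q
    -- Carrying x or y across the cut changes the crossing between them by exactly the difference of
    -- what their colours gain; therefore adjacency survives.
    balance : ∀ x y → bit (J x) + bit (rotate-lt (J x) (J y) (lt R x y)) ≡ bit (lt R x y) + bit (J y)
    balance x y with J x in p | J y in q | lt R x y in r
    ... | true  | true  | l     = ℕ.+-comm 1 (bit l)
    ... | true  | false | true  = refl
    ... | true  | false | false with lt R y x in s
    ...   | true  = case trans (sym q) (low y x s p) of λ ()
    ...   | false = case trans (sym p) (trans (cong J (lt-conn K x y r s)) q) of λ ()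
    balance x y | false | true  | true  = case trans (sym p) (low x y r q) of λ ()
    balance x y | false | true  | false = refl
    balance x y | false | false | l     = sym (ℕ.+-identityʳ (bit l))
    adjacent : ∀ n e e′ → Inj e → Inj e′ → Adjacent R n e e′ → Adjacent (rotate R J k) n e e′
    adjacent n e e′ i i′ adj = begin
      act n _ (if-inj e′ (act n (k n + bit (J x)) (col R n e′)) zero)  ≡⟨ cong (act n _) (if-inj-yes i′) ⟩
      act n l′ (act n (k n + bit (J x)) (col R n e′))   ≡⟨ act-act n l′ (k n + bit (J x)) _ ⟩
      act n (k n + bit (J x) + l′) (col R n e′)         ≡⟨ cong (λ z → act n z (col R n e′)) sums ⟩
      act n (bit (lt R x y) + (k n + bit (J y))) (col R n e′) ≡⟨ act-act n _ (bit (lt R x y)) _ ⟨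
      act n (k n + bit (J y)) (act n (bit (lt R x y)) (col R n e′)) ≡⟨ cong (act n (k n + bit (J y))) adj ⟩
      act n (k n + bit (J y)) (col R n e)               ≡⟨ if-inj-yes i ⟨
      if-inj e (act n (k n + bit (J y)) (col R n e)) zero ∎
      where
      open ≡-Reasoning
      x = e′ zero
      y = e zero
      l′ = bit (rotate-lt (J x) (J y) (lt R x y))
      sums : k n + bit (J x) + l′ ≡ bit (lt R x y) + (k n + bit (J y))
      sums = begin
        k n + bit (J x) + l′                 ≡⟨ ℕ.+-assoc (k n) _ _ ⟩
        k n + (bit (J x) + l′)               ≡⟨ cong (k n +_) (balance x y) ⟩
        k n + (bit (lt R x y) + bit (J y))   ≡⟨ ℕ.+-assoc (k n) _ _ ⟨
        k n + bit (lt R x y) + bit (J y)     ≡⟨ cong (_+ bit (J y)) (ℕ.+-comm (k n) _) ⟩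
        bit (lt R x y) + k n + bit (J y)     ≡⟨ ℕ.+-assoc (bit (lt R x y)) _ _ ⟩
        bit (lt R x y) + (k n + bit (J y))   ∎

  rotate-trivial : {R : Str X} → IsK R → rotate R (λ _ → false) (λ _ → 0) ≡ R
  rotate-trivial {R = R} K = Str-≡ (λ _ _ → refl) (λ _ → refl) λ n t → case em of λ where
    (yes i) → trans (if-inj-yes i) (act-0 n _)
    (no ¬i) → trans (if-inj-no ¬i) (sym (col-zero K n t ¬i))

  -- Equality of presented types up to moving the cut of the circle.  This relation has the
  -- back-and-forth property, and it is symmetric because the shift absorbs one full turn.
  record _≈_ {I : Set} (a b : I → On) : Set₁ where
    constructor turned
    field
      side  : On → Bool
      lower : Lower 𝕆 side
      shift : ℕ → ℕ
      same  : rotate 𝕆 side shift ↾ a ~ 𝕆 ↾ b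

  ~⇒≈ : {I : Set} {a b : I → On} → 𝕆 ↾ a ~ 𝕆 ↾ b → a ≈ b
  ~⇒≈ {a = a} eq = turned (λ _ → false) (λ _ _ _ ()) (λ _ → 0)
    (trans (cong (pull a) (rotate-trivial 𝕆-IsK)) eq)

  ≈-forth : {I : Set} {a b : I → On} → a ≈ b → ∀ x → ∃ λ y → maybe′ a x ≈ maybe′ b y
  ≈-forth {a = a} {b} (turned J low k eq) x =
    let y , eq′ = one-point (rotate-IsK 𝕆-IsK low k) a b eq x in y , turned J low k eq′

  ≈-sym : {I : Set} {a b : I → On} → a ≈ b → b ≈ a
  ≈-sym {I} {a} {b} (turned J low k eq) = turned J′ low′ k′ (Str-≡ lt-eq dd-eq col-eq)
    where
    -- The points left in place by the first rotation now form the lower part, so these are the ones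
    -- to move back around.
    J′ : On → Bool
    J′ z = truth (∃ λ i → J (a i) ≡ false × lt 𝕆 (b i) z ≡ false)
    low′ : Lower 𝕆 J′
    low′ x y x<y p = let i , q , r = truth⁻ p in
      truth⁺ (i , q , ≢true⇒false λ s → true≢false (lt-trans 𝕆-IsK _ _ _ s x<y) r)
    -- Between them the two rotations carry each point across the cut exactly once, so the shift to
    -- be undone is `k n + 1`.
    k′ : ℕ → ℕ
    k′ n = opposite n (k n + 1)
    lt-b : ∀ i j → rotate-lt (J (a i)) (J (a j)) (lt 𝕆 (a i) (a j)) ≡ lt 𝕆 (b i) (b j)
    lt-b i j = cong (λ S → lt S i j) eq
    J′b : ∀ i → J′ (b i) ≡ not (J (a i))
    J′b i with J (a i) in p
    ... | false = truth⁺ (i , p , lt-irrefl 𝕆-IsK (b i))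
    ... | true  = truth-false⁺ λ (j , q , r) →
            case trans (sym (trans (sym (lt-b j i)) (cong₂ (λ x y → rotate-lt x y _) q p))) r of λ ()
    unrotate : ∀ i j → rotate-lt (not (J (a i))) (not (J (a j)))
                 (rotate-lt (J (a i)) (J (a j)) (lt 𝕆 (a i) (a j))) ≡ lt 𝕆 (a i) (a j)
    unrotate i j with J (a i) in p | J (a j) in q | lt 𝕆 (a i) (a j) in r
    ... | true  | true  | _     = refl
    ... | true  | false | true  = refl
    ... | true  | false | false with lt 𝕆 (a j) (a i) in s
    ...   | true  = case trans (sym q) (low _ _ s p) of λ ()
    ...   | false = case trans (sym p) (trans (cong J (lt-conn 𝕆-IsK _ _ r s)) q) of λ ()
    unrotate i j | false | true  | true  = case trans (sym p) (low _ _ r q) of λ ()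
    unrotate i j | false | true  | false = refl
    unrotate i j | false | false | _     = refl
    lt-eq : ∀ i j → rotate-lt (J′ (b i)) (J′ (b j)) (lt 𝕆 (b i) (b j)) ≡ lt 𝕆 (a i) (a j)
    lt-eq i j = trans (cong₂ (λ x y → rotate-lt x y (lt 𝕆 (b i) (b j))) (J′b i) (J′b j))
      (trans (cong (rotate-lt _ _) (sym (lt-b i j))) (unrotate i j))
    dd-eq : ∀ t → dd 𝕆 (b ∘ t) ≡ dd 𝕆 (a ∘ t)
    dd-eq t = sym (cong (λ S → dd S t) eq)
    equalities : ∀ i j → a i ≡ a j → b i ≡ b j
    equalities = agree-≡ (rotate-IsK 𝕆-IsK low k) 𝕆-IsK a b eq
    equalities⁻ : ∀ i j → b i ≡ b j → a i ≡ a j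
    equalities⁻ = agree-≡ 𝕆-IsK (rotate-IsK 𝕆-IsK low k) b a (sym eq)
    col-eq : ∀ n t → if-inj (b ∘ t) (act n (k′ n + bit (J′ (b (t zero)))) (col 𝕆 n (b ∘ t))) zero
                     ≡ col 𝕆 n (a ∘ t)
    col-eq n t with em {P = Inj (a ∘ t)}
    ... | no ¬i = trans (if-inj-no λ i → ¬i λ x y p → i x y (equalities (t x) (t y) p))
                        (sym (col-zero 𝕆-IsK n (a ∘ t) ¬i))
    ... | yes i = trans (if-inj-yes λ x y p → i x y (equalities⁻ (t x) (t y) p)) (begin
        act n (k′ n + bit (J′ (b (t zero)))) (col 𝕆 n (b ∘ t))
          ≡⟨ cong₂ (λ x → act n (k′ n + bit x)) (J′b (t zero))
               (trans (sym (cong (λ S → col S n t) eq)) (if-inj-yes i)) ⟩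
        act n (k′ n + bit (not s)) (act n (k n + bit s) hue)   ≡⟨ act-act n _ (k n + bit s) hue ⟩
        act n (k n + bit s + (k′ n + bit (not s))) hue
          ≡⟨ cong (λ z → act n z hue) (sums (bit s) (bit (not s)) (one s)) ⟩
        act n (k n + 1 + k′ n) hue                             ≡⟨ act-act n (k′ n) (k n + 1) hue ⟨
        act n (k′ n) (act n (k n + 1) hue)                     ≡⟨ act-opposite n (k n + 1) hue ⟩
        hue                                                    ∎)
      where
      open ≡-Reasoning
      s = J (a (t zero))
      hue = col 𝕆 n (a ∘ t)
      one : ∀ s → bit s + bit (not s) ≡ 1
      one true  = refl
      one false = refl
      sums : ∀ x y → x + y ≡ 1 → k n + x + (k′ n + y) ≡ k n + 1 + k′ n
      sums x y x+y≡1 = begin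
        k n + x + (k′ n + y)   ≡⟨ cong (k n + x +_) (ℕ.+-comm (k′ n) y) ⟩
        k n + x + (y + k′ n)   ≡⟨ ℕ.+-assoc (k n + x) y (k′ n) ⟨
        k n + x + y + k′ n     ≡⟨ cong (_+ k′ n) (ℕ.+-assoc (k n) x y) ⟩
        k n + (x + y) + k′ n   ≡⟨ cong (λ z → k n + z + k′ n) x+y≡1 ⟩
        k n + 1 + k′ n         ∎

  ≈-reindex : {I I′ : Set} {a b : I → On} (t : I′ → I) → a ≈ b → (a ∘ t) ≈ (b ∘ t)
  ≈-reindex t (turned J low k eq) = turned J low k (cong (pull t) eq)

  ≈⇒elem : {I : Set} {a b : I → On} → a ≈ b → Elem ℂ a ℂ b
  ≈⇒elem eq = mkElem λ φ t → proj₁ (transfer φ (≈-reindex t eq))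
    where
    index : ∀ {n} → Fin (suc n) → Maybe (Fin n)
    index zero    = nothing
    index (suc i) = just i
    to-tuple : ∀ {n} {ρ σ : Vector On n} {x y} → maybe′ ρ x ≈ maybe′ σ y → (x ◂ ρ) ≈ (y ◂ σ)
    to-tuple {ρ = ρ} {σ} {x} {y} eq =
      subst₂ _≈_ (fe λ { zero → refl ; (suc _) → refl }) (fe λ { zero → refl ; (suc _) → refl })
        (≈-reindex index eq)
    forth : ∀ {n} {ρ σ : Vector On n} → ρ ≈ σ → ∀ x → ∃ λ y → (x ◂ ρ) ≈ (y ◂ σ)
    forth eq x = let y , eq′ = ≈-forth eq x in y , to-tuple eq′
    equals : ∀ {n} {ρ σ : Vector On n} → ρ ≈ σ → ∀ s t → eval ℂ ρ s ≡ eval ℂ ρ t → eval ℂ σ s ≡ eval ℂ σ t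
    equals {ρ = ρ} {σ} (turned J low k eq) (var i) (var j) =
      agree-≡ (rotate-IsK 𝕆-IsK low k) 𝕆-IsK ρ σ eq i j
    relates : ∀ {n} {ρ σ : Vector On n} → ρ ≈ σ → ∀ (ts : Vector (Term ℒ n) 5) →
              dd 𝕆 (λ i → eval ℂ ρ (ts i)) ≡ true → dd 𝕆 (λ i → eval ℂ σ (ts i)) ≡ true
    relates {n} {ρ} {σ} (turned _ _ _ eq) ts p =
      trans (cong (dd 𝕆) (variable-term σ))
        (trans (sym (cong (λ S → dd S (name ∘ ts)) eq))
          (trans (cong (dd 𝕆) (sym (variable-term ρ))) p))
      where
      name : Term ℒ n → Fin n
      name (var i) = i
      name-eval : ∀ (τ : Vector On n) s → eval ℂ τ s ≡ τ (name s)
      name-eval τ (var i) = refl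
      variable-term : ∀ (τ : Vector On n) → (λ i → eval ℂ τ (ts i)) ≡ τ ∘ name ∘ ts
      variable-term τ = fe λ i → name-eval τ (ts i)
    back : ∀ {n} {ρ σ : Vector On n} → ρ ≈ σ → ∀ y → ∃ λ x → (x ◂ ρ) ≈ (y ◂ σ)
    back eq y = let x , eq′ = forth (≈-sym eq) y in x , ≈-sym eq′
    open BackAndForth {M = ℂ} {ℂ} _≈_ forth back
      (λ eq s t → equals eq s t , equals (≈-sym eq) s t)
      (λ eq r ts → (λ (lift p) → lift (relates eq ts p)) , (λ (lift p) → lift (relates (≈-sym eq) ts p)))

  ~⇒elem : {I : Set} {a b : I → On} → 𝕆 ↾ a ~ 𝕆 ↾ b → Elem ℂ a ℂ b
  ~⇒elem = ≈⇒elem ∘ ~⇒≈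

  -- A tuple of m + 1 points taken from n ≤ m ones repeats an entry and has colour zero, so only the
  -- covers of index below n need to be recorded.
  presented-types : ∀ n → ∃ λ k → Σ (Vector On n → Fin k) λ type →
                    ∀ ρ σ → type ρ ≡ type σ → 𝕆 ↾ ρ ~ 𝕆 ↾ σ
  presented-types n = k , type , agree
    where
    coded = finite-× (finite-Π n λ _ → finite-Π n λ _ → finite-Bool)
           (finite-× (finite-tuples→ {5} {n} finite-Bool)
                     (finite-Π n λ m → finite-tuples→ {suc (toℕ m)} {n} (finite-Fin _)))
    k = proj₁ coded
    values : Vector On n → _
    values ρ = (λ i j → lt 𝕆 (ρ i) (ρ j)) , (λ t → dd 𝕆 (ρ ∘ t)) , (λ m t → col 𝕆 (toℕ {n} m) (ρ ∘ t))
    type : Vector On n → Fin k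
    type ρ = proj₁ (proj₂ coded) (values ρ)
    agree : ∀ ρ σ → type ρ ≡ type σ → 𝕆 ↾ ρ ~ 𝕆 ↾ σ
    agree ρ σ eq = Str-≡ (λ i j → cong (λ v → proj₁ v i j) same) (λ t → cong (λ v → proj₁ (proj₂ v) t) same)
      λ m t → case m ℕ.<? n of λ where
        (yes m<n) → subst (λ m → ∀ t → col 𝕆 m (ρ ∘ t) ≡ col 𝕆 m (σ ∘ t)) (toℕ-fromℕ< m<n)
          (λ t → cong (λ v → proj₂ (proj₂ v) (fromℕ< m<n) t) same) t
        (no m≮n) → trans (repeats ρ m t m≮n) (sym (repeats σ m t m≮n))
      where
      same : values ρ ≡ values σ
      same = proj₂ (proj₂ coded) _ _ eq
      repeats : ∀ τ m (t : Vector (Fin n) (suc m)) → ¬ m ℕ.< n → col 𝕆 m (τ ∘ t) ≡ zero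
      repeats τ m t m≮n = col-zero 𝕆-IsK m (τ ∘ t) λ i →
        let x , y , x<y , eq = pigeonhole (s≤s (ℕ.≮⇒≥ m≮n)) t in <⇒≢ x<y (i x y (cong τ eq))

  ℂ-types : FinitelyManyTypes ℂ
  ℂ-types n = let k , type , agree = presented-types n in
    k , type , λ ρ σ eq → ~⇒elem (agree ρ σ eq)

-- Saturation and strong homogeneity of `ℂ`

module Saturation
  (em : ∀ {ℓ} → ExcludedMiddle ℓ)
  (fe : ∀ {a b} → Extensionality a b)
  where
  open Classical em fe
  open Ordinals em fe
  open Presented em fe
  open Generic em fe
  open Logic em fe {ℒ}
  open Isomorphisms em fe {ℒ}
  open Monster em fe
  open Structure ℂ using (nonempty)

  -- Here y lists approximate realisations of a type, and the ultrafilter limit adjoins an ideal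
  -- point `nothing` to `𝕆`. As y is constant on no large set, the ideal point differs from all old
  -- ones; so distinctness, and with it each axiom, passes to the limit.
  module Limit {X : Set} (𝓑 : (X → Bool) → Set) (fip : Ultrafilters.FIP em fe 𝓑) (y : X → On)
    (escapes : ∀ o → ¬ Ultrafilters.Maximal.Large em fe 𝓑 fip (λ ξ → y ξ ≡ o)) where
    open Ultrafilters em fe
    open Maximal 𝓑 fip

    at : X → Maybe On → On
    at ξ = maybe′ id (y ξ)

    T : Str (Maybe On)
    T = record
      { lt  = λ a b → proj₁ (limit-Bool λ ξ → lt 𝕆 (at ξ a) (at ξ b))
      ; dd  = λ t → proj₁ (limit-Bool λ ξ → dd 𝕆 (at ξ ∘ t))
      ; col = λ n t → proj₁ (limit λ ξ → col 𝕆 n (at ξ ∘ t))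
      }

    lt-large : ∀ a b → Large (λ ξ → lt 𝕆 (at ξ a) (at ξ b) ≡ lt T a b)
    lt-large a b = proj₂ (limit-Bool λ ξ → lt 𝕆 (at ξ a) (at ξ b))
    dd-large : ∀ t → Large (λ ξ → dd 𝕆 (at ξ ∘ t) ≡ dd T t)
    dd-large t = proj₂ (limit-Bool λ ξ → dd 𝕆 (at ξ ∘ t))
    col-large : ∀ n t → Large (λ ξ → col 𝕆 n (at ξ ∘ t) ≡ col T n t)
    col-large n t = proj₂ (limit λ ξ → col 𝕆 n (at ξ ∘ t))

    distinct : ∀ a b → a ≢ b → Large (λ ξ → at ξ a ≢ at ξ b)
    distinct (just o) (just o′) ne = large-always λ ξ eq → ne (cong just eq)
    distinct (just o) nothing   ne = large-map (λ ξ p eq → p (sym eq)) (large-¬ (escapes o))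
    distinct nothing  (just o)  ne = large-¬ (escapes o)
    distinct nothing  nothing   ne = ⊥-elim (ne refl)

    injective : ∀ {n} (e : Vector (Maybe On) n) → Inj e → Large (λ ξ → Inj (at ξ ∘ e))
    injective {n} e i = large-∀ n λ j → large-∀ n λ k → case em of λ where
      (yes eq) → large-always λ ξ _ → eq
      (no ne)  → large-map (λ ξ p eq → ⊥-elim (p eq)) (distinct (e j) (e k) (ne ∘ i j k))

    T-IsK : IsK T
    T-IsK = record
      { lt-irrefl = λ a → let ξ , p = large-∃ (lt-large a a) in trans (sym p) (lt-irrefl 𝕆-IsK _)
      ; lt-trans  = λ a b c p q →
          let ξ , r , s , t = large-∃ (large-∧ (lt-large a b) (large-∧ (lt-large b c) (lt-large a c)))
          in trans (sym t) (lt-trans 𝕆-IsK _ _ _ (trans r p) (trans s q))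
      ; lt-conn   = λ a b p q → dne λ ne →
          let ξ , r , s , t = large-∃ (large-∧ (distinct a b ne) (large-∧ (lt-large a b) (lt-large b a)))
          in r (lt-conn 𝕆-IsK _ _ (trans s p) (trans t q))
      ; col-zero  = λ n e ¬i →
          let ξ , p = large-∃ (col-large n e) in
          trans (sym p) (col-zero 𝕆-IsK n (at ξ ∘ e) (¬i ∘ inj-∘⁻ (at ξ) e))
      ; linked    = λ n e e′ w i i′ l →
          let ξ , dds , i₁ , i₁′ , p , q , r = large-∃ (large-∧
                (large-∀ (suc n) λ j → large-∀ (suc n) λ k → dd-large (five w (e j) (e′ j) (e k) (e′ k)))
                (large-∧ (injective e i) (large-∧ (injective e′ i′)
                (large-∧ (lt-large (e′ zero) (e zero)) (large-∧ (col-large n e) (col-large n e′))))))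
          in trans (sym (cong₂ (λ b c → act n (bit b) c) p r)) (trans
               (linked 𝕆-IsK n (at ξ ∘ e) (at ξ ∘ e′) (at ξ w) i₁ i₁′ λ j k →
                 trans (sym (cong (dd 𝕆) (five-map (at ξ) w (e j) (e′ j) (e k) (e′ k))))
                       (trans (dds j k) (l j k))) q)
      }

    T-extends : pull just T ≡ 𝕆
    T-extends = Str-≡
      (λ a b → let _ , p = large-∃ (lt-large (just a) (just b)) in sym p)
      (λ t → let _ , p = large-∃ (dd-large (just ∘ t)) in sym p)
      (λ n t → let _ , p = large-∃ (col-large n (just ∘ t)) in sym p)

    -- The ideal point lies outside `𝕆`, but `one-point` copies it over the small set p. In finitely
    -- many variables the presented type is constant on a large set and equals there the type of the
    -- limit.
    realisation : ∀ {I : Set} (p : I → On) → ∃ λ x → ∀ {n} (v : Fin n → Maybe I) (Q : X → Set₁) →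
                  Large Q → ∃ λ ξ → Q ξ × 𝕆 ↾ (maybe′ p (y ξ) ∘ v) ~ 𝕆 ↾ (maybe′ p x ∘ v)
    realisation {I} p = x , λ {n} v Q large →
      let k , type , same = presented-types n
          κ , type-large = limit (λ ξ → type (maybe′ p (y ξ) ∘ v))
          large′ = large-∧ type-large large
          ξ , typeξ , q = large-∃ large′
          position = λ i → Maybe.map p (v i)
          here : ∀ ξ → at ξ ∘ position ≡ maybe′ p (y ξ) ∘ v
          here ξ = fe λ i → named (v i) ξ
          agree : ∀ ξ′ → type (maybe′ p (y ξ′) ∘ v) ≡ κ →
                  pull (at ξ ∘ position) 𝕆 ≡ pull (at ξ′ ∘ position) 𝕆
          agree ξ′ eq = subst₂ (λ a b → pull a 𝕆 ≡ pull b 𝕆) (sym (here ξ)) (sym (here ξ′))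
            (same _ _ (trans typeξ (sym eq)))
          T-values : pull (at ξ ∘ position) 𝕆 ≡ pull position T
          T-values = Str-≡
            (λ i j → let ξ′ , eq , r = large-∃ (large-∧ type-large (lt-large (position i) (position j)))
                     in trans (cong (λ S → lt S i j) (agree ξ′ eq)) r)
            (λ t → let ξ′ , eq , r = large-∃ (large-∧ type-large (dd-large (position ∘ t)))
                   in trans (cong (λ S → dd S t) (agree ξ′ eq)) r)
            (λ m t → let ξ′ , eq , r = large-∃ (large-∧ type-large (col-large m (position ∘ t)))
                     in trans (cong (λ S → col S m t) (agree ξ′ eq)) r)
      in ξ , q , trans (cong (λ f → pull f 𝕆) (sym (here ξ)))
                   (trans T-values
                     (trans (cong (λ f → pull f T) (fe λ i → pointed (v i)))
                            (cong (pull v) (proj₂ chosen))))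
      where
      chosen : ∃ λ x → T ↾ maybe′ (just ∘ p) nothing ~ 𝕆 ↾ maybe′ p x
      chosen = one-point T-IsK (just ∘ p) p (cong (pull p) T-extends) nothing
      x : On
      x = proj₁ chosen
      named : ∀ (k : Maybe I) ξ → at ξ (Maybe.map p k) ≡ maybe′ p (y ξ) k
      named (just _) ξ = refl
      named nothing  ξ = refl
      pointed : ∀ (k : Maybe I) → Maybe.map p k ≡ maybe′ (just ∘ p) nothing k
      pointed (just _) = refl
      pointed nothing  = refl

  ℂ-saturated : Saturated ℂ
  ℂ-saturated I p Φ finite = case em {P = ∃ λ o → Large (λ ξ → y ξ ≡ o)} of λ where
      (yes (o , large)) → o , λ φ Φφ →
        let ξ , q , r = large-∃ (large-∧ large (member φ Φφ)) in
        subst (λ x → Satisfies ℂ (maybe′ p x) φ) q r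
      (no escapes) →
        let x , real = Limit.realisation 𝓑 𝓑-FIP y (λ o l → escapes (o , l)) p in
        x , λ (n , ψ , v) Φφ →
          let ξ , q , eq = real v (λ ξ → Satisfies ℂ (maybe′ p (y ξ)) (n , ψ , v)) (member (n , ψ , v) Φφ)
          in preserves (~⇒elem eq) ψ id q
    where
    open Ultrafilters em fe
    F : Set
    F = FormulaOver ℒ (Maybe I)
    -- The ultrafilter lives on finite lists of formulas, each sent to a realisation if it has one.
    -- Finitely many sets of 𝓑 share the list of their own formulas.
    y : List F → On
    y φs = choose (λ x → All (Satisfies ℂ (maybe′ p x)) φs) nonempty
    𝓑 : (List F → Bool) → Set
    𝓑 A = ∃ λ φ → Φ φ × A ≡ λ ξ → truth (Satisfies ℂ (maybe′ p (y ξ)) φ)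
    formulas : ∀ l → All 𝓑 l → ∃ λ φs → All Φ φs × (∀ ξ → All (Satisfies ℂ (maybe′ p (y ξ))) φs → Holds ξ l)
    formulas [] [] = [] , [] , λ _ _ → []
    formulas (_ ∷ l) ((φ , Φφ , refl) ∷ ps) =
      let φs , qs , r = formulas l ps in
      φ ∷ φs , Φφ ∷ qs , λ { ξ (s ∷ ss) → truth⁺ s ∷ r ξ ss }
    𝓑-FIP : FIP 𝓑
    𝓑-FIP l ps = let φs , qs , r = formulas l ps in
      φs , r φs (choose-spec {P = λ x → All (Satisfies ℂ (maybe′ p x)) φs} nonempty (finite φs qs))
    open Maximal 𝓑 𝓑-FIP
    member : ∀ φ → Φ φ → Large (λ ξ → Satisfies ℂ (maybe′ p (y ξ)) φ)
    member φ Φφ = inj₁ (φ , Φφ , refl)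

  ℂ-extends : ∀ K → Extends ℂ ℂ K
  ℂ-extends = saturated-extends ℂ ℂ-types ℂ-saturated

  automorphism : ∀ {I : Set} {a b : I → On} → Elem ℂ a ℂ b → Σ (Aut ℂ) λ σ → ∀ i → _≅_.to σ (a i) ≡ b i
  automorphism {a = a} {b} el = Along.isomorphism On-order {M = ℂ} {ℂ} id (λ x → x , refl) id (λ x → x , refl)
    a b el (λ w → ℂ-extends _) (λ w → ℂ-extends _)

  ℂ-homogeneous : StronglyHomogeneous ℂ
  ℂ-homogeneous I a b same = automorphism (mkElem λ {n} φ t → Equivalence.to (same (n , φ , t)))

  private
    infinite : ∀ {k} (f : Fin k → On) → ∃ λ x → ∀ i → f i ≢ x
    infinite f = let x , above = strict-bound f in x , λ i eq → <-irrefl (subst (_< x) eq (above i))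

  open Countably ℂ ℂ-types (λ ()) infinite public using (N; N-types; N-countable; elementary)

  N-categorical : CountablyCategorical N
  N-categorical = categorical N N-countable N-types

  ℂ-monster : IsMonster (Th N) ℂ
  ℂ-monster = record
    { isModel             = λ φ p → subst (ℂ ⊨ φ [_]) (fe λ ()) (proj₁ (elementary φ _) p)
    ; saturated           = ℂ-saturated
    ; stronglyHomogeneous = ℂ-homogeneous
    }

-- Lascar and Kim–Pillay equivalence

-- In a strongly homogeneous structure an invariant relation is determined by the set of complete
-- types of the pairs in it, and such sets form a type in Set; so the intersection of all bounded
-- invariant equivalence relations is one of a small family, and is again bounded.
module FinestRelations
  (em : ∀ {ℓ} → ExcludedMiddle ℓ)
  (fe : ∀ {a b} → Extensionality a b)
  {L : Language} (C : Structure L (lsuc 0ℓ)) (homogeneous : StronglyHomogeneous C) (δ : TupleLength)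
  where
  open Classical em fe
  open Logic em fe {L}
  open Structure C using (Carrier; nonempty)
  private module Eq = IsEquivalence

  private
    𝕋 : Set₁
    𝕋 = Tuple C δ

  Pairs : Set
  Pairs = Index δ ⊎ Index δ

  Code : Set
  Code = (FormulaOver L Pairs → Bool) → Bool

  type : 𝕋 → 𝕋 → FormulaOver L Pairs → Bool
  type a b φ = truth (Satisfies C [ a , b ]′ φ)

  coded : Code → TupleRel C δ
  coded P a b = Lift (lsuc 0ℓ) (P (type a b) ≡ true)

  code : TupleRel C δ → Code
  code E p = truth (∃ λ a → ∃ λ b → type a b ≡ p × E a b)

  coded⁺ : ∀ {E a b} → E a b → coded (code E) a b
  coded⁺ e = lift (truth⁺ (_ , _ , refl , e))

  coded⁻ : ∀ {E} → Invariant C δ E → ∀ {a b} → coded (code E) a b → E a b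
  coded⁻ {E} inv {a} {b} (lift p) =
    let a′ , b′ , eq , e = truth⁻ p
        σ , moves = homogeneous Pairs [ a′ , b′ ]′ [ a , b ]′ λ φ →
          mk⇔ (λ s → truth⁻ (trans (sym (cong (λ t → t φ) eq)) (truth⁺ s)))
              (λ s → truth⁻ (trans (cong (λ t → t φ) eq) (truth⁺ s)))
    in subst₂ E (fe (moves ∘ inj₁)) (fe (moves ∘ inj₂)) (inv σ a′ b′ e)

  module _ {E E′ : TupleRel C δ} (to : ∀ {a b} → E a b → E′ a b) (from : ∀ {a b} → E′ a b → E a b) where

    transfer-equivalence : IsEquivalence E → IsEquivalence E′
    transfer-equivalence eq = record
      { refl  = to (Eq.refl eq)
      ; sym   = to ∘ Eq.sym eq ∘ from
      ; trans = λ p q → to (Eq.trans eq (from p) (from q))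
      }

    transfer-bounded : Bounded C δ E → Bounded C δ E′
    transfer-bounded (I , r , covers) = I , r , λ a → let i , e = covers a in i , to e

    transfer-invariant : Invariant C δ E → Invariant C δ E′
    transfer-invariant inv σ a b = to ∘ inv σ a b ∘ from

    transfer-definable : TypeDefinable C δ E → TypeDefinable C δ E′
    transfer-definable (Φ , def) = Φ , λ a b →
      mk⇔ (Equivalence.to (def a b) ∘ from) (to ∘ Equivalence.from (def a b))

  definable⇒invariant : ∀ {E} → TypeDefinable C δ E → Invariant C δ E
  definable⇒invariant (Φ , def) σ a b e = Equivalence.from (def _ _) λ (n , φ , v) Φφ →
    subst (C ⊨ φ [_]) (fe λ i → sides (v i))
      (preserves (iso-elem σ) φ ([ a , b ]′ ∘ v) (Equivalence.to (def a b) e (n , φ , v) Φφ))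
    where
    sides : ∀ i → _≅_.to σ ([ a , b ]′ i) ≡ [ _≅_.to σ ∘ a , _≅_.to σ ∘ b ]′ i
    sides (inj₁ _) = refl
    sides (inj₂ _) = refl

  definable⇒bounded-invariant : ∀ {E} → BoundedTypeDefinableEq C δ E → BoundedInvariantEq C δ E
  definable⇒bounded-invariant (eq , bounded , def) = eq , bounded , definable⇒invariant def

  meet : (TupleRel C δ → Set₁) → TupleRel C δ
  meet 𝒫 a b = ∀ P → 𝒫 (coded P) → coded P a b

  meet-equivalence : ∀ {𝒫} → (∀ {E} → 𝒫 E → IsEquivalence E) → IsEquivalence (meet 𝒫)
  meet-equivalence eq = record
    { refl  = λ P p → Eq.refl (eq p)
    ; sym   = λ e P p → Eq.sym (eq p) (e P p)
    ; trans = λ e f P p → Eq.trans (eq p) (e P p) (f P p)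
    }

  Lascar KimPillay : TupleRel C δ
  Lascar    = meet (BoundedInvariantEq C δ)
  KimPillay = meet (BoundedTypeDefinableEq C δ)

  -- Record for a tuple which representatives it is related to, under all codes at once; as codes
  -- form a small type, so do the records. Two tuples with the same record share a representative
  -- under every bounded code.
  Lascar-bounded : Bounded C δ Lascar
  Lascar-bounded = ((P : Code) → proj₁ (bound P) → Bool) , representative , λ a →
      colour a , λ P p →
        let i , e = proj₂ (proj₂ (bound P)) p a
            same  = choose-spec {P = λ b → colour b ≡ colour a} default (a , refl)
            f     = truth⁻ {P = coded P (representative (colour a)) (proj₁ (proj₂ (bound P)) i)}
                      (trans (cong (λ c → c P i) same) (truth⁺ e))
        in Eq.trans (proj₁ p) e (Eq.sym (proj₁ p) f)
    where
    bound : ∀ P → Σ Set λ I → Σ (I → 𝕋) λ r →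
      BoundedInvariantEq C δ (coded P) → ∀ a → ∃ λ i → coded P a (r i)
    bound P with em {P = BoundedInvariantEq C δ (coded P)}
    ... | yes (_ , (I , r , covers) , _) = I , r , λ _ → covers
    ... | no ¬p = ⊥ , ⊥-elim , λ p → ⊥-elim (¬p p)
    colour : 𝕋 → (P : Code) → proj₁ (bound P) → Bool
    colour a P i = truth (coded P a (proj₁ (proj₂ (bound P)) i))
    default : 𝕋
    default _ = nonempty
    representative : ((P : Code) → proj₁ (bound P) → Bool) → 𝕋
    representative c = choose (λ b → colour b ≡ c) default

  Lascar-finest : IsE-L C δ Lascar
  Lascar-finest =
    ( meet-equivalence {BoundedInvariantEq C δ} proj₁
    , Lascar-bounded
    , λ σ a b e P p → proj₂ (proj₂ p) σ a b (e P p) ) ,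
    λ E (eq , bounded , inv) e → coded⁻ inv (e (code E)
      ( transfer-equivalence {E} coded⁺ (coded⁻ inv) eq
      , transfer-bounded {E} coded⁺ (coded⁻ inv) bounded
      , transfer-invariant {E} coded⁺ (coded⁻ inv) inv))

  KimPillay-definable : TypeDefinable C δ KimPillay
  KimPillay-definable = Φ , λ a b → mk⇔
      (λ e φ (P , p , Φφ) → Equivalence.to (proj₂ (definition P) (truth⁻ p) a b) (e P (truth⁻ p)) φ Φφ)
      (λ real P p → Equivalence.from (proj₂ (definition P) p a b) λ φ Φφ → real φ (P , truth⁺ p , Φφ))
    where
    definition : ∀ P → Σ (PartialType L Pairs) λ Ψ → BoundedTypeDefinableEq C δ (coded P) →
      ∀ a b → coded P a b ⇔ Realises C [ a , b ]′ Ψ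
    definition P with em {P = BoundedTypeDefinableEq C δ (coded P)}
    ... | yes (_ , _ , Ψ , def) = Ψ , λ _ → def
    ... | no ¬p = (λ _ → ⊥) , λ p → ⊥-elim (¬p p)
    Φ : PartialType L Pairs
    Φ φ = ∃ λ P → truth (BoundedTypeDefinableEq C δ (coded P)) ≡ true × proj₁ (definition P) φ

  KimPillay-finest : IsE-KP C δ KimPillay
  KimPillay-finest =
    ( meet-equivalence {BoundedTypeDefinableEq C δ} proj₁
    , (let I , r , covers = Lascar-bounded in I , r , λ a →
         let i , e = covers a in i , λ P p → e P (definable⇒bounded-invariant p))
    , KimPillay-definable) ,
    λ E (eq , bounded , def) e → let inv = definable⇒invariant def in coded⁻ inv (e (code E)
      ( transfer-equivalence {E} coded⁺ (coded⁻ inv) eq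
      , transfer-bounded {E} coded⁺ (coded⁻ inv) bounded
      , transfer-definable {E} coded⁺ (coded⁻ inv) def))

-- The failure of G-compactness

record IsStrictLinear {ℓ} {V : Set ℓ} (l : V → V → Bool) : Set ℓ where
  field
    irreflexive : ∀ x → l x x ≡ false
    transitive  : ∀ x y z → l x y ≡ true → l y z ≡ true → l x z ≡ true
    connected   : ∀ x y → l x y ≡ false → l y x ≡ false → x ≡ y
open IsStrictLinear

lex : ∀ {a b} {A : Set a} {B : Set b} → (A → A → Bool) → (B → B → Bool) → A ⊎ B → A ⊎ B → Bool
lex l m (inj₁ x) (inj₁ y) = l x y
lex l m (inj₁ x) (inj₂ y) = true
lex l m (inj₂ x) (inj₁ y) = false
lex l m (inj₂ x) (inj₂ y) = m x y

lex-linear : ∀ {a b} {A : Set a} {B : Set b} {l : A → A → Bool} {m : B → B → Bool} →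
             IsStrictLinear l → IsStrictLinear m → IsStrictLinear (lex l m)
lex-linear L M = record
  { irreflexive = λ { (inj₁ x) → irreflexive L x ; (inj₂ y) → irreflexive M y }
  ; transitive  = λ where
      (inj₁ x) (inj₁ y) (inj₁ z) p q → transitive L x y z p q
      (inj₁ x) (inj₁ y) (inj₂ z) p q → refl
      (inj₁ x) (inj₂ y) (inj₂ z) p q → refl
      (inj₂ x) (inj₂ y) (inj₂ z) p q → transitive M x y z p q
  ; connected   = λ where
      (inj₁ x) (inj₁ y) p q → cong inj₁ (connected L x y p q)
      (inj₂ x) (inj₂ y) p q → cong inj₂ (connected M x y p q)
  }

IsK⇒linear : ∀ {ℓ} {X : Set ℓ} {R : Str X} → IsK R → IsStrictLinear (lt R)
IsK⇒linear K = record { irreflexive = lt-irrefl K ; transitive = lt-trans K ; connected = lt-conn K }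

-- Sequences with prescribed colours

module Configurations
  (em : ∀ {ℓ} → ExcludedMiddle ℓ)
  (fe : ∀ {a b} → Extensionality a b)
  where
  open Classical em fe
  open Ordinals em fe
  open Presented em fe
  open Generic em fe
  open Monster em fe

  ℕ-lt : ℕ → ℕ → Bool
  ℕ-lt m n = truth (m ℕ.< n)

  ℕ-lt-linear : IsStrictLinear ℕ-lt
  ℕ-lt-linear = record
    { irreflexive = λ n → truth-false⁺ (ℕ.<-irrefl refl)
    ; transitive  = λ x y z p q → truth⁺ (ℕ.<-trans (truth⁻ p) (truth⁻ q))
    ; connected   = λ x y p q → case ℕ.<-cmp x y of λ where
        (tri< r _ _) → ⊥-elim (true≢false (truth⁺ r) p)
        (tri≈ _ r _) → r
        (tri> _ _ r) → ⊥-elim (true≢false (truth⁺ r) q)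
    }

  -- Without links any colouring is admissible. Colours depend on the first entry alone, as does the
  -- shift in `rotate`, so moving the cut preserves this form.
  potential : (V → V → Bool) → (V → ℕ → ℕ) → Str V
  potential l κ = record
    { lt  = l
    ; dd  = λ _ → false
    ; col = λ n t → if-inj t (act n (κ (t zero) n) zero) zero
    }

  potential-IsK : {l : V → V → Bool} → IsStrictLinear l → ∀ κ → IsK (potential l κ)
  potential-IsK L κ = record
    { lt-irrefl = irreflexive L
    ; lt-trans  = transitive L
    ; lt-conn   = connected L
    ; col-zero  = λ n e → if-inj-no
    ; linked    = λ n e e′ w i i′ l → case l zero zero of λ ()
    }

  constant : (ℕ → ℕ) → Str ℕ
  constant k = potential ℕ-lt (λ _ → k)

  constant-IsK : ∀ k → IsK (constant k)
  constant-IsK k = potential-IsK ℕ-lt-linear (λ _ → k)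

  ω+ω : ℕ ⊎ ℕ → ℕ ⊎ ℕ → Bool
  ω+ω = lex ℕ-lt ℕ-lt

  sides : (ℕ → ℕ) → (ℕ → ℕ) → ℕ ⊎ ℕ → ℕ → ℕ
  sides k l (inj₁ _) = k
  sides k l (inj₂ _) = l

  two : (ℕ → ℕ) → (ℕ → ℕ) → Str (ℕ ⊎ ℕ)
  two k l = potential ω+ω (sides k l)

  two-IsK : ∀ k l → IsK (two k l)
  two-IsK k l = potential-IsK (lex-linear ℕ-lt-linear ℕ-lt-linear) (sides k l)

  two-left : ∀ k l → pull inj₁ (two k l) ≡ constant k
  two-left k l = Str-≡ (λ _ _ → refl) (λ _ → refl) λ n t →
    if-inj-cong (inj-∘⁻ inj₁ t) (inj-∘ (λ _ _ → inj₁-injective)) (λ _ → refl)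

  two-right : ∀ k l → pull inj₂ (two k l) ≡ constant l
  two-right k l = Str-≡ (λ _ _ → refl) (λ _ → refl) λ n t →
    if-inj-cong (inj-∘⁻ inj₂ t) (inj-∘ (λ _ _ → inj₂-injective)) (λ _ → refl)

  -- In the absence of mixed links the colour `mix` of mixed injective tuples is free and can be
  -- chosen to suit each application.
  module Sum {X : Set ℓ} {Y : Set ℓ′} {R : Str X} {S : Str Y} (KR : IsK R) (KS : IsK S)
             (mix : ∀ n → Colour n) where

    Left Right : ∀ {n} → Vector (X ⊎ Y) n → Set _
    Left {n} t  = Σ (Vector X n) λ u → t ≡ inj₁ ∘ u
    Right {n} t = Σ (Vector Y n) λ u → t ≡ inj₂ ∘ u

    Related : Vector (X ⊎ Y) 5 → Set _
    Related t = (∃ λ u → t ≡ inj₁ ∘ u × dd R u ≡ true) ⊎ (∃ λ u → t ≡ inj₂ ∘ u × dd S u ≡ true)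

    colour : ∀ n → Vector (X ⊎ Y) (suc n) → Colour n
    colour n t with em {P = Left t} | em {P = Right t}
    ... | yes (u , _) | _           = col R n u
    ... | no _        | yes (u , _) = col S n u
    ... | no _        | no _        = if-inj t (mix n) zero

    sum : Str (X ⊎ Y)
    sum = record { lt = lex (lt R) (lt S) ; dd = λ t → truth (Related t) ; col = colour }

    left-injective : (s t : I → X) → inj₁ {B = Y} ∘ s ≡ inj₁ ∘ t → s ≡ t
    left-injective _ _ eq = fe λ i → inj₁-injective (cong (λ f → f i) eq)

    right-injective : (s t : I → Y) → inj₂ {A = X} ∘ s ≡ inj₂ ∘ t → s ≡ t
    right-injective _ _ eq = fe λ i → inj₂-injective (cong (λ f → f i) eq)

    apart : ∀ {n} {u : Vector X (suc n)} {v : Vector Y (suc n)} → inj₁ ∘ u ≢ inj₂ ∘ v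
    apart eq = case cong (λ f → f zero) eq of λ ()

    colour-left : ∀ n u → colour n (inj₁ ∘ u) ≡ col R n u
    colour-left n u with em {P = Left (inj₁ ∘ u)} | em {P = Right (inj₁ ∘ u)}
    ... | yes (v , eq) | _ = cong (col R n) (sym (left-injective u v eq))
    ... | no none      | _ = ⊥-elim (none (u , refl))

    colour-right : ∀ n u → colour n (inj₂ ∘ u) ≡ col S n u
    colour-right n u with em {P = Left (inj₂ ∘ u)} | em {P = Right (inj₂ ∘ u)}
    ... | yes (v , eq) | _            = ⊥-elim (apart (sym eq))
    ... | no _         | yes (v , eq) = cong (col S n) (sym (right-injective u v eq))
    ... | no _         | no none      = ⊥-elim (none (u , refl))

    colour-mixed : ∀ n t → ¬ Left t → ¬ Right t → colour n t ≡ if-inj t (mix n) zero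
    colour-mixed n t ¬l ¬r with em {P = Left t} | em {P = Right t}
    ... | yes l | _     = ⊥-elim (¬l l)
    ... | no _  | yes r = ⊥-elim (¬r r)
    ... | no _  | no _  = refl

    sum-left : pull inj₁ sum ≡ R
    sum-left = Str-≡ (λ _ _ → refl)
      (λ t → bool-≡ (from t ∘ truth⁻) λ p → truth⁺ (inj₁ (t , refl , p))) colour-left
      where
      from : ∀ t → Related (inj₁ ∘ t) → dd R t ≡ true
      from t (inj₁ (u , eq , p)) = trans (cong (dd R) (left-injective t u eq)) p
      from t (inj₂ (u , eq , p)) = ⊥-elim (apart eq)

    sum-right : pull inj₂ sum ≡ S
    sum-right = Str-≡ (λ _ _ → refl)
      (λ t → bool-≡ (from t ∘ truth⁻) λ p → truth⁺ (inj₂ (t , refl , p))) colour-right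
      where
      from : ∀ t → Related (inj₂ ∘ t) → dd S t ≡ true
      from t (inj₁ (u , eq , p)) = ⊥-elim (apart (sym eq))
      from t (inj₂ (u , eq , p)) = trans (cong (dd S) (right-injective t u eq)) p

    sum-IsK : IsK sum
    sum-IsK = record
      { lt-irrefl = irreflexive linear
      ; lt-trans  = transitive linear
      ; lt-conn   = connected linear
      ; col-zero  = zero⁺
      ; linked    = λ n e e′ w i i′ l → linked⁺ w refl n e e′ i i′ l
      }
      where
      linear = lex-linear (IsK⇒linear KR) (IsK⇒linear KS)
      zero⁺ : ∀ n e → ¬ Inj e → colour n e ≡ zero
      zero⁺ n e ¬i with em {P = Left e} | em {P = Right e}
      ... | yes (u , refl) | _              = col-zero KR n u (¬i ∘ inj-∘ λ _ _ → inj₁-injective)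
      ... | no _           | yes (u , refl) = col-zero KS n u (¬i ∘ inj-∘ λ _ _ → inj₂-injective)
      ... | no _           | no _           = if-inj-no ¬i
      third fourth : Fin 5
      third  = suc (suc (suc zero))
      fourth = suc (suc (suc (suc zero)))
      -- A related quintuple lies on one side and starts with w, so the side of w decides that of
      -- both tuples.
      linked⁺ : ∀ w {w′} → w ≡ w′ → ∀ n e e′ → Inj e → Inj e′ → Linked sum w′ e e′ → Adjacent sum n e e′
      linked⁺ (inj₁ w) refl n e e′ i i′ l = linked-along sum inj₁ KR sum-left n {w₁ = w}
          {λ j → proj₁ (side j) third} {λ j → proj₁ (side j) fourth}
          refl (fe λ j → cong (λ f → f third) (proj₂ (side j)))
          (fe λ j → cong (λ f → f fourth) (proj₂ (side j))) i i′ l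
        where
        side : ∀ j → Left (five (inj₁ w) (e zero) (e′ zero) (e j) (e′ j))
        side j with truth⁻ {P = Related (five (inj₁ w) (e zero) (e′ zero) (e j) (e′ j))} (l zero j)
        ... | inj₁ (u , eq , _) = u , eq
        ... | inj₂ (u , eq , _) = case cong (λ f → f zero) eq of λ ()
      linked⁺ (inj₂ w) refl n e e′ i i′ l = linked-along sum inj₂ KS sum-right n {w₁ = w}
          {λ j → proj₁ (side j) third} {λ j → proj₁ (side j) fourth}
          refl (fe λ j → cong (λ f → f third) (proj₂ (side j)))
          (fe λ j → cong (λ f → f fourth) (proj₂ (side j))) i i′ l
        where
        side : ∀ j → Right (five (inj₂ w) (e zero) (e′ zero) (e j) (e′ j))
        side j with truth⁻ {P = Related (five (inj₂ w) (e zero) (e′ zero) (e j) (e′ j))} (l zero j)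
        ... | inj₁ (u , eq , _) = case cong (λ f → f zero) eq of λ ()
        ... | inj₂ (u , eq , _) = u , eq

  ~-local : {R S : Str I} → (∀ n (t : Vector I n) → pull t R ≡ pull t S) → R ≡ S
  ~-local h = Str-≡ (λ x y → cong (λ P → lt P zero (suc zero)) (h 2 (x ◂ y ◂ ⟨⟩)))
    (λ t → cong (λ P → dd P id) (h 5 t)) (λ n t → cong (λ P → col P n id) (h (suc n) t))

  -- The sequence is copied point by point. A structure is determined by its finite tuples, and each
  -- of these is complete at a finite stage.
  copy : {R : Str X} → IsK R → {I : Set} (a : I → X) (b : I → On) → R ↾ a ~ 𝕆 ↾ b →
         (c : ℕ → X) → ∃ λ d → R ↾ [ a , c ]′ ~ 𝕆 ↾ [ b , d ]′
  copy {X = X} {R} K {I} a b base c = d₀ , ~-local λ n t →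
      let w , t′ , factors = bounded t in
      trans (cong (λ f → pull f R) (fe λ i → factor a c w (t′ i) (factors i)))
        (trans (cong (pull t′) (proj₂ built w))
          (cong (λ f → pull f 𝕆) (fe λ i → sym (factor b d₀ w (t′ i) (factors i)))))
    where
    module W = SmallWellOrder ℕ-order
    upto : {A : Set ℓ} → (I → A) → (ℕ → A) → ∀ w → I ⊎ Fin w → A
    upto f g w = [ f , g ∘ toℕ ]′
    Copied : ℕ → (ℕ → On) → Set
    Copied w d = R ↾ upto a c (suc w) ~ 𝕆 ↾ upto b d (suc w)
    upto-≗ : ∀ {d d′ : ℕ → On} w → (∀ v → v ℕ.< w → d v ≡ d′ v) → upto b d w ≡ upto b d′ w
    upto-≗ w eq = fe λ { (inj₁ _) → refl ; (inj₂ i) → eq _ (toℕ<n i) }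
    local : Local W.wf Copied
    local w d d′ below eq stage = trans stage (cong (λ f → pull f 𝕆) (upto-≗ (suc w) agree))
      where
      agree : ∀ v → v ℕ.< suc w → d v ≡ d′ v
      agree v (s≤s v≤w) with ℕ.m≤n⇒m<n∨m≡n v≤w
      ... | inj₁ v<w  = below v v<w
      ... | inj₂ refl = eq
    before : ∀ w d → (∀ v → v ℕ.< w → Copied v d) → R ↾ upto a c w ~ 𝕆 ↾ upto b d w
    before zero d _ = trans (cong (λ f → pull f R) (fe λ { (inj₁ _) → refl }))
      (trans (cong (pull {Y = I ⊎ Fin 0} [ id , (λ ()) ]′) base)
        (cong (λ f → pull f 𝕆) (fe λ { (inj₁ _) → refl })))
    before (suc w) d ih = ih w ℕ.≤-refl
    last : ∀ w → I ⊎ Fin (suc w) → Maybe (I ⊎ Fin w)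
    last w (inj₁ i) = just (inj₁ i)
    last w (inj₂ j) with toℕ j ℕ.<? w
    ... | yes p = just (inj₂ (fromℕ< p))
    ... | no _  = nothing
    last-≗ : {A : Set ℓ} (f : I → A) (g : ℕ → A) → ∀ w k →
             upto f g (suc w) k ≡ maybe′ (upto f g w) (g w) (last w k)
    last-≗ f g w (inj₁ i) = refl
    last-≗ f g w (inj₂ j) with toℕ j ℕ.<? w
    ... | yes p = cong g (sym (toℕ-fromℕ< p))
    ... | no ¬p = cong g (ℕ.≤-antisym (ℕ.s≤s⁻¹ (toℕ<n j)) (ℕ.≮⇒≥ ¬p))
    step : ∀ w d → (∀ v → v ℕ.< w → Copied v d) → ∃ λ d′ → Below W.wf w d d′ × Copied w d′
    step w d ih =
      let y , eq = one-point K (upto a c w) (upto b d w) (before w d ih) (c w)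
          d′ = override W.wf d w y
          below = override-below W.wf d w y
      in d′ , below ,
         trans (cong (λ f → pull f R) (fe (last-≗ a c w)))
           (trans (cong (pull (last w)) eq)
             (cong (λ f → pull f 𝕆) (trans
               (cong₂ (λ f z → maybe′ f z ∘ last w) (upto-≗ w below) (sym (override-at W.wf d w y)))
               (sym (fe (last-≗ b d′ w))))))
    built : ∃ λ d → ∀ w → Copied w d
    built = build W.wf (ordinal (sup ⊥ λ ())) Copied local step
    d₀ : ℕ → On
    d₀ = proj₁ built
    Factor : ∀ w → I ⊎ ℕ → I ⊎ Fin (suc w) → Set
    Factor w k k′ = k ≡ [ inj₁ , inj₂ ∘ toℕ ]′ k′
    factor : {A : Set ℓ} (f : I → A) (g : ℕ → A) → ∀ w {k} k′ →
             Factor w k k′ → [ f , g ]′ k ≡ upto f g (suc w) k′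
    factor f g w (inj₁ _) refl = refl
    factor f g w (inj₂ _) refl = refl
    height : I ⊎ ℕ → ℕ
    height (inj₁ _) = 0
    height (inj₂ n) = n
    locate : ∀ w k → height k ≤ w → ∃ (Factor w k)
    locate w (inj₁ i) _ = inj₁ i , refl
    locate w (inj₂ n) p = inj₂ (fromℕ< (s≤s p)) , cong inj₂ (sym (toℕ-fromℕ< (s≤s p)))
    tallest : ∀ {n} (t : Vector (I ⊎ ℕ) n) → ∃ λ w → ∀ i → height (t i) ≤ w
    tallest {zero}  t = 0 , λ ()
    tallest {suc n} t = let w , p = tallest (t ∘ suc) in
      height (t zero) ℕ.⊔ w , λ { zero → ℕ.m≤m⊔n _ w ; (suc i) → ℕ.≤-trans (p i) (ℕ.m≤n⊔m _ w) }
    bounded : ∀ {n} (t : Vector (I ⊎ ℕ) n) → ∃ λ w → Σ (Vector (I ⊎ Fin (suc w)) n) λ t′ →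
              ∀ i → Factor w (t i) (t′ i)
    bounded t = let w , p = tallest t in
      w , (λ i → proj₁ (locate w (t i) (p i))) , λ i → proj₂ (locate w (t i) (p i))

-- Arithmetic of -1/2 in the covers

-- Each step adds 3ⁿ = 1 + 2 · half n, which by the induction hypothesis is 1 + 2j times 3ᵐ.
half-coherent : ∀ {m n} → m ≤ n → ∃ λ j → half n ≡ half m + j * suc (half m + half m)
half-coherent {m} m≤n = go (ℕ.≤⇒≤′ m≤n)
  where
  open ≡-Reasoning
  p = suc (half m + half m)
  go : ∀ {n} → m ℕ.≤′ n → ∃ λ j → half n ≡ half m + j * p
  go ℕ.≤′-refl = 0 , sym (ℕ.+-identityʳ _)
  go {suc n} (ℕ.≤′-step m≤n) = let j , eq = go m≤n in j + (1 + (j + j)) , (begin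
    half n + suc (half n + half n)                   ≡⟨ cong (λ h → h + suc (h + h)) eq ⟩
    (h + j * p) + suc ((h + j * p) + (h + j * p))    ≡⟨ ℕ.+-assoc h (j * p) _ ⟩
    h + (j * p + suc ((h + j * p) + (h + j * p)))    ≡⟨ cong (λ x → h + (j * p + suc x)) (shuffle h (j * p)) ⟩
    h + (j * p + (p + (j * p + j * p)))              ≡⟨ cong (λ x → h + (j * p + (p + x))) (ℕ.*-distribʳ-+ p j j) ⟨
    h + (j * p + (1 + (j + j)) * p)                  ≡⟨ cong (h +_) (ℕ.*-distribʳ-+ p j (1 + (j + j))) ⟨
    h + (j + (1 + (j + j))) * p                      ∎)
    where
    h = half m
    shuffle : ∀ a b → (a + b) + (a + b) ≡ (a + a) + (b + b)
    shuffle a b = begin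
      (a + b) + (a + b)   ≡⟨ ℕ.+-assoc a b (a + b) ⟩
      a + (b + (a + b))   ≡⟨ cong (a +_) (ℕ.+-assoc b a b) ⟨
      a + (b + a + b)     ≡⟨ cong (λ x → a + (x + b)) (ℕ.+-comm b a) ⟩
      a + (a + b + b)     ≡⟨ cong (a +_) (ℕ.+-assoc a b b) ⟩
      a + (a + (b + b))   ≡⟨ ℕ.+-assoc a a (b + b) ⟨
      (a + a) + (b + b)   ∎

n≤half : ∀ n → n ≤ half n
n≤half zero    = z≤n
n≤half (suc n) = ℕ.≤-trans (s≤s (n≤half n))
  (ℕ.≤-trans (s≤s (ℕ.m≤m+n (half n) (half n))) (ℕ.m≤n+m (suc (half n + half n)) (half n)))

-- Cyclic distance at most k; steps on both sides avoid subtraction and make the notion symmetric.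
Close : ∀ n → ℕ → Colour n → Colour n → Set
Close n k c d = ∃ λ i → ∃ λ j → i ≤ k × j ≤ k × act n i c ≡ act n j d

half-far : ∀ k → ¬ Close (suc k) k zero (act (suc k) (half (suc k)) zero)
half-far k (i , j , i≤k , j≤k , eq) = ℕ.<-irrefl refl (ℕ.≤-trans (n≤half (suc k))
    (ℕ.≤-trans (ℕ.m≤m+n h j) (ℕ.≤-trans (ℕ.≤-reflexive (sym i≡h+j)) i≤k)))
  where
  h = half (suc k)
  -- In the cover of index `suc k` nothing wraps around, as k stays below h. Hence the equation of
  -- colours is one of numbers, i = h + j, which is too large for i ≤ k.
  small : ∀ {l} → l ≤ k → h + l ℕ.< suc (h + h)
  small l≤k = s≤s (ℕ.+-monoʳ-≤ h (ℕ.≤-trans l≤k (ℕ.≤-trans (ℕ.n≤1+n k) (n≤half (suc k)))))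
  value : ∀ l → l ℕ.< suc (h + h) → toℕ (act (suc k) l zero) ≡ l
  value l p = trans (toℕ-act (suc k) l zero) (m<n⇒m%n≡m p)
  i≡h+j : i ≡ h + j
  i≡h+j = trans (sym (value i (ℕ.≤-<-trans (ℕ.m≤n+m i h) (small i≤k))))
    (trans (cong toℕ (trans eq (act-act (suc k) j h zero))) (value (h + j) (small j≤k)))

-- A pair related by Kim-Pillay but not by Lascar equivalence

module NotGCompact
  (em : ∀ {ℓ} → ExcludedMiddle ℓ)
  (fe : ∀ {a b} → Extensionality a b)
  where
  open Classical em fe
  open Ordinals em fe
  open Presented em fe
  open Generic em fe
  open Logic em fe {ℒ}
  open Monster em fe
  open Saturation em fe
  open Configurations em fe

  private
    Seq : Set₁
    Seq = ℕ → On

  Constant : (ℕ → ℕ) → Seq → Set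
  Constant k x = constant k ≡ pull x 𝕆

  Pair : (ℕ → ℕ) → (ℕ → ℕ) → Seq → Seq → Set
  Pair k l x y = two k l ≡ pull [ x , y ]′ 𝕆

  pair-left : ∀ {k l x y} → Pair k l x y → Constant k x
  pair-left {k} {l} eq = trans (sym (two-left k l)) (cong (pull inj₁) eq)

  pair-right : ∀ {k l x y} → Pair k l x y → Constant l y
  pair-right {k} {l} eq = trans (sym (two-right k l)) (cong (pull inj₂) eq)

  some-constant : ∀ k → ∃ (Constant k)
  some-constant k =
    let x , eq = copy (constant-IsK k) {⊥} ⊥-elim ⊥-elim
                   (Str-≡ (λ ()) (λ t → ⊥-elim (t zero)) (λ _ t → ⊥-elim (t zero))) id
    in x , cong (pull inj₂) eq

  some-pair : ∀ k l {x} → Constant k x → ∃ (Pair k l x)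
  some-pair k l {x} eq =
    let y , eq′ = copy (two-IsK k l) inj₁ x (trans (two-left k l) eq) inj₂
    in y , trans (pull-≗ (two k l) id [ inj₁ , inj₂ ]′ λ { (inj₁ _) → refl ; (inj₂ _) → refl }) eq′

  -- Mixed tuples get the colours k as well, so the added sequence completes a `Pair k k` over every
  -- constant sequence with colours k below it.
  module Top (k : ℕ → ℕ) = Sum 𝕆-IsK (constant-IsK k) (λ n → act n (k n) zero)

  module _ (k : ℕ → ℕ) {I : Set} (p : I → On) where
    open Top k

    Above : Seq → Set
    Above z = sum ↾ [ inj₁ ∘ p , inj₂ ]′ ~ 𝕆 ↾ [ p , z ]′

    above : ∃ Above
    above = copy sum-IsK (inj₁ ∘ p) p (cong (pull p) sum-left) inj₂

    above-constant : ∀ {z} → Above z → Constant k z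
    above-constant eq = trans (sym sum-right) (cong (pull inj₂) eq)

    above-pair : ∀ {z} → Above z → (f : ℕ → I) → Constant k (p ∘ f) → Pair k k (p ∘ f) z
    above-pair {z} eq f con = trans (sym flat) (trans
        (pull-≗ sum g ([ inj₁ ∘ p , inj₂ ]′ ∘ [ inj₁ ∘ f , inj₂ ]′)
          λ { (inj₁ _) → refl ; (inj₂ _) → refl }) (trans
        (cong (pull [ inj₁ ∘ f , inj₂ ]′) eq)
        (pull-≗ 𝕆 _ _ λ { (inj₁ _) → refl ; (inj₂ _) → refl })))
      where
      x : Seq
      x = p ∘ f
      x-inj : Inj x
      x-inj = agree-≡ 𝕆-IsK (constant-IsK k) x id (sym con)
      g : ℕ ⊎ ℕ → On ⊎ ℕ
      g = [ inj₁ ∘ x , inj₂ ]′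
      g-inj : Inj g
      g-inj (inj₁ i) (inj₁ j) e = cong inj₁ (x-inj i j (inj₁-injective e))
      g-inj (inj₂ i) (inj₂ .i) refl = refl
      in-left : ∀ {J : Set} {t : J → ℕ ⊎ ℕ} {u} → g ∘ t ≡ inj₁ ∘ u → ∃ λ s → t ≡ inj₁ ∘ s × u ≡ x ∘ s
      in-left {t = t} {u} e = proj₁ ∘ at , fe (proj₁ ∘ proj₂ ∘ at) , fe (proj₂ ∘ proj₂ ∘ at)
        where
        single : ∀ v {o} → g v ≡ inj₁ o → ∃ λ i → v ≡ inj₁ i × o ≡ x i
        single (inj₁ i) refl = i , refl , refl
        at = λ j → single (t j) (cong (λ h → h j) e)
      in-right : ∀ {J : Set} {t : J → ℕ ⊎ ℕ} {u} → g ∘ t ≡ inj₂ ∘ u → t ≡ inj₂ ∘ u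
      in-right {t = t} e = fe λ j → single (t j) (cong (λ h → h j) e)
        where
        single : ∀ v {o} → g v ≡ inj₂ o → v ≡ inj₂ o
        single (inj₂ _) refl = refl
      flat : pull g sum ≡ two k k
      flat = Str-≡ lt-eq (λ t → truth-false⁺ (unrelated t)) col-eq
        where
        lt-eq : ∀ i j → lt sum (g i) (g j) ≡ ω+ω i j
        lt-eq (inj₁ i) (inj₁ j) = sym (cong (λ S → lt S i j) con)
        lt-eq (inj₁ _) (inj₂ _) = refl
        lt-eq (inj₂ _) (inj₁ _) = refl
        lt-eq (inj₂ _) (inj₂ _) = refl
        unrelated : ∀ t → ¬ Related (g ∘ t)
        unrelated t (inj₁ (u , e , d)) with in-left {t = t} e
        ... | s , _ , refl = true≢false d (sym (cong (λ S → dd S s) con))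
        unrelated t (inj₂ (_ , _ , ()))
        col-eq : ∀ n t → colour n (g ∘ t) ≡ if-inj t (act n (sides k k (t zero) n) zero) zero
        col-eq n t = by-cases em em
          where
          from-left : ∀ {u} → (∃ λ s → t ≡ inj₁ ∘ s × u ≡ x ∘ s) →
                      col 𝕆 n u ≡ if-inj t (act n (sides k k (t zero) n) zero) zero
          from-left (s , refl , refl) = trans (sym (cong (λ S → col S n s) con))
            (sym (cong (λ S → col S n s) (two-left k k)))
          from-right : ∀ {u} → t ≡ inj₂ ∘ u →
                       col (constant k) n u ≡ if-inj t (act n (sides k k (t zero) n) zero) zero
          from-right {u} refl = sym (cong (λ S → col S n u) (two-right k k))
          same-sides : ∀ v → k ≡ sides k k v
          same-sides (inj₁ _) = refl
          same-sides (inj₂ _) = refl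
          by-cases : Dec (Left (g ∘ t)) → Dec (Right (g ∘ t)) →
                     colour n (g ∘ t) ≡ if-inj t (act n (sides k k (t zero) n) zero) zero
          by-cases (yes (u , e)) _ = trans (cong (colour n) e)
            (trans (colour-left n u) (from-left (in-left {t = t} e)))
          by-cases (no _) (yes (u , e)) = trans (cong (colour n) e)
            (trans (colour-right n u) (from-right (in-right {t = t} e)))
          by-cases (no ¬l) (no ¬r) = trans (colour-mixed n (g ∘ t) ¬l ¬r)
            (if-inj-cong (inj-∘⁻ g t) (inj-∘ g-inj) λ _ → cong (λ z → act n (z n) zero) (same-sides (t zero)))

  -- Moving x across the cut raises its colours by one.
  rotated-pair : ∀ {k x z u v} → Pair k k x z → Pair k (suc ∘ k) u v → [ z , x ]′ ≈ [ u , v ]′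
  rotated-pair {k} {x} {z} {u} {v} xz uv = turned J low (λ _ → 0) (trans flat uv)
    where
    J : On → Bool
    J o = truth (∃ λ i → lt 𝕆 (x i) o ≡ false)
    low : Lower 𝕆 J
    low o o′ o<o′ p = let i , q = truth⁻ p in
      truth⁺ (i , ≢true⇒false λ r → true≢false (lt-trans 𝕆-IsK _ _ _ r o<o′) q)
    J-x : ∀ i → J (x i) ≡ true
    J-x i = truth⁺ (i , lt-irrefl 𝕆-IsK (x i))
    J-z : ∀ i → J (z i) ≡ false
    J-z i = truth-false⁺ λ (j , p) → true≢false (sym (cong (λ S → lt S (inj₁ j) (inj₂ i)) xz)) p
    zx : ℕ ⊎ ℕ → On
    zx = [ z , x ]′
    zx-swap : zx ≡ [ x , z ]′ ∘ swap
    zx-swap = fe λ { (inj₁ _) → refl ; (inj₂ _) → refl }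
    zx-type : pull zx 𝕆 ≡ pull swap (two k k)
    zx-type = trans (cong (λ f → pull f 𝕆) zx-swap) (cong (pull swap) (sym xz))
    flat : pull zx (rotate 𝕆 J (λ _ → 0)) ≡ two k (suc ∘ k)
    flat = Str-≡ lt-eq (λ t → cong (λ S → dd S t) zx-type) col-eq
      where
      rotated : ∀ i j {b c} → J (zx i) ≡ b → J (zx j) ≡ c →
                rotate-lt (J (zx i)) (J (zx j)) (lt 𝕆 (zx i) (zx j)) ≡ rotate-lt b c (ω+ω (swap i) (swap j))
      rotated i j refl refl = cong (rotate-lt (J (zx i)) (J (zx j))) (cong (λ S → lt S i j) zx-type)
      lt-eq : ∀ i j → rotate-lt (J (zx i)) (J (zx j)) (lt 𝕆 (zx i) (zx j)) ≡ ω+ω i j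
      lt-eq (inj₁ i) (inj₁ j) = rotated (inj₁ i) (inj₁ j) (J-z i) (J-z j)
      lt-eq (inj₁ i) (inj₂ j) = rotated (inj₁ i) (inj₂ j) (J-z i) (J-x j)
      lt-eq (inj₂ i) (inj₁ j) = rotated (inj₂ i) (inj₁ j) (J-x i) (J-z j)
      lt-eq (inj₂ i) (inj₂ j) = rotated (inj₂ i) (inj₂ j) (J-x i) (J-x j)
      zx-inj : Inj zx
      zx-inj i j e = trans (sym (swap² i)) (trans (cong swap
        (agree-≡ 𝕆-IsK (two-IsK k k) [ x , z ]′ id (sym xz) (swap i) (swap j)
          (trans (sym (cong (λ f → f i) zx-swap)) (trans e (cong (λ f → f j) zx-swap))))) (swap² j))
        where
        swap² : ∀ (i : ℕ ⊎ ℕ) → swap (swap i) ≡ i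
        swap² (inj₁ _) = refl
        swap² (inj₂ _) = refl
      swap-inj : Inj (swap {A = ℕ} {B = ℕ})
      swap-inj (inj₁ _) (inj₁ _) refl = refl
      swap-inj (inj₂ _) (inj₂ _) refl = refl
      col-eq : ∀ n t → if-inj (zx ∘ t) (act n (bit (J (zx (t zero)))) (col 𝕆 n (zx ∘ t))) zero
                       ≡ if-inj t (act n (sides k (suc ∘ k) (t zero) n) zero) zero
      col-eq n t = if-inj-cong (inj-∘⁻ zx t) (inj-∘ zx-inj) λ i →
        trans (cong (act n _) (trans (cong (λ S → col S n t) zx-type)
                (if-inj-yes (inj-∘ swap-inj (inj-∘⁻ zx t i)))))
          (trans (act-act n _ (sides k k (swap (t zero)) n) zero) (cong (λ m → act n m zero) (raise (t zero))))
        where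
        raise : ∀ s → sides k k (swap s) n + bit (J (zx s)) ≡ sides k (suc ∘ k) s n
        raise (inj₁ i) = trans (cong (λ b → k n + bit b) (J-z i)) (ℕ.+-identityʳ (k n))
        raise (inj₂ i) = trans (cong (λ b → k n + bit b) (J-x i)) (ℕ.+-comm (k n) 1)

  module BoundedInvariant {E : TupleRel ℂ ω} (bie : BoundedInvariantEq ℂ ω E) where
    open IsEquivalence (proj₁ bie) renaming (refl to E-refl; sym to E-sym; trans to E-trans)
    private
      bounded : Bounded ℂ ω E
      bounded = proj₁ (proj₂ bie)

    -- An elementary map between small families extends to an automorphism, under which E is
    -- invariant.
    moves : ∀ {I : Set} {f g : I → On} → Elem ℂ f ℂ g → (i j : ℕ → I) → E (f ∘ i) (f ∘ j) → E (g ∘ i) (g ∘ j)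
    moves el i j e = let σ , eq = automorphism el in
      subst₂ E (fe (eq ∘ i)) (fe (eq ∘ j)) (proj₂ (proj₂ bie) σ _ _ e)

    -- Two copies of the same type, each placed in the same way over representatives of all the
    -- classes, lie in the same class.
    related-pair : ∀ k → ∃ λ x → ∃ λ z → Pair k k x z × E x z
    related-pair k = x , z , above-pair k p′ z-above inj₂ (above-constant k p x-above) ,
        E-trans near (E-sym (moves (~⇒elem same) inj₂ (λ n → inj₁ (i , n)) near))
      where
      J : Set
      J = proj₁ bounded
      p : J × ℕ → On
      p (i , n) = proj₁ (proj₂ bounded) i n
      x : Seq
      x = proj₁ (above k p)
      x-above = proj₂ (above k p)
      p′ : (J × ℕ) ⊎ ℕ → On
      p′ = [ p , x ]′
      z : Seq
      z = proj₁ (above k p′)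
      z-above = proj₂ (above k p′)
      i = proj₁ (proj₂ (proj₂ bounded) x)
      near : E x (λ n → p (i , n))
      near = proj₂ (proj₂ (proj₂ bounded) x)
      open Top k using (sum)
      skip : (J × ℕ) ⊎ ℕ → ((J × ℕ) ⊎ ℕ) ⊎ ℕ
      skip = [ inj₁ ∘ inj₁ , inj₂ ]′
      same : 𝕆 ↾ [ p , x ]′ ~ 𝕆 ↾ [ p , z ]′
      same = trans (sym x-above) (trans
        (pull-≗ sum [ inj₁ ∘ p , inj₂ ]′ ([ inj₁ ∘ p′ , inj₂ ]′ ∘ skip)
          λ { (inj₁ _) → refl ; (inj₂ _) → refl }) (trans
        (cong (pull skip) z-above)
        (pull-≗ 𝕆 _ _ λ { (inj₁ _) → refl ; (inj₂ _) → refl })))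

    pairs-related : ∀ {k x z} → Pair k k x z → E x z
    pairs-related {k} eq = let _ , _ , eq′ , e = related-pair k in
      moves (~⇒elem (trans (sym eq′) eq)) inj₁ inj₂ e

    -- A related `Pair k k` with its lower member carried across the cut has the elementary type of
    -- (u, v).
    successors-related : ∀ {k u v} → Pair k (suc ∘ k) u v → E u v
    successors-related {k} uv = let _ , _ , eq , e = related-pair k in
      moves (≈⇒elem (rotated-pair eq uv)) inj₁ inj₂ (E-sym e)

    -- Nothing is known about the position of x relative to y, so a third sequence above both
    -- mediates.
    constants-related : ∀ {k x y} → Constant k x → Constant k y → E x y
    constants-related {k} {x} {y} cx cy =
      let z , eq = above k [ x , y ]′ in
      E-trans (pairs-related (above-pair k [ x , y ]′ eq inj₁ cx))
        (E-sym (pairs-related (above-pair k [ x , y ]′ eq inj₂ cy)))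

    all-constants-related : ∀ m {x y} → Constant (λ _ → 0) x → Constant (λ _ → m) y → E x y
    all-constants-related zero    cx cy = constants-related cx cy
    all-constants-related (suc m) cx cy =
      let u , cu = some-constant (λ _ → m)
          v , uv = some-pair (λ _ → m) (λ _ → suc m) cu
      in E-trans (all-constants-related m cx cu)
           (E-trans (successors-related uv) (constants-related (pair-right uv) cy))

  α₀ β₀ : Seq
  α₀ = proj₁ (some-constant λ _ → 0)
  β₀ = proj₁ (some-pair (λ _ → 0) half (proj₂ (some-constant λ _ → 0)))

  α₀-β₀ : Pair (λ _ → 0) half α₀ β₀
  α₀-β₀ = proj₂ (some-pair (λ _ → 0) half (proj₂ (some-constant λ _ → 0)))

  -- A formula in n variables cannot tell the colours half m, m < n, from the integer half n.
  definably-related : ∀ {E} → BoundedTypeDefinableEq ℂ ω E → E α₀ β₀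
  definably-related {E} (eq , bounded , Φ , def) = Equivalence.from (def α₀ β₀) λ (n , φ , v) Φφ →
    let d , ad = some-pair (λ _ → 0) (λ _ → half n) (pair-left α₀-β₀)
        e = BoundedInvariant.all-constants-related (eq , bounded , invariant) (half n)
              (pair-left α₀-β₀) (pair-right ad)
    in preserves (~⇒elem (trans (cong (pull v) (sym ad)) (trans (agree v) (cong (pull v) α₀-β₀)))) φ id
         (Equivalence.to (def α₀ d) e (n , φ , v) Φφ)
    where
    open FinestRelations em fe ℂ ℂ-homogeneous ω using (definable⇒invariant)
    invariant : Invariant ℂ ω E
    invariant = definable⇒invariant (Φ , def)
    agree : ∀ {n} (v : Vector (ℕ ⊎ ℕ) n) → pull v (two (λ _ → 0) (λ _ → half n)) ≡ pull v (two (λ _ → 0) half)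
    agree {n} v = Str-≡ (λ _ _ → refl) (λ _ → refl) λ m t → if-inj-cong id id λ i → by-side m t i (v (t zero))
      where
      by-side : ∀ m (t : Vector (Fin n) (suc m)) → Inj (v ∘ t) → ∀ s →
                act m (sides (λ _ → 0) (λ _ → half n) s m) zero ≡ act m (sides (λ _ → 0) half s m) zero
      by-side m t i (inj₁ _) = refl
      by-side m t i (inj₂ _) = let j , eq = half-coherent m≤n in
          trans (cong (λ h → act m h zero) eq) (act-multiple m j (half m) zero)
        where
        m≤n : m ≤ n
        m≤n = ℕ.≮⇒≥ λ n<m → let x , y , x<y , eq = pigeonhole (ℕ.<-trans n<m (ℕ.n<1+n m)) t in
          <⇒≢ x<y (i x y (cong v eq))

  Linking : Seq → Seq → On → Set
  Linking α β w = ∀ i j → dd 𝕆 (five w (α i) (β i) (α j) (β j)) ≡ true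

  -- The rule for links says nothing about non-injective sequences; lumping them together keeps the
  -- number of classes small without touching the others.
  Step : TupleRel ℂ ω
  Step α β = (¬ Inj α × ¬ Inj β) ⊎ (Inj α × Inj β × ∃ (Linking α β))

  Steps : TupleRel ℂ ω
  Steps = EqClosure Step

  steps-invariant : Invariant ℂ ω Steps
  steps-invariant σ α β = EqClosure.gmap (to ∘_) step
    where
    open _≅_ σ
    to-inj : Inj to
    to-inj x y eq = trans (sym (Inverse.inverseʳ bijection refl))
      (trans (cong from eq) (Inverse.inverseʳ bijection refl))
    step : ∀ {α β} → Step α β → Step (to ∘ α) (to ∘ β)
    step {α} {β} (inj₁ (p , q)) = inj₁ (p ∘ inj-∘⁻ to α , q ∘ inj-∘⁻ to β)
    step {α} {β} (inj₂ (p , q , w , l)) = inj₂ (inj-∘ to-inj p , inj-∘ to-inj q , to w , λ i j →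
      trans (sym (cong (dd 𝕆) (five-map to _ _ _ _ _)))
        (lower (Equivalence.to (pres-relation zero (five w (α i) (β i) (α j) (β j))) (lift (l i j)))))

  initial : Seq → ∀ n → Vector On (suc n)
  initial α n = α ∘ toℕ

  -- The bound k does not depend on the cover n: it reflects the length of a chain, which is the
  -- same for all covers.
  Near : TupleRel ℂ ω
  Near α β = (Inj α → Inj β) × (Inj β → Inj α) ×
    (Inj α → ∃ λ k → ∀ n → Close n k (col 𝕆 n (initial α n)) (col 𝕆 n (initial β n)))

  near-equivalence : IsEquivalence Near
  near-equivalence = record
    { refl  = id , id , λ _ → 0 , λ n → 0 , 0 , z≤n , z≤n , refl
    ; sym   = λ (f , g , h) → g , f , λ i → let k , p = h (g i) in k , λ n →
        let x , y , x≤k , y≤k , eq = p n in y , x , y≤k , x≤k , sym eq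
    ; trans = λ (f , g , h) (f′ , g′ , h′) → f′ ∘ f , g ∘ g′ , λ i →
        let k , p = h i ; k′ , p′ = h′ (f i) in k + k′ , λ n →
        let x , y , x≤k , y≤k , eq = p n ; x′ , y′ , x′≤k′ , y′≤k′ , eq′ = p′ n in
        x + x′ , y′ + y , ℕ.+-mono-≤ x≤k x′≤k′ ,
        ℕ.≤-trans (ℕ.+-mono-≤ y′≤k′ y≤k) (ℕ.≤-reflexive (ℕ.+-comm k′ k)) ,
        compose n x y x′ y′ eq eq′
    }
    where
    compose : ∀ n x y x′ y′ {c d e} → act n x c ≡ act n y d → act n x′ d ≡ act n y′ e →
              act n (x + x′) c ≡ act n (y′ + y) e
    compose n x y x′ y′ {c} {d} {e} p q = begin
      act n (x + x′) c        ≡⟨ act-act n x′ x c ⟨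
      act n x′ (act n x c)    ≡⟨ cong (act n x′) p ⟩
      act n x′ (act n y d)    ≡⟨ act-act n x′ y d ⟩
      act n (y + x′) d        ≡⟨ cong (λ z → act n z d) (ℕ.+-comm y x′) ⟩
      act n (x′ + y) d        ≡⟨ act-act n y x′ d ⟨
      act n y (act n x′ d)    ≡⟨ cong (act n y) q ⟩
      act n y (act n y′ e)    ≡⟨ act-act n y y′ e ⟩
      act n (y′ + y) e        ∎
      where open ≡-Reasoning

  steps-near : ∀ {α β} → Steps α β → Near α β
  steps-near = EqClosure.fold near-equivalence near
    where
    bit≤1 : ∀ x → bit x ≤ 1
    bit≤1 true  = s≤s z≤n
    bit≤1 false = z≤n
    near : ∀ {α β} → Step α β → Near α β
    near (inj₁ (p , q)) = ⊥-elim ∘ p , ⊥-elim ∘ q , ⊥-elim ∘ p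
    near {α} {β} (inj₂ (p , q , w , l)) = const q , const p , λ _ → 1 , λ n →
      0 , bit (lt 𝕆 (β 0) (α 0)) , z≤n , bit≤1 _ ,
      trans (act-0 n _) (sym (linked 𝕆-IsK n (initial α n) (initial β n) w
        (inj-∘ p λ _ _ → toℕ-injective) (inj-∘ q λ _ _ → toℕ-injective) λ i j → l (toℕ i) (toℕ j)))

  not-steps : ¬ Steps α₀ β₀
  not-steps steps =
    let k , near = proj₂ (proj₂ (steps-near steps)) α₀-inj in
    half-far k (subst₂ (Close (suc k) k)
      (trans (colour-at inj₁ (λ _ _ → inj₁-injective) (suc k)) (act-0 (suc k) zero))
      (colour-at inj₂ (λ _ _ → inj₂-injective) (suc k)) (near (suc k)))
    where
    α₀-inj : Inj α₀
    α₀-inj = agree-≡ 𝕆-IsK (constant-IsK (λ _ → 0)) α₀ id (sym (pair-left α₀-β₀))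
    colour-at : (f : ℕ → ℕ ⊎ ℕ) → Inj f → ∀ n →
      col 𝕆 n (initial ([ α₀ , β₀ ]′ ∘ f) n) ≡ act n (sides (λ _ → 0) half (f 0) n) zero
    colour-at f f-inj n = trans (sym (cong (λ S → col S n (f ∘ toℕ)) α₀-β₀))
      (if-inj-yes (inj-∘ f-inj λ _ _ → toℕ-injective))

  -- As γ lies above α, no cut is crossed from α to γ, and equal colours make corresponding tuples
  -- adjacent. So the rule permits a new point that links the whole of α to γ.
  module Linker (α γ : Seq) (same : ∀ n t → col 𝕆 n (α ∘ t) ≡ col 𝕆 n (γ ∘ t))
                (below : ∀ i j → lt 𝕆 (α i) (γ j) ≡ true) where

    Old : ∀ {n} → Vector (Maybe On) n → Set₁
    Old {n} t = Σ (Vector On n) λ u → t ≡ just ∘ u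

    link : ℕ → ℕ → Vector (Maybe On) 5
    link i j = five nothing (just (α i)) (just (γ i)) (just (α j)) (just (γ j))

    Related : Vector (Maybe On) 5 → Set₁
    Related t = (∃ λ u → t ≡ just ∘ u × dd 𝕆 u ≡ true) ⊎ (∃ λ i → ∃ λ j → t ≡ link i j)

    top-lt : Maybe On → Maybe On → Bool
    top-lt (just x) (just y) = lt 𝕆 x y
    top-lt (just x) nothing  = true
    top-lt nothing  _        = false

    colour : ∀ n → Vector (Maybe On) (suc n) → Colour n
    colour n t with em {P = Old t}
    ... | yes (u , _) = col 𝕆 n u
    ... | no _        = zero

    linker : Str (Maybe On)
    linker = record { lt = top-lt ; dd = λ t → truth (Related t) ; col = colour }

    just∘-injective : ∀ {n} (s t : Vector On n) → just ∘ s ≡ just ∘ t → s ≡ t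
    just∘-injective s t eq = fe λ i → just-injective (cong (λ f → f i) eq)

    linker-extends : pull just linker ≡ 𝕆
    linker-extends = Str-≡ (λ _ _ → refl)
      (λ t → bool-≡ (from t ∘ truth⁻) λ p → truth⁺ (inj₁ (t , refl , p))) col-eq
      where
      from : ∀ t → Related (just ∘ t) → dd 𝕆 t ≡ true
      from t (inj₁ (u , eq , p)) = trans (cong (dd 𝕆) (just∘-injective t u eq)) p
      from t (inj₂ (_ , _ , eq)) = case cong (λ f → f zero) eq of λ ()
      col-eq : ∀ n t → colour n (just ∘ t) ≡ col 𝕆 n t
      col-eq n t with em {P = Old (just ∘ t)}
      ... | yes (u , eq) = cong (col 𝕆 n) (sym (just∘-injective t u eq))
      ... | no none      = ⊥-elim (none (t , refl))

    linker-IsK : IsK linker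
    linker-IsK = record
      { lt-irrefl = λ { (just x) → lt-irrefl 𝕆-IsK x ; nothing → refl }
      ; lt-trans  = λ where
          (just x) (just y) (just z) p q → lt-trans 𝕆-IsK x y z p q
          (just x) (just y) nothing  p q → refl
      ; lt-conn   = λ where
          (just x) (just y) p q → cong just (lt-conn 𝕆-IsK x y p q)
          nothing  nothing  p q → refl
      ; col-zero  = zero⁺
      ; linked    = λ n e e′ w i i′ l → linked⁺ w n e e′ i i′ l
      }
      where
      third fourth : Fin 5
      third  = suc (suc (suc zero))
      fourth = suc (suc (suc (suc zero)))
      zero⁺ : ∀ n e → ¬ Inj e → colour n e ≡ zero
      zero⁺ n e ¬i with em {P = Old e}
      ... | yes (u , refl) = col-zero 𝕆-IsK n u (¬i ∘ inj-∘ just-inj)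
      ... | no _           = refl
      linked⁺ : ∀ w n e e′ → Inj e → Inj e′ → Linked linker w e e′ → Adjacent linker n e e′
      linked⁺ (just w) n e e′ i i′ l = linked-along linker just 𝕆-IsK linker-extends n {w₁ = w}
          {λ j → proj₁ (old j) third} {λ j → proj₁ (old j) fourth}
          refl (fe λ j → cong (λ f → f third) (proj₂ (old j)))
          (fe λ j → cong (λ f → f fourth) (proj₂ (old j))) i i′ l
        where
        old : ∀ j → Old (five (just w) (e zero) (e′ zero) (e j) (e′ j))
        old j with truth⁻ {P = Related (five (just w) (e zero) (e′ zero) (e j) (e′ j))} (l zero j)
        ... | inj₁ (u , eq , _) = u , eq
        ... | inj₂ (_ , _ , eq) = case cong (λ f → f zero) eq of λ ()
      linked⁺ nothing n e e′ i i′ l = subst₂ (Adjacent linker n) (sym e≡) (sym e′≡) (begin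
          act n (bit (lt 𝕆 (γ (s zero)) (α (s zero)))) (colour n (just ∘ γ ∘ s))
            ≡⟨ cong₂ (λ x → act n (bit x)) (lt-asym 𝕆-IsK _ _ (below (s zero) (s zero)))
                 (trans (cong (λ S → col S n (γ ∘ s)) linker-extends) (sym (same n s))) ⟩
          act n 0 (col 𝕆 n (α ∘ s))        ≡⟨ act-0 n _ ⟩
          col 𝕆 n (α ∘ s)                  ≡⟨ cong (λ S → col S n (α ∘ s)) linker-extends ⟨
          colour n (just ∘ α ∘ s)          ∎)
        where
        open ≡-Reasoning
        -- The diagonal quintuples already show that both tuples are the same selection s of
        -- indices, from α and from γ.
        position : ∀ j → ∃ λ i → e j ≡ just (α i) × e′ j ≡ just (γ i)
        position j with truth⁻ {P = Related (five nothing (e j) (e′ j) (e j) (e′ j))} (l j j)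
        ... | inj₁ (_ , eq , _) = case cong (λ f → f zero) eq of λ ()
        ... | inj₂ (i , _ , eq) = i , cong (λ f → f (suc zero)) eq , cong (λ f → f (suc (suc zero))) eq
        s : Vector ℕ (suc n)
        s = proj₁ ∘ position
        e≡ : e ≡ just ∘ α ∘ s
        e≡ = fe (proj₁ ∘ proj₂ ∘ position)
        e′≡ : e′ ≡ just ∘ γ ∘ s
        e′≡ = fe (proj₂ ∘ proj₂ ∘ position)

    linking : ∃ (Linking α γ)
    linking =
      let w , eq = one-point linker-IsK (just ∘ [ α , γ ]′) [ α , γ ]′
                     (cong (pull [ α , γ ]′) linker-extends) nothing
          name : ℕ → ℕ → Vector (Maybe (ℕ ⊎ ℕ)) 5
          name i j = five nothing (just (inj₁ i)) (just (inj₂ i)) (just (inj₁ j)) (just (inj₂ j))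
      in w , λ i j → trans (cong (dd 𝕆) (sym (five-map (maybe′ [ α , γ ]′ w) _ _ _ _ _)))
           (trans (sym (cong (λ S → dd S (name i j)) eq))
             (truth⁺ (inj₂ (i , j , five-map (maybe′ (just ∘ [ α , γ ]′) nothing) _ _ _ _ _))))

  -- Sequences with the same colours are two steps apart, via a copy of either on top of both.
  steps-bounded : Bounded ℂ ω Steps
  steps-bounded = Maybe Colours , representative , cover
    where
    Colours : Set
    Colours = ∀ n → Vector ℕ (suc n) → Colour n
    colours : Seq → Colours
    colours α n t = col 𝕆 n (α ∘ t)
    default : Seq
    default _ = ordinal (sup ⊥ λ ())
    representative : Maybe Colours → Seq
    representative nothing  = default
    representative (just c) = choose (λ β → Inj β × colours β ≡ c) default
    open Sum 𝕆-IsK 𝕆-IsK (λ n → zero)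
    meet-above : ∀ {α β} → Inj α → Inj β → colours β ≡ colours α → Steps α β
    meet-above {α} {β} i j eq =
      EqClosure.transitive Step (EqClosure.return (inj₂ (i , γ-inj , link-α)))
        (EqClosure.symmetric Step (EqClosure.return (inj₂ (j , γ-inj , link-β))))
      where
      p : ℕ ⊎ ℕ → On
      p = [ α , β ]′
      copied : ∃ λ γ → sum ↾ [ inj₁ ∘ p , inj₂ ∘ α ]′ ~ 𝕆 ↾ [ p , γ ]′
      copied = copy sum-IsK (inj₁ ∘ p) p (cong (pull p) sum-left) (inj₂ ∘ α)
      γ : Seq
      γ = proj₁ copied
      γ-type : 𝕆 ↾ α ~ 𝕆 ↾ γ
      γ-type = trans (cong (pull α) (sym sum-right)) (cong (pull inj₂) (proj₂ copied))
      γ-inj : Inj γ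
      γ-inj x y e = i x y (agree-≡ 𝕆-IsK 𝕆-IsK γ α (sym γ-type) x y e)
      γ-colours : ∀ n t → col 𝕆 n (α ∘ t) ≡ col 𝕆 n (γ ∘ t)
      γ-colours n t = cong (λ S → col S n t) γ-type
      under : ∀ s j → lt 𝕆 (p s) (γ j) ≡ true
      under s j = sym (cong (λ S → lt S (inj₁ s) (inj₂ j)) (proj₂ copied))
      link-α : ∃ (Linking α γ)
      link-α = Linker.linking α γ γ-colours (λ x → under (inj₁ x))
      link-β : ∃ (Linking β γ)
      link-β = Linker.linking β γ (λ n t → trans (cong (λ c → c n t) eq) (γ-colours n t))
                 (λ x → under (inj₂ x))
    cover : ∀ α → ∃ λ c → Steps α (representative c)
    cover α = by-cases em
      where
      by-cases : Dec (Inj α) → ∃ λ c → Steps α (representative c)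
      by-cases (no ¬i) = nothing , EqClosure.return (inj₁ (¬i , λ i → case i 0 1 refl of λ ()))
      by-cases (yes i) =
        let j , eq = choose-spec {P = λ β → Inj β × colours β ≡ colours α} default (α , i , refl)
        in just (colours α) , meet-above i j eq

  not-G-compact : ¬ GCompact (Th N)
  not-G-compact compact = not-steps (proj₂ Lascar-finest Steps
      (EqClosure.isEquivalence Step , steps-bounded , steps-invariant)
      (proj₂ agree λ P bounded-definable → definably-related bounded-definable))
    where
    open FinestRelations em fe ℂ ℂ-homogeneous ω
    agree = compact ℂ ℂ-monster ω Lascar KimPillay Lascar-finest KimPillay-finest

proposition4 :
    (∀ {ℓ} → ExcludedMiddle ℓ) →
    (∀ {a b} → Extensionality a b) →
    Σ Language λ L → IsFinite L ×
      (Σ (Structure L 0ℓ) λ N → CountablyCategorical N × ¬ GCompact (Th N))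
proposition4 em fe = ℒ , ℒ-finite , N , N-categorical , NotGCompact.not-G-compact em fe
  where open Saturation em fe
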